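{- Let $G$ be a finite simple graph. The connected subgraph arrangement $\mathcal{A}_G$ is factored if and only if it is inductively factored.
   Context: Let $G=(N,E)$ be a finite simple graph with vertex set $N=[n]$; $H_I:=\ker(\sum_{i\in I}x_i)\subseteq\mathbb{Q}^n$ and $\mathcal{A}_G:=\{H_I\mid \varnothing\neq I\subseteq N,\ G[I]\text{ connected}\}$. For $X$ in the intersection lattice, $\mathcal{A}_X:=\{H\in\mathcal{A}\mid X\subseteq H\}$. A partition $\pi=(\pi_1,\dots,\pi_s)$ of $\mathcal{A}$ is independent if any choice $H_i\in\pi_i$ ($1\le i\le s$) gives hyperplanes with $\mathrm{codim}(H_1\cap\dots\cap H_s)=s$; it is nice (a factorization) if it is independent and for every $X\in L(\mathcal{A})\setminus\{V\}$ the induced partition of $\mathcal{A}_X$ (nonempty blocks $\pi_i\cap\mathcal{A}_X$) has a block which is a singleton; $\mathcal{A}$ is factored if it admits a nice partition. For $H_0\in\mathcal{A}$ let $\mathcal{A}'=\mathcal{A}\setminus\{H_0\}$ and $\mathcal{A}''=\{H\cap H_0\mid H\in\mathcal{A}'\}$ (an arrangement in $H_0$). The class of inductively factored pairs $(\mathcal{A},\pi)$ is the smallest class such that (i) $(\Phi_\ell,(\varnothing))$ (empty arrangement with empty partition) is in it for all $\ell\ge0$; (ii) if $\pi=(\pi_1,\dots,\pi_s)$ is a partition of $\mathcal{A}$ and $H_0\in\pi_1$ is such that the restriction map $\mathcal{A}\setminus\pi_1\to\mathcal{A}''$, $H\mapsto H\cap H_0$, is bijective, and both $(\mathcal{A}',\pi')$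 and $(\mathcal{A}'',\pi'')$ are in the class, where $\pi'$ has the nonempty blocks $\pi_i\cap\mathcal{A}'$ and $\pi''=(\pi''_2,\dots,\pi''_s)$ with $\pi''_i=\{H\cap H_0\mid H\in\pi_i\}$, then $(\mathcal{A},\pi)$ is in the class. $\mathcal{A}$ is inductively factored if $(\mathcal{A},\pi)$ is in the class for some partition $\pi$. -}

module Defs where

open import Data.Fin.Base using (Fin)
open import Data.Fin.Properties using (_≟_; all?)
open import Data.Fin.Subset using (Subset; inside; outside; Nonempty) renaming (_∈_ to _∈ₛ_)
open import Data.Fin.Subset.Properties using (nonempty?) renaming (_∈?_ to _∈ₛ?_)
open import Data.List.Base
  using (List; []; _∷_; allFin; cartesianProductWith; filter; foldr; length; lookup; map; removeAt)
open import Data.List.Membership.Propositional.Properties using (∈-allFin)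
import Data.List.Membership.Propositional as Propositional
import Data.List.Membership.Setoid as Membership
import Data.List.Relation.Binary.Disjoint.Setoid as Disjointness
import Data.List.Relation.Binary.Subset.Setoid as Inclusion
open import Data.List.Relation.Binary.Pointwise.Base using (Pointwise)
open import Data.List.Relation.Unary.All using (All)
open import Data.List.Relation.Unary.AllPairs using (AllPairs)
open import Data.List.Relation.Unary.Any using (Any; here; there)
open import Data.Nat.Base using (ℕ; zero; suc)
import Data.Nat.Base as ℕ
open import Data.Product.Base using (∃; _×_; _,_)
open import Data.Rational.Base using (ℚ; 0ℚ; _+_; _*_)
open import Data.Sum.Base using (_⊎_; inj₁; inj₂)
open import Data.Vec.Base using (Vec; []; _∷_; replicate; zipWith)
import Data.Vec.Base as Vec
open import Function.Bundles using (_⇔_)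
open import Level using (0ℓ)
open import Relation.Binary.Core using (Rel)
open import Relation.Binary.Construct.Closure.ReflexiveTransitive using (Star; ε; _◅_; _◅◅_)
open import Relation.Binary.Definitions using (Decidable; Symmetric; Irreflexive)
open import Relation.Binary.PropositionalEquality.Core using (_≡_; refl)
open import Relation.Nullary.Decidable using (Dec; map′; _×-dec_; _⊎-dec_; _→-dec_)
open import Relation.Nullary.Negation.Core using (¬_)
open import Relation.Unary using (Pred; U; _∩_; _⊆_; _≐_)
open import Relation.Unary.Relation.Binary.Equality using (≐-setoid)

------------------------------------------------------------------------
-- Graphs

record SimpleGraph (n : ℕ) : Set₁ where
  field
    Adj         : Rel (Fin n) 0ℓ
    adj?        : Decidable Adj
    symmetric   : Symmetric Adj
    irreflexive : Irreflexive _≡_ Adj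

module _ {n : ℕ} (G : SimpleGraph n) where
  open SimpleGraph G

  InducedAdj : Subset n → Rel (Fin n) 0ℓ
  InducedAdj I u v = u ∈ₛ I × v ∈ₛ I × Adj u v

  InducedConnected : Subset n → Set
  InducedConnected I = ∀ u → u ∈ₛ I → ∀ v → v ∈ₛ I → Star (InducedAdj I) u v

-- Reachability by walks is decided as in Warshall's algorithm: `Via xs u v`
-- says that there is a walk from u to v whose interior vertices lie in xs.

module _ {n : ℕ} {R : Rel (Fin n) 0ℓ} (R? : Decidable R) where
  open Propositional using (_∈_)

  private
    Via : List (Fin n) → Rel (Fin n) 0ℓ
    Via []       u v = u ≡ v ⊎ R u v
    Via (x ∷ xs) u v = Via xs u v ⊎ (Via xs u x × Via xs x v)

    via? : ∀ xs → Decidable (Via xs)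
    via? []       u v = u ≟ v ⊎-dec R? u v
    via? (x ∷ xs) u v = via? xs u v ⊎-dec (via? xs u x ×-dec via? xs x v)

    via⇒star : ∀ xs {u v} → Via xs u v → Star R u v
    via⇒star []       (inj₁ refl)    = ε
    via⇒star []       (inj₂ r)       = r ◅ ε
    via⇒star (x ∷ xs) (inj₁ p)       = via⇒star xs p
    via⇒star (x ∷ xs) (inj₂ (p , q)) = via⇒star xs p ◅◅ via⇒star xs q

    via-base : ∀ xs {u v} → u ≡ v ⊎ R u v → Via xs u v
    via-base []       p = p
    via-base (x ∷ xs) p = inj₁ (via-base xs p)

    via-trans : ∀ xs {u w v} → w ∈ xs → Via xs u w → Via xs w v → Via xs u v
    via-trans (x ∷ xs) (here refl) p q = inj₂ (toHead p , fromHead q)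
      where
      toHead : ∀ {u} → Via (x ∷ xs) u x → Via xs u x
      toHead (inj₁ p)       = p
      toHead (inj₂ (p , _)) = p

      fromHead : ∀ {v} → Via (x ∷ xs) x v → Via xs x v
      fromHead (inj₁ q)       = q
      fromHead (inj₂ (_ , q)) = q
    via-trans (x ∷ xs) (there w∈xs) (inj₁ p)       (inj₁ q)       = inj₁ (via-trans xs w∈xs p q)
    via-trans (x ∷ xs) (there w∈xs) (inj₁ p)       (inj₂ (q , r)) = inj₂ (via-trans xs w∈xs p q , r)
    via-trans (x ∷ xs) (there w∈xs) (inj₂ (p , q)) (inj₁ r)       = inj₂ (p , via-trans xs w∈xs q r)
    via-trans (x ∷ xs) (there w∈xs) (inj₂ (p , _)) (inj₂ (_ , r)) = inj₂ (p , r)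

    star⇒via : ∀ {u v} → Star R u v → Via (allFin n) u v
    star⇒via ε       = via-base (allFin n) (inj₁ refl)
    star⇒via (r ◅ p) =
      via-trans (allFin n) (∈-allFin _) (via-base (allFin n) (inj₂ r)) (star⇒via p)

  star? : Decidable (Star R)
  star? u v = map′ (via⇒star (allFin n)) star⇒via (via? (allFin n) u v)

module _ {n : ℕ} (G : SimpleGraph n) where
  open SimpleGraph G

  inducedAdj? : ∀ I → Decidable (InducedAdj G I)
  inducedAdj? I u v = u ∈ₛ? I ×-dec v ∈ₛ? I ×-dec adj? u v

  inducedConnected? : ∀ I → Dec (InducedConnected G I)
  inducedConnected? I =
    all? λ u → u ∈ₛ? I →-dec all? λ v → v ∈ₛ? I →-dec star? (inducedAdj? I) u v

subsets : ∀ n → List (Subset n)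
subsets zero    = [] ∷ []
subsets (suc n) = cartesianProductWith _∷_ (inside ∷ outside ∷ []) (subsets n)

------------------------------------------------------------------------
-- Linear algebra in ℚⁿ

-- A linear subspace is represented by its set of vectors; that the set is
-- closed under the vector space operations is part of having a dimension.

Subspace : ℕ → Set₁
Subspace n = Pred (Vec ℚ n) 0ℓ

0ᵥ : ∀ {n} → Vec ℚ n
0ᵥ = replicate _ 0ℚ

_+ᵥ_ : ∀ {n} → Vec ℚ n → Vec ℚ n → Vec ℚ n
_+ᵥ_ = zipWith _+_

_*ᵥ_ : ∀ {n} → ℚ → Vec ℚ n → Vec ℚ n
c *ᵥ v = Vec.map (c *_) v

linComb : ∀ {n d} → Vec ℚ d → Vec (Vec ℚ n) d → Vec ℚ n
linComb []       []       = 0ᵥ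
linComb (c ∷ cs) (v ∷ vs) = (c *ᵥ v) +ᵥ linComb cs vs

LinearlyIndependent : ∀ {n d} → Vec (Vec ℚ n) d → Set
LinearlyIndependent vs = ∀ cs → linComb cs vs ≡ 0ᵥ → cs ≡ 0ᵥ

Span : ∀ {n d} → Vec (Vec ℚ n) d → Subspace n
Span vs x = ∃ λ cs → linComb cs vs ≡ x

HasDim : ∀ {n} → Subspace n → ℕ → Set
HasDim {n} V d = ∃ λ (vs : Vec (Vec ℚ n) d) → LinearlyIndependent vs × V ≐ Span vs

HasCodimIn : ∀ {n} → Subspace n → Subspace n → ℕ → Set
HasCodimIn V X s = X ⊆ V × ∃ λ d → HasDim V (s ℕ.+ d) × HasDim X d

sumOver : ∀ {n} → Subset n → Vec ℚ n → ℚ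
sumOver []            []       = 0ℚ
sumOver (inside  ∷ I) (x ∷ xs) = x + sumOver I xs
sumOver (outside ∷ I) (x ∷ xs) = sumOver I xs

------------------------------------------------------------------------
-- Arrangements

-- Finite sets of subspaces are lists up to mutual membership, where subspaces
-- are compared by extensional equality _≐_.  The ambient vector space of an
-- arrangement is a subspace V of ℚⁿ: V = U is ℚⁿ itself, and the restriction
-- to H₀ has ambient space H₀.

module _ {n : ℕ} where
  open Membership (≐-setoid (Vec ℚ n) 0ℓ) public using (_∈_; _∉_)
  open Inclusion (≐-setoid (Vec ℚ n) 0ℓ) public using () renaming (_⊆_ to _⊆ₗ_)
  open Disjointness (≐-setoid (Vec ℚ n) 0ℓ) public using (Disjoint)

IsHyperplaneIn : ∀ {n} → Subspace n → Subspace n → Set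
IsHyperplaneIn V H = HasCodimIn V H 1

record IsArrangement {n} (V : Subspace n) (A : List (Subspace n)) : Set₁ where
  field
    finiteDimensional : ∃ λ d → HasDim V d
    hyperplanes       : All (IsHyperplaneIn V) A

⋂ : ∀ {n} → Subspace n → List (Subspace n) → Subspace n
⋂ V Hs = foldr _∩_ V Hs

InLattice : ∀ {n} → Subspace n → List (Subspace n) → Subspace n → Set₁
InLattice V A X = ∃ λ Hs → Hs ⊆ₗ A × X ≐ ⋂ V Hs

hyperplane : ∀ {n} → Subset n → Subspace n
hyperplane I x = sumOver I x ≡ 0ℚ

connectedSubgraphArrangement : ∀ {n} → SimpleGraph n → List (Subspace n)
connectedSubgraphArrangement {n} G =
  map hyperplane (filter (λ I → nonempty? I ×-dec inducedConnected? G I) (subsets n))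

------------------------------------------------------------------------
-- Partitions

record IsPartition {n} (A : List (Subspace n)) (π : List (List (Subspace n))) : Set₁ where
  field
    nonempty : All (λ B → ∃ λ H → H ∈ B) π
    disjoint : AllPairs Disjoint π
    covers   : ∀ H → H ∈ A ⇔ Any (H ∈_) π

IsIndependent : ∀ {n} → Subspace n → List (List (Subspace n)) → Set₁
IsIndependent V π = ∀ Hs → Pointwise _∈_ Hs π → HasCodimIn V (⋂ V Hs) (length π)

-- B ∩ A_X consists of exactly one hyperplane; since π partitions A, every
-- member of a block B of π is in A.

IsSingletonAt : ∀ {n} → Subspace n → List (Subspace n) → Set₁
IsSingletonAt X B = ∃ λ H → (H ∈ B × X ⊆ H) × (∀ K → K ∈ B → X ⊆ K → K ≐ H)

record IsNice {n} (V : Subspace n) (A : List (Subspace n)) (π : List (List (Subspace n))) : Set₁ where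
  field
    independent : IsIndependent V π
    singleton   : ∀ X → InLattice V A X → ¬ X ≐ V → Any (IsSingletonAt X) π

Factored : ∀ {n} → Subspace n → List (Subspace n) → Set₁
Factored V A = IsArrangement V A × ∃ λ π → IsPartition A π × IsNice V A π

------------------------------------------------------------------------
-- Inductively factored arrangements

IsDeletion : ∀ {n} → List (Subspace n) → Subspace n → List (Subspace n) → Set₁
IsDeletion A H₀ A′ = ∀ H → H ∈ A′ ⇔ (H ∈ A × ¬ H ≐ H₀)

restrict : ∀ {n} → Subspace n → List (Subspace n) → List (Subspace n)
restrict H₀ = map (_∩ H₀)

-- As π′ covers A′ and has nonempty blocks, its blocks are exactly the
-- nonempty sets B ∩ A′ with B in π.

record IsInducedPartition {n} (π : List (List (Subspace n)))
                          (A′ : List (Subspace n)) (π′ : List (List (Subspace n))) : Set₁ where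
  field
    isPartition : IsPartition A′ π′
    blocks      : All (λ B′ → Any (λ B → ∀ H → H ∈ B′ ⇔ (H ∈ B × H ∈ A′)) π) π′

record RestrictionBijective {n} (A B : List (Subspace n)) (H₀ : Subspace n)
                            (A″ : List (Subspace n)) : Set₁ where
  field
    injective  : ∀ H K → H ∈ A → H ∉ B → K ∈ A → K ∉ B → (H ∩ H₀) ≐ (K ∩ H₀) → H ≐ K
    surjective : ∀ K → K ∈ A″ → ∃ λ H → H ∈ A × H ∉ B × K ≐ (H ∩ H₀)

-- The blocks of a partition carry no preferred order, so the distinguished
-- block may stand at any position i.

data IsInductivelyFactoredPair {n} :
       Subspace n → List (Subspace n) → List (List (Subspace n)) → Set₁ where
  empty : ∀ {V d} → HasDim V d → IsInductivelyFactoredPair V [] []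
  step  : ∀ {V A π} H₀ (i : Fin (length π)) A′ π′ →
          IsArrangement V A →
          IsPartition A π →
          H₀ ∈ lookup π i →
          IsDeletion A H₀ A′ →
          IsInducedPartition π A′ π′ →
          RestrictionBijective A (lookup π i) H₀ (restrict H₀ A′) →
          IsInductivelyFactoredPair V A′ π′ →
          IsInductivelyFactoredPair H₀ (restrict H₀ A′) (map (restrict H₀) (removeAt π i)) →
          IsInductivelyFactoredPair V A π

InductivelyFactored : ∀ {n} → Subspace n → List (Subspace n) → Set₁
InductivelyFactored V A = ∃ λ π → IsInductivelyFactoredPair V A π

{-# OPTIONS --safe #-}

-- An inductively factored pair is nice, by induction on its derivation: a transversal or a flat
-- either contains H₀ and is handled in the restriction, or it is already one of the deletion.
--
-- Conversely, a nice partition of A_G colours the connected sets of G.  At a flat of rank two the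
-- colours must split as one against the rest, and this localises to induced minors (disjoint
-- connected parts), of which the claw, the square, the diamond, K₄ and the butterfly cannot be
-- coloured.  A longest induced path shows that without these minors every component of G is a path
-- or a kite, that is, a path with a triangle at its end.  The arrangement of such a graph is built
-- from the end of the path towards its beginning: the connected sets starting at a new vertex t
-- form a new block, and two of them differ by an older connected set, so restricting to one of
-- them gives back the older arrangement.  For a kite with end triangle u, a, b the sets leading
-- from t to a do not fit into that block; they are added to the block of a and b.

module Submission where

open import Defs
open import Data.Bool.Base as Bool using (Bool; true; false; _∧_; _∨_; T)
import Data.Bool.Properties as Bool
open import Data.Empty using (⊥; ⊥-elim)
open import Data.Fin.Base using (Fin; zero; suc; toℕ; punchIn; punchOut)
import Data.Fin.Properties as Fin
open import Data.Fin.Subset using (Subset; inside; outside; Nonempty; _∪_; ∁; ⁅_⁆) renaming (_∈_ to _∈ₛ_; _∉_ to _∉ₛ_; _∩_ to _∩ₛ_; ⊥ to ⊥ₛ)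
open import Data.Fin.Subset.Properties using (nonempty?; ⊆-antisym; ∉⊥; x∈⁅x⁆; x∈⁅y⁆⇒x≡y; x∈p∪q⁻; x∈p∪q⁺; x∈p∩q⁺; x∈p∩q⁻; x∉p⇒x∈∁p; x∈∁p⇒x∉p) renaming (_∈?_ to _∈ₛ?_)
open import Data.List.Base using (List; []; _∷_; [_]; _++_; _∷ʳ_; concat; filter; length; lookup; map; removeAt; reverse; tabulate)
import Data.List.Membership.DecPropositional as DecMembership
open import Data.List.Membership.Propositional using (find; lose) renaming (_∈_ to _∈ₚ_; _∉_ to _∉ₚ_)
open import Data.List.Membership.Propositional.Properties using (∈-++⁺ˡ; ∈-++⁺ʳ; ∈-++⁻; ∈-cartesianProductWith⁺; ∈-filter⁺; ∈-filter⁻; ∈-lookup; ∈-map⁺)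
import Data.List.Properties as List
open import Data.List.Relation.Binary.Pointwise as Pointwise using (Pointwise; []; _∷_)
open import Data.List.Relation.Unary.All as All using (All; []; _∷_)
import Data.List.Relation.Unary.All.Properties as All
open import Data.List.Relation.Unary.AllPairs as AllPairs using (AllPairs; []; _∷_)
import Data.List.Relation.Unary.AllPairs.Properties as AllPairs
open import Data.List.Relation.Unary.Any as Any using (Any; here; there)
import Data.List.Relation.Unary.Any.Properties as Any
open import Data.Maybe.Base using (Maybe; just; nothing)
open import Data.Nat.Base as ℕ using (ℕ; zero; suc; _≤_; _<_; z≤n; s≤s)
import Data.Nat.Properties as ℕ
open import Data.Product.Base using (∃; ∃₂; _×_; _,_; proj₁; proj₂)
open import Data.Rational.Base using (ℚ; 0ℚ; 1ℚ; ½; _+_; _*_; -_; 1/_; NonZero; ≢-nonZero)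
open import Data.Rational.Properties using (_≟_; +-assoc; +-comm; +-identityˡ; +-identityʳ; *-identityˡ; *-identityʳ; *-inverseˡ; *-zeroˡ; *-zeroʳ)
open import Data.Rational.Solver
open import Data.Sum.Base as Sum using (_⊎_; inj₁; inj₂)
open import Data.Unit.Base using (⊤; tt)
open import Data.Vec.Base as Vec using (Vec; []; _∷_; _[_]≔_)
open import Data.Vec.Properties as Vec using ([]=⇒lookup; lookup⇒[]=; lookup-map; lookup-replicate; lookup-zipWith; lookup∘tabulate; lookup∘update; lookup∘update′; ∷-injectiveˡ; ∷-injectiveʳ)
open import Data.Vec.Relation.Binary.Pointwise.Extensional using (ext; Pointwise-≡⇒≡)
open import Function.Base using (_∘_; id)
open import Function.Bundles using (_⇔_; mk⇔; Equivalence)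
open import Relation.Binary.Construct.Closure.ReflexiveTransitive as Star using (Star; ε; _◅_; _◅◅_)
open import Relation.Binary.PropositionalEquality using (_≡_; _≢_; refl; sym; trans; cong; cong₂; subst; subst₂; module ≡-Reasoning)
open import Relation.Nullary using (¬_; Dec; yes; no; does)
open import Relation.Nullary.Decidable using (_×-dec_; _⊎-dec_; _→-dec_; ¬?; dec-true; from-yes; fromWitness; isYes; map′; toWitness)
open import Relation.Unary using (U; _⊆_; _≐_; _∩_)
open import Relation.Unary.Properties using (≐-refl; ≐-sym; ≐-trans)

open +-*-Solver using (solve; _:+_; _:*_; :-_; _:=_; con)
open Equivalence using (to; from)

variable
  n m d e : ℕ

vec-ext : {x y : Vec ℚ n} → (∀ k → Vec.lookup x k ≡ Vec.lookup y k) → x ≡ y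
vec-ext p = Pointwise-≡⇒≡ (ext p)

lookup-+ᵥ : ∀ (x y : Vec ℚ n) k → Vec.lookup (x +ᵥ y) k ≡ Vec.lookup x k + Vec.lookup y k
lookup-+ᵥ x y k = lookup-zipWith _+_ k x y

lookup-*ᵥ : ∀ c (x : Vec ℚ n) k → Vec.lookup (c *ᵥ x) k ≡ c * Vec.lookup x k
lookup-*ᵥ c x k = lookup-map k (c *_) x

lookup-0ᵥ : ∀ (k : Fin n) → Vec.lookup 0ᵥ k ≡ 0ℚ
lookup-0ᵥ k = lookup-replicate k 0ℚ

-- Linear maps and forms

record LinearMap (n m : ℕ) : Set where
  field
    fun    : Vec ℚ n → Vec ℚ m
    +-homo : ∀ x y → fun (x +ᵥ y) ≡ fun x +ᵥ fun y
    *-homo : ∀ c x → fun (c *ᵥ x) ≡ c *ᵥ fun x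

record Form (n : ℕ) : Set where
  field
    fun    : Vec ℚ n → ℚ
    +-homo : ∀ x y → fun (x +ᵥ y) ≡ fun x + fun y
    *-homo : ∀ c x → fun (c *ᵥ x) ≡ c * fun x

infixl 20 _⟨_⟩
_⟨_⟩ : Form n → Vec ℚ n → ℚ
_⟨_⟩ = Form.fun

ker : Form n → Subspace n
ker f x = f ⟨ x ⟩ ≡ 0ℚ

coord : Fin n → Form n
coord k = record
  { fun = λ x → Vec.lookup x k ; +-homo = λ x y → lookup-+ᵥ x y k ; *-homo = λ c x → lookup-*ᵥ c x k }

_∘ᶠ_ : Form m → LinearMap n m → Form n
f ∘ᶠ φ = record
  { fun = λ x → f ⟨ LinearMap.fun φ x ⟩
  ; +-homo = λ x y → trans (cong (f ⟨_⟩) (LinearMap.+-homo φ x y)) (Form.+-homo f _ _)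
  ; *-homo = λ c x → trans (cong (f ⟨_⟩) (LinearMap.*-homo φ c x)) (Form.*-homo f c _) }

_·ᶠ_ : ℚ → Form n → Form n
a ·ᶠ f = record
  { fun = λ x → a * f ⟨ x ⟩
  ; +-homo = λ x y → trans (cong (a *_) (Form.+-homo f x y))
    (solve 3 (λ a b c → a :* (b :+ c) := a :* b :+ a :* c) refl a (f ⟨ x ⟩) (f ⟨ y ⟩))
  ; *-homo = λ c x → trans (cong (a *_) (Form.*-homo f c x))
    (solve 3 (λ a b c → a :* (b :* c) := b :* (a :* c)) refl a c (f ⟨ x ⟩)) }

form-0 : ∀ (f : Form n) → f ⟨ 0ᵥ ⟩ ≡ 0ℚ
form-0 {n} f = trans (cong (f ⟨_⟩) (vec-ext {n} λ k → trans (lookup-0ᵥ k)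
  (sym (trans (lookup-*ᵥ 0ℚ 0ᵥ k) (*-zeroˡ (Vec.lookup 0ᵥ k))))))
                 (trans (Form.*-homo f 0ℚ 0ᵥ) (*-zeroˡ (f ⟨ 0ᵥ ⟩)))

infixl 6 _-ᵥ_
_-ᵥ_ : Vec ℚ n → Vec ℚ n → Vec ℚ n
x -ᵥ y = x +ᵥ ((- 1ℚ) *ᵥ y)

lookup--ᵥ : ∀ (x y : Vec ℚ n) k → Vec.lookup (x -ᵥ y) k ≡ Vec.lookup x k + - 1ℚ * Vec.lookup y k
lookup--ᵥ x y k = trans (lookup-+ᵥ x _ k) (cong (Vec.lookup x k +_) (lookup-*ᵥ (- 1ℚ) y k))

form-+* : ∀ (f : Form n) x c y → f ⟨ x +ᵥ (c *ᵥ y) ⟩ ≡ f ⟨ x ⟩ + c * f ⟨ y ⟩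
form-+* f x c y = trans (Form.+-homo f x _) (cong (f ⟨ x ⟩ +_) (Form.*-homo f c y))

linComb-+ : ∀ (cs ds : Vec ℚ d) (vs : Vec (Vec ℚ n) d) →
            linComb (cs +ᵥ ds) vs ≡ linComb cs vs +ᵥ linComb ds vs
linComb-+ [] [] [] = vec-ext λ k → trans (lookup-0ᵥ k)
  (sym (trans (lookup-+ᵥ 0ᵥ 0ᵥ k) (cong₂ _+_ (lookup-0ᵥ k) (lookup-0ᵥ k))))
linComb-+ (c ∷ cs) (b ∷ bs) (v ∷ vs) = vec-ext λ k →
  let open ≡-Reasoning in begin
  Vec.lookup (((c + b) *ᵥ v) +ᵥ linComb (cs +ᵥ bs) vs) k
    ≡⟨ trans (lookup-+ᵥ ((c + b) *ᵥ v) _ k) (cong₂ _+_ (lookup-*ᵥ (c + b) v k)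
      (trans (cong (λ z → Vec.lookup z k) (linComb-+ cs bs vs)) (lookup-+ᵥ (linComb cs vs) (linComb bs vs) k))) ⟩
  (c + b) * Vec.lookup v k + (Vec.lookup (linComb cs vs) k + Vec.lookup (linComb bs vs) k)
    ≡⟨ solve 5 (λ c b v x y → (c :+ b) :* v :+ (x :+ y) := (c :* v :+ x) :+ (b :* v :+ y)) refl c b
      (Vec.lookup v k) (Vec.lookup (linComb cs vs) k) (Vec.lookup (linComb bs vs) k) ⟩
  (c * Vec.lookup v k + Vec.lookup (linComb cs vs) k) + (b * Vec.lookup v k + Vec.lookup (linComb bs vs) k)
    ≡⟨ sym (trans (lookup-+ᵥ ((c *ᵥ v) +ᵥ linComb cs vs) _ k) (cong₂ _+_
        (trans (lookup-+ᵥ (c *ᵥ v) _ k) (cong (_+ Vec.lookup (linComb cs vs) k) (lookup-*ᵥ c v k)))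
        (trans (lookup-+ᵥ (b *ᵥ v) _ k) (cong (_+ Vec.lookup (linComb bs vs) k) (lookup-*ᵥ b v k))))) ⟩
  Vec.lookup (((c *ᵥ v) +ᵥ linComb cs vs) +ᵥ ((b *ᵥ v) +ᵥ linComb bs vs)) k ∎

linComb-* : ∀ a (cs : Vec ℚ d) (vs : Vec (Vec ℚ n) d) → linComb (a *ᵥ cs) vs ≡ a *ᵥ linComb cs vs
linComb-* a [] [] = vec-ext λ k → trans (lookup-0ᵥ k) (sym
  (trans (lookup-*ᵥ a 0ᵥ k) (trans (cong (a *_) (lookup-0ᵥ k)) (*-zeroʳ a))))
linComb-* a (c ∷ cs) (v ∷ vs) = vec-ext λ k →
  let open ≡-Reasoning in begin
  Vec.lookup (((a * c) *ᵥ v) +ᵥ linComb (a *ᵥ cs) vs) k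
    ≡⟨ trans (lookup-+ᵥ ((a * c) *ᵥ v) _ k) (cong₂ _+_ (lookup-*ᵥ (a * c) v k)
      (trans (cong (λ z → Vec.lookup z k) (linComb-* a cs vs)) (lookup-*ᵥ a (linComb cs vs) k))) ⟩
  (a * c) * Vec.lookup v k + a * Vec.lookup (linComb cs vs) k
    ≡⟨ solve 4 (λ a c v x → (a :* c) :* v :+ a :* x := a :* (c :* v :+ x)) refl a c (Vec.lookup v k)
      (Vec.lookup (linComb cs vs) k) ⟩
  a * (c * Vec.lookup v k + Vec.lookup (linComb cs vs) k)
    ≡⟨ sym (trans (lookup-*ᵥ a ((c *ᵥ v) +ᵥ linComb cs vs) k)
      (cong (a *_) (trans (lookup-+ᵥ (c *ᵥ v) _ k) (cong (_+ Vec.lookup (linComb cs vs) k) (lookup-*ᵥ c v k))))) ⟩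
  Vec.lookup (a *ᵥ ((c *ᵥ v) +ᵥ linComb cs vs)) k ∎

linComb-0 : ∀ (vs : Vec (Vec ℚ n) d) → linComb 0ᵥ vs ≡ 0ᵥ
linComb-0 [] = refl
linComb-0 (v ∷ vs) = vec-ext λ k → trans (lookup-+ᵥ (0ℚ *ᵥ v) _ k)
  (trans (cong₂ _+_ (trans (lookup-*ᵥ 0ℚ v k) (*-zeroˡ (Vec.lookup v k)))
  (cong (λ z → Vec.lookup z k) (linComb-0 vs))) (+-identityˡ _))

0*ᵥ : ∀ (v : Vec ℚ n) → 0ℚ *ᵥ v ≡ 0ᵥ
0*ᵥ v = vec-ext λ k → trans (lookup-*ᵥ 0ℚ v k) (trans (*-zeroˡ (Vec.lookup v k)) (sym (lookup-0ᵥ k)))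

+ᵥ-identityˡ : ∀ (v : Vec ℚ n) → 0ᵥ +ᵥ v ≡ v
+ᵥ-identityˡ v = vec-ext λ k → trans (lookup-+ᵥ 0ᵥ v k) (trans (cong (_+ Vec.lookup v k) (lookup-0ᵥ k)) (+-identityˡ _))

+ᵥ-identityʳ : ∀ (v : Vec ℚ n) → v +ᵥ 0ᵥ ≡ v
+ᵥ-identityʳ v = vec-ext λ k → trans (lookup-+ᵥ v 0ᵥ k) (trans (cong (Vec.lookup v k +_) (lookup-0ᵥ k)) (+-identityʳ _))

1*ᵥ : ∀ (v : Vec ℚ n) → 1ℚ *ᵥ v ≡ v
1*ᵥ v = vec-ext λ k → trans (lookup-*ᵥ 1ℚ v k) (*-identityˡ _)

-ᵥ-self : ∀ (v : Vec ℚ n) → v -ᵥ v ≡ 0ᵥ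
-ᵥ-self v = vec-ext λ k → trans (lookup--ᵥ v v k) (trans
  (solve 1 (λ x → x :+ :- con 1ℚ :* x := con 0ℚ) refl (Vec.lookup v k)) (sym (lookup-0ᵥ k)))

zeroHead : ∀ c (v : Vec ℚ n) (cs : Vec ℚ d) vs → c ≡ 0ℚ → linComb (c ∷ cs) (v ∷ vs) ≡ linComb cs vs
zeroHead c v cs vs refl = trans (cong (_+ᵥ linComb cs vs) (0*ᵥ v)) (+ᵥ-identityˡ _)

independent-tail : ∀ {v : Vec ℚ n} {vs : Vec (Vec ℚ n) d} → LinearlyIndependent (v ∷ vs) → LinearlyIndependent vs
independent-tail {v = v} {vs} li cs eq = ∷-injectiveʳ (li (0ℚ ∷ cs) (trans (zeroHead 0ℚ v cs vs refl) eq))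

nonzero-coord : ∀ (x : Vec ℚ n) → x ≡ 0ᵥ ⊎ ∃ λ k → Vec.lookup x k ≢ 0ℚ
nonzero-coord [] = inj₁ refl
nonzero-coord (a ∷ x) with a ≟ 0ℚ | nonzero-coord x
... | no a≢0 | _ = inj₂ (zero , a≢0)
... | yes refl | inj₁ refl = inj₁ refl
... | yes refl | inj₂ (k , p) = inj₂ (suc k , p)

-- Coordinates with respect to an independent family

record Dual {n d} (vs : Vec (Vec ℚ n) d) : Set where
  field
    φ : LinearMap n d
    φ-comb : ∀ cs → LinearMap.fun φ (linComb cs vs) ≡ cs

  residual : LinearMap n n
  residual = record
    { fun = R
    ; +-homo = λ x y → vec-ext λ k →
        trans (lookup--ᵥ (x +ᵥ y) _ k)
        (trans (cong₂ (λ a b → a + - 1ℚ * b) (lookup-+ᵥ x y k)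
          (trans (cong (λ z → Vec.lookup z k) (trans (cong (λ z → linComb z vs) (φ.+-homo x y))
            (linComb-+ (φ.fun x) (φ.fun y) vs))) (lookup-+ᵥ (L x) (L y) k)))
        (trans (solve 4 (λ a b c e → (a :+ b) :+ :- con 1ℚ :* (c :+ e) := (a :+ :- con 1ℚ :* c) :+
          (b :+ :- con 1ℚ :* e)) refl (Vec.lookup x k) (Vec.lookup y k) (Vec.lookup (L x) k) (Vec.lookup (L y) k))
        (sym (trans (lookup-+ᵥ (R x) (R y) k) (cong₂ _+_ (lookup--ᵥ x (L x) k) (lookup--ᵥ y (L y) k))))))
    ; *-homo = λ c x → vec-ext λ k →
        trans (lookup--ᵥ (c *ᵥ x) _ k)
        (trans (cong₂ (λ a b → a + - 1ℚ * b) (lookup-*ᵥ c x k)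
          (trans (cong (λ z → Vec.lookup z k) (trans (cong (λ z → linComb z vs) (φ.*-homo c x))
            (linComb-* c (φ.fun x) vs))) (lookup-*ᵥ c (L x) k)))
        (trans (solve 3 (λ c a b → c :* a :+ :- con 1ℚ :* (c :* b) := c :* (a :+ :- con 1ℚ :* b)) refl c
          (Vec.lookup x k) (Vec.lookup (L x) k))
        (sym (trans (lookup-*ᵥ c (R x) k) (cong (c *_) (lookup--ᵥ x (L x) k)))))) }
    where
    module φ = LinearMap φ
    L R : Vec ℚ n → Vec ℚ n
    L x = linComb (φ.fun x) vs
    R x = x -ᵥ L x

  residual-comb : ∀ cs → LinearMap.fun residual (linComb cs vs) ≡ 0ᵥ
  residual-comb cs = trans (cong (λ z → linComb cs vs -ᵥ linComb z vs) (φ-comb cs)) (-ᵥ-self (linComb cs vs))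

  residual-0 : ∀ x → LinearMap.fun residual x ≡ 0ᵥ → linComb (LinearMap.fun φ x) vs ≡ x
  residual-0 x eq = vec-ext λ k →
    let a = Vec.lookup x k ; b = Vec.lookup (linComb (LinearMap.fun φ x) vs) k
        p : a + - 1ℚ * b ≡ 0ℚ
        p = trans (sym (lookup--ᵥ x _ k)) (trans (cong (λ z → Vec.lookup z k) eq) (lookup-0ᵥ k))
    in trans (solve 2 (λ a b → b := a :+ :- con 1ℚ :* (a :+ :- con 1ℚ :* b)) refl a b)
       (trans (cong (λ z → a + - 1ℚ * z) p) (solve 1 (λ a → a :+ :- con 1ℚ :* con 0ℚ := a) refl a))

  in-span? : ∀ x → Span vs x ⊎ ∃ λ (g : Form n) → (∀ y → Span vs y → g ⟨ y ⟩ ≡ 0ℚ) × g ⟨ x ⟩ ≢ 0ℚ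
  in-span? x with nonzero-coord (LinearMap.fun residual x)
  ... | inj₁ eq = inj₁ (LinearMap.fun φ x , residual-0 x eq)
  ... | inj₂ (k , nz) = inj₂ (coord k ∘ᶠ residual , (λ { y (cs , refl) →
    trans (cong (λ z → Vec.lookup z k) (residual-comb cs)) (lookup-0ᵥ k) }) , nz)

dual : ∀ (vs : Vec (Vec ℚ n) d) → LinearlyIndependent vs → Dual vs
dual [] li = record { φ = record { fun = λ _ → [] ; +-homo = λ _ _ → refl ; *-homo = λ _ _ → refl } ;
  φ-comb = λ { [] → refl } }
dual {n} {suc d} (v ∷ vs) li = go (in-span? v)
  where
  D = dual vs (independent-tail li)
  open Dual D
  module φ = LinearMap φ
  go : _ → Dual (v ∷ vs)
  go (inj₁ (cs , eq)) = ⊥-elim (bad (∷-injectiveˡ (li (- 1ℚ ∷ cs) (trans (cong (((- 1ℚ) *ᵥ v) +ᵥ_) eq) z))))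
    where
    z : ((- 1ℚ) *ᵥ v) +ᵥ v ≡ 0ᵥ
    z = vec-ext λ k → trans (lookup-+ᵥ ((- 1ℚ) *ᵥ v) v k)
      (trans (cong (_+ Vec.lookup v k) (lookup-*ᵥ (- 1ℚ) v k))
      (trans (solve 1 (λ x → :- con 1ℚ :* x :+ x := con 0ℚ) refl (Vec.lookup v k)) (sym (lookup-0ᵥ k))))
    bad : - 1ℚ ≢ 0ℚ
    bad ()
  go (inj₂ (h , h-vs , hv≢0)) = record { φ = ψ ; φ-comb = ψ-comb }
    where
    instance nz : NonZero (h ⟨ v ⟩)
             nz = ≢-nonZero hv≢0
    g : Form n
    g = (1/ (h ⟨ v ⟩)) ·ᶠ h
    gv : g ⟨ v ⟩ ≡ 1ℚ
    gv = *-inverseˡ (h ⟨ v ⟩)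
    g-vs : ∀ cs → g ⟨ linComb cs vs ⟩ ≡ 0ℚ
    g-vs cs = trans (cong (1/ (h ⟨ v ⟩) *_) (h-vs _ (cs , refl))) (*-zeroʳ (1/ (h ⟨ v ⟩)))
    tl : Vec ℚ n → Vec ℚ d
    tl x = φ.fun x +ᵥ ((- (g ⟨ x ⟩)) *ᵥ φ.fun v)
    tl-lookup : ∀ x k → Vec.lookup (tl x) k ≡ Vec.lookup (φ.fun x) k + - (g ⟨ x ⟩) * Vec.lookup (φ.fun v) k
    tl-lookup x k = trans (lookup-+ᵥ (φ.fun x) _ k) (cong (Vec.lookup (φ.fun x) k +_)
      (lookup-*ᵥ (- (g ⟨ x ⟩)) (φ.fun v) k))
    ψ : LinearMap n (suc d)
    ψ = record
      { fun = λ x → g ⟨ x ⟩ ∷ tl x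
      ; +-homo = λ x y → cong₂ _∷_ (Form.+-homo g x y) (vec-ext λ k →
          trans (tl-lookup (x +ᵥ y) k) (trans (cong₂ (λ a b → a + - b * Vec.lookup (φ.fun v) k)
            (trans (cong (λ z → Vec.lookup z k) (φ.+-homo x y)) (lookup-+ᵥ (φ.fun x) (φ.fun y) k)) (Form.+-homo g x y))
          (trans (solve 5 (λ a b c e f → (a :+ b) :+ :- (c :+ e) :* f := (a :+ :- c :* f) :+
            (b :+ :- e :* f)) refl (Vec.lookup (φ.fun x) k) (Vec.lookup (φ.fun y) k) (g ⟨ x ⟩) (g ⟨ y ⟩)
            (Vec.lookup (φ.fun v) k))
          (sym (trans (lookup-+ᵥ (tl x) (tl y) k) (cong₂ _+_ (tl-lookup x k) (tl-lookup y k)))))))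
      ; *-homo = λ c x → cong₂ _∷_ (Form.*-homo g c x) (vec-ext λ k →
          trans (tl-lookup (c *ᵥ x) k) (trans (cong₂ (λ a b → a + - b * Vec.lookup (φ.fun v) k)
            (trans (cong (λ z → Vec.lookup z k) (φ.*-homo c x)) (lookup-*ᵥ c (φ.fun x) k)) (Form.*-homo g c x))
          (trans (solve 4 (λ c a b f → c :* a :+ :- (c :* b) :* f := c :* (a :+ :- b :* f)) refl c
            (Vec.lookup (φ.fun x) k) (g ⟨ x ⟩) (Vec.lookup (φ.fun v) k))
          (sym (trans (lookup-*ᵥ c (tl x) k) (cong (c *_) (tl-lookup x k))))))) }
    ψ-comb : ∀ cs → LinearMap.fun ψ (linComb cs (v ∷ vs)) ≡ cs
    ψ-comb (c ∷ cs) = cong₂ _∷_ gx (vec-ext λ k →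
        trans (tl-lookup x k)
        (trans (cong₂ (λ a b → a + - b * Vec.lookup (φ.fun v) k)
          (trans (cong (λ z → Vec.lookup z k) (trans (φ.+-homo (c *ᵥ v) (linComb cs vs))
            (cong₂ _+ᵥ_ (φ.*-homo c v) (φ-comb cs))))
                 (trans (lookup-+ᵥ (c *ᵥ φ.fun v) cs k) (cong (_+ Vec.lookup cs k) (lookup-*ᵥ c (φ.fun v) k)))) gx)
        (solve 3 (λ c f s → (c :* f :+ s) :+ :- c :* f := s) refl c (Vec.lookup (φ.fun v) k) (Vec.lookup cs k))))
      where
      x = linComb (c ∷ cs) (v ∷ vs)
      gx : g ⟨ x ⟩ ≡ c
      gx = trans (Form.+-homo g (c *ᵥ v) (linComb cs vs))
        (trans (cong₂ _+_ (trans (Form.*-homo g c v) (cong (c *_) gv)) (g-vs cs))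
        (solve 1 (λ c → c :* con 1ℚ :+ con 0ℚ := c) refl c))

hasDim-resp : ∀ {V W : Subspace n} → V ≐ W → HasDim V d → HasDim W d
hasDim-resp (V⊆W , W⊆V) (vs , li , p , q) = vs , li , (λ w → p (W⊆V w)) , (λ s → V⊆W (q s))

-- Cutting a subspace by a linear form

linComb-killed : ∀ (g : Form n) (cs : Vec ℚ d) vs → (∀ i → g ⟨ Vec.lookup vs i ⟩ ≡ 0ℚ) → g ⟨ linComb cs vs ⟩ ≡ 0ℚ
linComb-killed g [] [] k = form-0 g
linComb-killed g (c ∷ cs) (v ∷ vs) k =
  trans (Form.+-homo g (c *ᵥ v) _) (cong₂ _+_ (trans (Form.*-homo g c v)
    (trans (cong (c *_) (k zero)) (*-zeroʳ c))) (linComb-killed g cs vs (k ∘ suc)))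

record Cut {n d} (vs : Vec (Vec ℚ n) d) (g : Form n) : Set where
  field
    w    : Vec ℚ n
    w∈   : Span vs w
    gw≡1 : g ⟨ w ⟩ ≡ 1ℚ
    {d′} : ℕ
    d≡   : d ≡ suc d′
    us   : Vec (Vec ℚ n) d′
    li   : LinearlyIndependent us
    cut  : (Span vs ∩ ker g) ≐ Span us

cut : ∀ (vs : Vec (Vec ℚ n) d) → LinearlyIndependent vs → (g : Form n) →
      (∀ i → g ⟨ Vec.lookup vs i ⟩ ≡ 0ℚ) ⊎ Cut vs g
cut [] li g = inj₁ λ ()
cut {n} (v ∷ vs) li g with cut vs (independent-tail li) g
... | inj₁ killed with g ⟨ v ⟩ ≟ 0ℚ
...   | yes gv≡0 = inj₁ λ { zero → gv≡0 ; (suc i) → killed i }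
...   | no gv≢0 = inj₂ (record
  { w = (1/ (g ⟨ v ⟩)) *ᵥ v
  ; w∈ = ((1/ (g ⟨ v ⟩)) ∷ 0ᵥ) , trans (cong (((1/ (g ⟨ v ⟩)) *ᵥ v) +ᵥ_) (linComb-0 vs)) (+ᵥ-identityʳ _)
  ; gw≡1 = trans (Form.*-homo g (1/ (g ⟨ v ⟩)) v) (*-inverseˡ (g ⟨ v ⟩))
  ; d≡ = refl ; us = vs ; li = independent-tail li
  ; cut = forth , λ { (cs , refl) → ((0ℚ ∷ cs) , zeroHead 0ℚ v cs vs refl) , linComb-killed g cs vs killed } })
  where
  instance nz : NonZero (g ⟨ v ⟩)
           nz = ≢-nonZero gv≢0
  forth : (Span (v ∷ vs) ∩ ker g) ⊆ Span vs
  forth ((c ∷ cs , refl) , gx) = cs , sym (zeroHead c v cs vs c≡0)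
    where
    p : c * g ⟨ v ⟩ ≡ 0ℚ
    p = trans (solve 1 (λ z → z := z :+ con 0ℚ) refl (c * g ⟨ v ⟩))
      (trans (sym (trans (Form.+-homo g (c *ᵥ v) _) (cong₂ _+_ (Form.*-homo g c v)
      (linComb-killed g cs vs killed)))) gx)
    c≡0 : c ≡ 0ℚ
    c≡0 = trans (solve 3 (λ c a b → c := c :* (con 1ℚ :+ :- (b :* a)) :+ b :* (c :* a)) refl c (g ⟨ v ⟩) (1/ (g ⟨ v ⟩)))
          (trans (cong₂ (λ y z → c * (1ℚ + - y) + (1/ (g ⟨ v ⟩)) * z) (*-inverseˡ (g ⟨ v ⟩)) p)
          (solve 2 (λ c b → c :* (con 1ℚ :+ :- con 1ℚ) :+ b :* con 0ℚ := con 0ℚ) refl c (1/ (g ⟨ v ⟩))))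
cut {n} (v ∷ vs) li g | inj₂ C = inj₂ (record
  { w = w ; w∈ = let (cs , eq) = w∈ in (0ℚ ∷ cs) , trans (zeroHead 0ℚ v cs vs refl) eq
  ; gw≡1 = gw≡1 ; d≡ = cong suc d≡ ; us = u ∷ us ; li = li′ ; cut = forth , back })
  where
  open Cut C renaming (li to li-us; cut to cut-us)
  ws = proj₁ w∈
  γ : ℚ
  γ = g ⟨ v ⟩
  u : Vec ℚ n
  u = v +ᵥ ((- γ) *ᵥ w)
  gu : g ⟨ u ⟩ ≡ 0ℚ
  gu = trans (form-+* g v (- γ) w) (trans (cong (λ z → γ + - γ * z) gw≡1)
    (solve 1 (λ a → a :+ :- a :* con 1ℚ := con 0ℚ) refl γ))
  expand : ∀ c {es x} → linComb es vs ≡ x → (c *ᵥ u) +ᵥ x ≡ linComb (c ∷ (es +ᵥ ((c * - γ) *ᵥ ws))) (v ∷ vs)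
  expand c {es} {x} refl = vec-ext λ k →
    let lw : Vec.lookup (linComb ((c * - γ) *ᵥ ws) vs) k ≡ (c * - γ) * Vec.lookup w k
        lw = trans (cong (λ z → Vec.lookup z k) (linComb-* (c * - γ) ws vs))
          (trans (lookup-*ᵥ (c * - γ) (linComb ws vs) k) (cong (λ z → (c * - γ) * Vec.lookup z k) (proj₂ w∈)))
    in trans (lookup-+ᵥ (c *ᵥ u) x k)
       (trans (cong (_+ Vec.lookup x k) (trans (lookup-*ᵥ c u k)
         (cong (c *_) (trans (lookup-+ᵥ v _ k) (cong (Vec.lookup v k +_) (lookup-*ᵥ (- γ) w k))))))
       (trans (solve 5 (λ c v a w x → c :* (v :+ :- a :* w) :+ x := c :* v :+ (x :+ (c :* :- a) :* w)) refl
         c (Vec.lookup v k) γ (Vec.lookup w k) (Vec.lookup x k))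
       (sym (trans (lookup-+ᵥ (c *ᵥ v) _ k) (cong₂ _+_ (lookup-*ᵥ c v k)
          (trans (cong (λ z → Vec.lookup z k) (linComb-+ es ((c * - γ) *ᵥ ws) vs))
            (trans (lookup-+ᵥ (linComb es vs) _ k) (cong (Vec.lookup x k +_) lw))))))))
  us⊆vs : ∀ es → Span vs (linComb es us)
  us⊆vs es = proj₁ (proj₂ cut-us (es , refl))
  li′ : LinearlyIndependent (u ∷ us)
  li′ (c ∷ es) eq = cong₂ _∷_ c≡0 (li-us es (trans (sym (zeroHead c u es us c≡0)) eq))
    where
    c≡0 : c ≡ 0ℚ
    c≡0 = ∷-injectiveˡ (li (c ∷ (proj₁ (us⊆vs es) +ᵥ ((c * - γ) *ᵥ ws)))
      (trans (sym (expand c {proj₁ (us⊆vs es)} (proj₂ (us⊆vs es)))) eq))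
  back : Span (u ∷ us) ⊆ (Span (v ∷ vs) ∩ ker g)
  back (c ∷ es , refl) = ((c ∷ (proj₁ (us⊆vs es) +ᵥ ((c * - γ) *ᵥ ws))) ,
    sym (expand c {proj₁ (us⊆vs es)} (proj₂ (us⊆vs es)))) ,
    trans (Form.+-homo g (c *ᵥ u) _) (cong₂ _+_ (trans (Form.*-homo g c u)
      (trans (cong (c *_) gu) (*-zeroʳ c))) (proj₂ (proj₂ cut-us (es , refl))))
  forth : (Span (v ∷ vs) ∩ ker g) ⊆ Span (u ∷ us)
  forth ((c ∷ es , refl) , gx) = (c ∷ fs) , trans (cong ((c *ᵥ u) +ᵥ_) (proj₂ y∈us)) (vec-ext λ k →
        trans (lookup-+ᵥ (c *ᵥ u) y k)
        (trans (cong₂ _+_ (trans (lookup-*ᵥ c u k) (cong (c *_)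
          (trans (lookup-+ᵥ v _ k) (cong (Vec.lookup v k +_) (lookup-*ᵥ (- γ) w k)))))
                          (trans (lookup-+ᵥ (linComb es vs) _ k) (cong (Vec.lookup (linComb es vs) k +_)
                            (lookup-*ᵥ (c * γ) w k))))
        (trans (solve 5 (λ c v a w x → c :* (v :+ :- a :* w) :+ (x :+ (c :* a) :* w) := c :* v :+ x) refl c
          (Vec.lookup v k) γ (Vec.lookup w k) (Vec.lookup (linComb es vs) k))
        (sym (trans (lookup-+ᵥ (c *ᵥ v) _ k) (cong (_+ Vec.lookup (linComb es vs) k) (lookup-*ᵥ c v k)))))))
    where
    y : Vec ℚ n
    y = linComb es vs +ᵥ ((c * γ) *ᵥ w)
    gy : g ⟨ y ⟩ ≡ 0ℚ
    gy = trans (form-+* g (linComb es vs) (c * γ) w) (trans (cong (λ z → g ⟨ linComb es vs ⟩ + (c * γ) * z) gw≡1)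
         (trans (solve 3 (λ c a x → x :+ (c :* a) :* con 1ℚ := c :* a :+ x) refl c γ (g ⟨ linComb es vs ⟩))
         (trans (sym (trans (Form.+-homo g (c *ᵥ v) _) (cong (_+ g ⟨ linComb es vs ⟩) (Form.*-homo g c v)))) gx)))
    y∈ : Span vs y
    y∈ = (es +ᵥ ((c * γ) *ᵥ ws)) , trans (linComb-+ es _ vs)
      (cong (linComb es vs +ᵥ_) (trans (linComb-* (c * γ) ws vs) (cong ((c * γ) *ᵥ_) (proj₂ w∈))))
    y∈us = proj₁ cut-us (y∈ , gy)
    fs = proj₁ y∈us

Vanishes : Form n → Subspace n → Set
Vanishes g V = ∀ x → V x → g ⟨ x ⟩ ≡ 0ℚ

record ProperCut {n} (V : Subspace n) (d : ℕ) (g : Form n) : Set where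
  field
    w    : Vec ℚ n
    w∈V  : V w
    gw≡1 : g ⟨ w ⟩ ≡ 1ℚ
    {d′} : ℕ
    d≡   : d ≡ suc d′
    dim  : HasDim (V ∩ ker g) d′

hasDim-cut : ∀ {V : Subspace n} → HasDim V d → (g : Form n) → Vanishes g V ⊎ ProperCut V d g
hasDim-cut (vs , li , forth , back) g with cut vs li g
... | inj₁ killed = inj₁ λ x x∈V → let (cs , eq) = forth x∈V in trans (cong (g ⟨_⟩) (sym eq)) (linComb-killed g cs vs killed)
... | inj₂ C = inj₂ (record { w = w ; w∈V = back w∈ ; gw≡1 = gw≡1 ; d≡ = d≡
        ; dim = us , Cut.li C , (λ { (x∈V , gx) → proj₁ cut′ (forth x∈V , gx) }) , λ s → let (a , b) = proj₂ cut′ s in back a , b })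
  where open Cut C renaming (cut to cut′)

hasDim-mono : ∀ {V W : Subspace n} → HasDim V d → HasDim W e → V ⊆ W → d ℕ.≤ e
hasDim-mono {d = zero} _ _ _ = z≤n
hasDim-mono {d = suc d} {e = zero} (v ∷ vs , li , forth , back) ([] , li′ , forth′ , back′) V⊆W =
  ⊥-elim (bad (∷-injectiveˡ (li (1ℚ ∷ 0ᵥ) v0)))
  where
  v∈ : Span (v ∷ vs) (linComb (1ℚ ∷ 0ᵥ) (v ∷ vs))
  v∈ = (1ℚ ∷ 0ᵥ) , refl
  v0 : linComb (1ℚ ∷ 0ᵥ) (v ∷ vs) ≡ 0ᵥ
  v0 with forth′ (V⊆W (back v∈))
  ... | [] , eq = sym eq
  bad : 1ℚ ≢ 0ℚ
  bad ()
hasDim-mono {n = n} {d = suc d} {e = suc e} {V} {W} V-dim (w ∷ ws , li , forth , back) V⊆W = go (hasDim-cut V-dim g)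
  where
  D = dual (w ∷ ws) li
  g : Form n
  g = coord zero ∘ᶠ Dual.φ D
  W∩g : (W ∩ ker g) ⊆ Span ws
  W∩g (x∈W , gx) with forth x∈W
  ... | (c ∷ cs) , refl = cs , sym (zeroHead c w cs ws (trans
    (sym (cong (λ z → Vec.lookup z zero) (Dual.φ-comb D (c ∷ cs)))) gx))
  ws-dim : HasDim (Span ws) e
  ws-dim = ws , independent-tail li , id , id
  go : Vanishes g V ⊎ ProperCut V (suc d) g → suc d ℕ.≤ suc e
  go (inj₁ z) = ℕ.m≤n⇒m≤1+n (hasDim-mono V-dim ws-dim λ {x} x∈V → W∩g (V⊆W x∈V , z x x∈V))
  go (inj₂ record { d≡ = refl ; dim = dim }) = s≤s (hasDim-mono dim ws-dim λ { (x∈V , gx) → W∩g (V⊆W x∈V , gx) })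

hasDim-unique : ∀ {V W : Subspace n} → HasDim V d → HasDim W e → V ≐ W → d ≡ e
hasDim-unique p q (a , b) = ℕ.≤-antisym (hasDim-mono p q a) (hasDim-mono q p b)

hasDim-∈? : ∀ {V : Subspace n} → HasDim V d → ∀ x → V x ⊎ ∃ λ (g : Form n) → Vanishes g V × g ⟨ x ⟩ ≢ 0ℚ
hasDim-∈? (vs , li , forth , back) x with Dual.in-span? (dual vs li) x
... | inj₁ s = inj₁ (back s)
... | inj₂ (g , z , nz) = inj₂ (g , (λ y y∈ → z y (forth y∈)) , nz)

equal-dim⇒⊇ : ∀ {V W : Subspace n} → HasDim V d → HasDim W d → V ⊆ W → W ⊆ V
equal-dim⇒⊇ V-dim W-dim V⊆W {x} x∈W with hasDim-∈? V-dim x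
... | inj₁ x∈V = x∈V
... | inj₂ (g , z , gx≢0) with hasDim-cut W-dim g
...   | inj₁ z′ = ⊥-elim (gx≢0 (z′ x x∈W))
...   | inj₂ record { d≡ = refl ; dim = dim } = ⊥-elim (ℕ.1+n≰n (hasDim-mono V-dim dim λ {y} y∈V → V⊆W y∈V , z y y∈V))

record IsCutBy {n} (V H : Subspace n) (g : Form n) : Set where
  field
    H≐   : H ≐ (V ∩ ker g)
    w    : Vec ℚ n
    w∈V  : V w
    gw≢0 : g ⟨ w ⟩ ≢ 0ℚ

nonvanishing⇒codim1 : ∀ {V H : Subspace n} {g} → HasDim V d → IsCutBy V H g → IsHyperplaneIn V H
nonvanishing⇒codim1 {V = V} {g = g} V-dim c with hasDim-cut V-dim g
... | inj₁ z = ⊥-elim (IsCutBy.gw≢0 c (z _ (IsCutBy.w∈V c)))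
... | inj₂ record { d′ = d′ ; d≡ = refl ; dim = dim } = (λ h → proj₁ (proj₁ (IsCutBy.H≐ c) h)) , d′ , V-dim ,
               hasDim-resp (proj₂ (IsCutBy.H≐ c) , proj₁ (IsCutBy.H≐ c)) dim

all-killed? : ∀ (g : Form n) (vs : Vec (Vec ℚ n) d) → (∀ i → g ⟨ Vec.lookup vs i ⟩ ≡ 0ℚ) ⊎ ∃ λ i → g ⟨
  Vec.lookup vs i ⟩ ≢ 0ℚ
all-killed? g [] = inj₁ λ ()
all-killed? g (v ∷ vs) with g ⟨ v ⟩ ≟ 0ℚ | all-killed? g vs
... | no nz | _ = inj₂ (zero , nz)
... | yes z | inj₂ (i , nz) = inj₂ (suc i , nz)
... | yes z | inj₁ p = inj₁ λ { zero → z ; (suc i) → p i }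

codim1⇒form : ∀ {V H : Subspace n} → IsHyperplaneIn V H → ∃ λ g → IsCutBy V H g
codim1⇒form {n} {V} {H} (H⊆V , d , V-dim@(vs , li , forth , back) , H-dim) = go (allIn vs (λ i → back (unit vs i)))
  where
  unit : ∀ {k} (us : Vec (Vec ℚ n) k) i → Span us (Vec.lookup us i)
  unit (u ∷ us) zero = (1ℚ ∷ 0ᵥ) , trans (cong₂ _+ᵥ_ (1*ᵥ u) (linComb-0 us)) (+ᵥ-identityʳ u)
  unit (u ∷ us) (suc i) = let (cs , eq) = unit us i in (0ℚ ∷ cs) , trans (zeroHead 0ℚ u cs us refl) eq
  Result : Set
  Result = ∃ λ g → IsCutBy V H g
  cutAt : ∀ x → V x → H x ⊎ Result
  cutAt x x∈V with hasDim-∈? H-dim x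
  ... | inj₁ h = inj₁ h
  ... | inj₂ (g , z , gx≢0) with hasDim-cut V-dim g
  ...   | inj₁ z′ = ⊥-elim (gx≢0 (z′ x x∈V))
  ...   | inj₂ record { d≡ = refl ; dim = dim } = inj₂ (g , record
              { H≐ = H⊆ , equal-dim⇒⊇ H-dim dim H⊆
              ; w = x ; w∈V = x∈V ; gw≢0 = gx≢0 })
    where
    H⊆ : H ⊆ (V ∩ ker g)
    H⊆ {y} h = H⊆V h , z y h
  allIn : ∀ {k} (us : Vec (Vec ℚ n) k) → (∀ i → V (Vec.lookup us i)) → (∀ i → H (Vec.lookup us i)) ⊎ Result
  allIn [] _ = inj₁ λ ()
  allIn (u ∷ us) ∈V with cutAt u (∈V zero) | allIn us (∈V ∘ suc)
  ... | inj₂ r | _ = inj₂ r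
  ... | inj₁ _ | inj₂ r = inj₂ r
  ... | inj₁ h | inj₁ hs = inj₁ λ { zero → h ; (suc i) → hs i }
  go : _ → Result
  go (inj₂ r) = r
  go (inj₁ hs) = ⊥-elim (ℕ.1+n≰n (hasDim-mono V-dim H-dim V⊆H))
    where
    V⊆H : V ⊆ H
    V⊆H {x} x∈V with hasDim-∈? H-dim x
    ... | inj₁ h = h
    ... | inj₂ (g , z , gx≢0) = ⊥-elim (gx≢0 (trans (cong (g ⟨_⟩) (sym (proj₂ (forth x∈V))))
      (linComb-killed g (proj₁ (forth x∈V)) vs λ i → z _ (hs i))))

module _ {a p} {A : Set a} {P : A → Set p} where
  All-at : ∀ {xs} → All P xs → ∀ i → P (lookup xs i)
  All-at (p ∷ ps) zero    = p
  All-at (p ∷ ps) (suc i) = All-at ps i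

  Any-at : ∀ xs i → P (lookup xs i) → Any P xs
  Any-at (x ∷ xs) zero    p = here p
  Any-at (x ∷ xs) (suc i) p = there (Any-at xs i p)

  at-Any : ∀ {xs} → Any P xs → ∃ λ i → P (lookup xs i)
  at-Any p = Any.index p , Any.lookup-index p

  removeAt-Any⁻ : ∀ xs i → Any P (removeAt xs i) → ∃ λ j → j ≢ i × P (lookup xs j)
  removeAt-Any⁻ (x ∷ xs) zero    p = let (j , q) = at-Any p in suc j , (λ ()) , q
  removeAt-Any⁻ (x ∷ xs) (suc i) (here p) = zero , (λ ()) , p
  removeAt-Any⁻ (x ∷ xs) (suc i) (there p) = let (j , ne , q) = removeAt-Any⁻ xs i p in suc j , ne ∘ Fin.suc-injective , q

module _ {n : ℕ} where
  ∈-resp : ∀ {H K : Subspace n} {A} → H ≐ K → H ∈ A → K ∈ A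
  ∈-resp H≐K = Any.map (≐-trans (≐-sym H≐K))

  ∈-refl : ∀ {H : Subspace n} {A} → H ∈ (H ∷ A)
  ∈-refl = here ≐-refl

  disjoint-at : ∀ {π : List (List (Subspace n))} → AllPairs Disjoint π →
                ∀ i j {H} → H ∈ lookup π i → H ∈ lookup π j → i ≡ j
  disjoint-at (d ∷ ds) zero    zero    p q = refl
  disjoint-at (d ∷ ds) zero    (suc j) p q = ⊥-elim (All-at d j (p , q))
  disjoint-at (d ∷ ds) (suc i) zero    p q = ⊥-elim (All-at d i (q , p))
  disjoint-at (d ∷ ds) (suc i) (suc j) p q = cong suc (disjoint-at ds i j p q)

  module _ {A : List (Subspace n)} {π} (P : IsPartition A π) where
    open IsPartition P

    block-of : ∀ {H} → H ∈ A → ∃ λ i → H ∈ lookup π i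
    block-of H∈A = at-Any (to (covers _) H∈A)

    block⊆ : ∀ i {H} → H ∈ lookup π i → H ∈ A
    block⊆ i H∈ = from (covers _) (Any-at π i H∈)

    block-unique : ∀ i j {H} → H ∈ lookup π i → H ∈ lookup π j → i ≡ j
    block-unique = disjoint-at disjoint

HasCodimIn-resp : ∀ {V X Y : Subspace n} {s} → X ≐ Y → HasCodimIn V X s → HasCodimIn V Y s
HasCodimIn-resp X≐Y (X⊆V , d , p , q) = (λ y → X⊆V (proj₂ X≐Y y)) , d , p , hasDim-resp X≐Y q

member-hyperplane : ∀ {V : Subspace n} {A H} → IsArrangement V A → H ∈ A → IsHyperplaneIn V H
member-hyperplane arr H∈A = let (i , e) = at-Any H∈A in
  HasCodimIn-resp (≐-sym e) (All-at (IsArrangement.hyperplanes arr) i)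

hyperplane-⊆⇒≐ : ∀ {V H K : Subspace n} → IsHyperplaneIn V H → IsHyperplaneIn V K → H ⊆ K → H ≐ K
hyperplane-⊆⇒≐ (_ , d , V-dim , H-dim) (_ , e , V-dim′ , K-dim) H⊆K
  with ℕ.suc-injective (hasDim-unique V-dim V-dim′ ≐-refl)
... | refl = H⊆K , equal-dim⇒⊇ H-dim K-dim H⊆K

⊆-hyperplane? : ∀ {V X H : Subspace n} → HasDim X d → X ⊆ V → IsHyperplaneIn V H → X ⊆ H ⊎ ¬ X ⊆ H
⊆-hyperplane? X-dim X⊆V hyp with codim1⇒form hyp
... | g , c with hasDim-cut X-dim g
...   | inj₁ z = inj₁ λ x∈X → proj₂ (IsCutBy.H≐ c) (X⊆V x∈X , z _ x∈X)
...   | inj₂ C = inj₂ λ X⊆H → 1≢0 (trans (sym (ProperCut.gw≡1 C))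
  (proj₂ (proj₁ (IsCutBy.H≐ c) (X⊆H (ProperCut.w∈V C)))))
  where
  1≢0 : 1ℚ ≢ 0ℚ
  1≢0 ()

hyperplane-≐? : ∀ {V H K : Subspace n} → IsHyperplaneIn V H → IsHyperplaneIn V K → H ≐ K ⊎ ¬ H ≐ K
hyperplane-≐? h@(H⊆V , _ , _ , H-dim) k with ⊆-hyperplane? H-dim H⊆V k
... | inj₁ s = inj₁ (hyperplane-⊆⇒≐ h k s)
... | inj₂ ns = inj₂ λ e → ns (proj₁ e)

⋂⊆ : ∀ {V : Subspace n} Hs → ⋂ V Hs ⊆ V
⋂⊆ []       x∈ = x∈
⋂⊆ (H ∷ Hs) (_ , x∈) = ⋂⊆ Hs x∈

⋂-All : ∀ {V : Subspace n} {Hs x} → ⋂ V Hs x → All (λ H → H x) Hs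
⋂-All {Hs = []} _ = []
⋂-All {Hs = H ∷ Hs} (h , hs) = h ∷ ⋂-All hs

All-⋂ : ∀ {V : Subspace n} {Hs x} → V x → All (λ H → H x) Hs → ⋂ V Hs x
All-⋂ v [] = v
All-⋂ v (h ∷ hs) = h , All-⋂ v hs

⋂-dim : ∀ {V : Subspace n} {Hs} → HasDim V d → All (IsHyperplaneIn V) Hs →
        ∃ λ e → HasDim (⋂ V Hs) e × d ℕ.≤ length Hs ℕ.+ e
⋂-dim V-dim [] = _ , V-dim , ℕ.≤-refl
⋂-dim {d = d} {V = V} {H ∷ Hs} V-dim (h ∷ hs) with ⋂-dim V-dim hs | codim1⇒form h
... | e , X-dim , le | g , c with hasDim-cut X-dim g
...   | inj₁ z = e , hasDim-resp ((λ x∈ → proj₂ (IsCutBy.H≐ c) (⋂⊆ Hs x∈ , z _ x∈) , x∈) , proj₂) X-dim , ℕ.m≤n⇒m≤1+n le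
...   | inj₂ record { d′ = e′ ; d≡ = refl ; dim = dim } =
        e′ , hasDim-resp ((λ { (x∈ , gx) → proj₂ (IsCutBy.H≐ c) (⋂⊆ Hs x∈ , gx) , x∈ }) ,
          (λ { (x∈H , x∈) → x∈ , proj₂ (proj₁ (IsCutBy.H≐ c) x∈H) })) dim
        , subst (d ℕ.≤_) (ℕ.+-suc (length Hs) e′) le

-- Transversals of a partition

Choice : List (List (Subspace n)) → Set₁
Choice {n} π = Fin (length π) → Subspace n

IsChoice : ∀ (π : List (List (Subspace n))) → Choice π → Set₁
IsChoice π f = ∀ j → f j ∈ lookup π j

⋂ᶜ : Subspace n → (π : List (List (Subspace n))) → Choice π → Subspace n
⋂ᶜ V π f x = V x × (∀ j → f j x)

pick : ∀ {Hs : List (Subspace n)} {π} → Pointwise _∈_ Hs π → Choice π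
pick (_∷_ {x = H} p ps) zero    = H
pick (_∷_ p ps) (suc j) = pick ps j

pick-∈ : ∀ {Hs : List (Subspace n)} {π} (ps : Pointwise _∈_ Hs π) → IsChoice π (pick ps)
pick-∈ (p ∷ ps) zero = p
pick-∈ (p ∷ ps) (suc j) = pick-∈ ps j

pick-⋂ : ∀ {V : Subspace n} {Hs π} (ps : Pointwise _∈_ Hs π) → ⋂ V Hs ≐ ⋂ᶜ V π (pick ps)
pick-⋂ [] = (λ v → v , λ ()) , proj₁
pick-⋂ (p ∷ ps) = (λ { (h , hs) → let (v , k) = proj₁ (pick-⋂ ps) hs in v , λ { zero → h ; (suc j) → k j } }) ,
                  (λ { (v , k) → k zero , proj₂ (pick-⋂ ps) (v , k ∘ suc) })

choice-list : ∀ (π : List (List (Subspace n))) f → IsChoice π f →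
  ∃ λ Hs → Pointwise _∈_ Hs π × ∀ V → ⋂ V Hs ≐ ⋂ᶜ V π f
choice-list [] f f∈ = [] , [] , λ V → (λ v → v , λ ()) , proj₁
choice-list (B ∷ π) f f∈ with choice-list π (f ∘ suc) (f∈ ∘ suc)
... | Hs , ps , e = f zero ∷ Hs , f∈ zero ∷ ps , λ V →
      (λ { (h , hs) → let (v , k) = proj₁ (e V) hs in v , λ { zero → h ; (suc j) → k j } }) ,
      (λ { (v , k) → k zero , proj₂ (e V) (v , k ∘ suc) })

independentᶜ : ∀ {V : Subspace n} {π} → IsIndependent V π → ∀ f → IsChoice π f → HasCodimIn V (⋂ᶜ V π f) (length π)
independentᶜ {V = V} {π} ind f f∈ with choice-list π f f∈
... | Hs , ps , e = HasCodimIn-resp (e V) (ind Hs ps)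

removeAt-pointwise : ∀ {Hs : List (Subspace n)} {π} (ps : Pointwise _∈_ Hs π) i →
  ∃ λ Ks → Pointwise _∈_ Ks (removeAt π i) × ∀ x → All (λ H → H x) Hs ⇔ (pick ps i x × All (λ H → H x) Ks)
removeAt-pointwise {Hs = H ∷ Hs} (p ∷ ps) zero = Hs , ps , λ x → mk⇔ (λ { (h ∷ hs) → h , hs }) (λ { (h , hs) → h ∷ hs })
removeAt-pointwise {Hs = H ∷ Hs} (p ∷ ps) (suc i) with removeAt-pointwise ps i
... | Ks , qs , e = H ∷ Ks , p ∷ qs , λ x →
      mk⇔ (λ { (h ∷ hs) → let (a , b) = to (e x) hs in a , h ∷ b }) (λ { (a , h ∷ b) → h ∷ from (e x) (a , b) })

restrict-∈ : ∀ {H H₀ : Subspace n} {B} → H ∈ B → (H ∩ H₀) ∈ restrict H₀ B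
restrict-∈ = Any.map⁺ ∘ Any.map λ e → (λ { (a , b) → proj₁ e a , b }) , (λ { (a , b) → proj₂ e a , b })

restrict-∈⁻ : ∀ {K H₀ : Subspace n} {B} → K ∈ restrict H₀ B → ∃ λ H → H ∈ B × K ≐ (H ∩ H₀)
restrict-∈⁻ {B = B} p = let (i , e) = at-Any (Any.map⁻ p) in lookup B i , Any-at B i ≐-refl , e

restrict-pointwise : ∀ (H₀ : Subspace n) {Hs π} → Pointwise _∈_ Hs π →
  Pointwise _∈_ (map (_∩ H₀) Hs) (map (restrict H₀) π)
restrict-pointwise H₀ [] = []
restrict-pointwise H₀ (p ∷ ps) = restrict-∈ p ∷ restrict-pointwise H₀ ps

-- Inductively factored pairs are nice

module _ {n : ℕ} where
  IF⇒isArrangement : ∀ {V : Subspace n} {A π} → IsInductivelyFactoredPair V A π → IsArrangement V A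
  IF⇒isArrangement (empty V-dim) = record { finiteDimensional = _ , V-dim ; hyperplanes = [] }
  IF⇒isArrangement (step _ _ _ _ arr _ _ _ _ _ _ _) = arr

  IF⇒isPartition : ∀ {V : Subspace n} {A π} → IsInductivelyFactoredPair V A π → IsPartition A π
  IF⇒isPartition (empty _) = record { nonempty = [] ; disjoint = [] ; covers = λ H → mk⇔ (λ ()) (λ ()) }
  IF⇒isPartition (step _ _ _ _ _ part _ _ _ _ _ _) = part

module StepNice {n} {V : Subspace n} {A π H₀} (i : Fin (length π)) {A′ π′}
  (arr : IsArrangement V A) (part : IsPartition A π) (H₀∈B : H₀ ∈ lookup π i)
  (del : IsDeletion A H₀ A′) (ind : IsInducedPartition π A′ π′)
  (bij : RestrictionBijective A (lookup π i) H₀ (restrict H₀ A′))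
  (nice′ : IsNice V A′ π′)
  (nice″ : IsNice H₀ (restrict H₀ A′) (map (restrict H₀) (removeAt π i)))
  where
  open IsInducedPartition ind

  H₀∈A : H₀ ∈ A
  H₀∈A = block⊆ part i H₀∈B

  H₀-hyp : IsHyperplaneIn V H₀
  H₀-hyp = member-hyperplane arr H₀∈A

  V-dim : ∃ (HasDim V)
  V-dim = IsArrangement.finiteDimensional arr

  σ : ∀ k → ∃ λ j → ∀ H → H ∈ lookup π′ k ⇔ (H ∈ lookup π j × H ∈ A′)
  σ k = at-Any (All-at blocks k)

  ≢H₀ : ∀ {H j} → H ∈ lookup π j → j ≢ i → ¬ H ≐ H₀
  ≢H₀ {j = j} H∈ j≢i e = j≢i (block-unique part j i H∈ (∈-resp (≐-sym e) H₀∈B))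

  in-A′ : ∀ {H j} → H ∈ lookup π j → ¬ H ≐ H₀ → H ∈ A′
  in-A′ {j = j} H∈ ne = from (del _) (block⊆ part j H∈ , ne)

  σ-surjective : ∀ {H} j → H ∈ lookup π j → H ∈ A′ → ∃ λ k → proj₁ (σ k) ≡ j × H ∈ lookup π′ k
  σ-surjective j H∈ H∈A′ with block-of isPartition H∈A′
  ... | k , H∈k = k , block-unique part _ j (proj₁ (to (proj₂ (σ k) _) H∈k)) H∈ , H∈k

  σ-injective : ∀ k l → proj₁ (σ k) ≡ proj₁ (σ l) → k ≡ l
  σ-injective k l e with All-at (IsPartition.nonempty isPartition) k
  ... | H , H∈k = block-unique isPartition k l H∈k
      (from (proj₂ (σ l) H) (subst (λ j → H ∈ lookup π j × H ∈ A′) e (to (proj₂ (σ k) H) H∈k)))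

  independent : IsIndependent V π
  independent Hs ps with hyperplane-≐? (member-hyperplane arr (block⊆ part i (pick-∈ ps i))) H₀-hyp
  ... | inj₁ Hi≐H₀ with removeAt-pointwise ps i
  ...   | Ks , qs , e = codim
    where
    rs = restrict-pointwise H₀ qs
    X≐ : ⋂ H₀ (map (_∩ H₀) Ks) ≐ ⋂ V Hs
    X≐ = (λ x∈ → let h₀ = ⋂⊆ (map (_∩ H₀) Ks) x∈ in
           All-⋂ (proj₁ H₀-hyp h₀) (from (e _) (proj₂ Hi≐H₀ h₀ , unmap Ks (⋂-All x∈)))) ,
         (λ x∈ → let (h , ks) = to (e _) (⋂-All x∈) in All-⋂ (proj₁ Hi≐H₀ h) (remap Ks (proj₁ Hi≐H₀ h) ks))
      where
      unmap : ∀ Ks {x} → All (λ H → H x) (map (_∩ H₀) Ks) → All (λ H → H x) Ks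
      unmap [] _ = []
      unmap (K ∷ Ks) ((k , _) ∷ ks) = k ∷ unmap Ks ks
      remap : ∀ Ks {x} → H₀ x → All (λ H → H x) Ks → All (λ H → H x) (map (_∩ H₀) Ks)
      remap [] h _ = []
      remap (K ∷ Ks) h (k ∷ ks) = (k , h) ∷ remap Ks h ks
    codim : HasCodimIn V (⋂ V Hs) (length π)
    codim with IsNice.independent nice″ _ rs | H₀-hyp
    ... | _ , d , H₀-dim , X-dim | H₀⊆V , d′ , V-dim′ , H₀-dim′ =
      ⋂⊆ Hs , d , subst (HasDim V) eq V-dim′ , hasDim-resp X≐ X-dim
      where
      eq : suc d′ ≡ length π ℕ.+ d
      eq = trans (cong suc (trans (hasDim-unique H₀-dim′ H₀-dim ≐-refl)
        (cong (ℕ._+ d) (List.length-map (restrict H₀) (removeAt π i)))))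
                 (cong (ℕ._+ d) (sym (List.length-removeAt′ π i)))
  independent Hs ps | inj₂ Hi≢H₀ = subst (HasCodimIn V _) lengths
    (HasCodimIn-resp X≐ (independentᶜ (IsNice.independent nice′) f f∈))
    where
    H = pick ps
    ne : ∀ j → ¬ H j ≐ H₀
    ne j with j Fin.≟ i
    ... | yes refl = Hi≢H₀
    ... | no j≢i = ≢H₀ (pick-∈ ps j) j≢i
    ∈A′ : ∀ j → H j ∈ A′
    ∈A′ j = in-A′ (pick-∈ ps j) (ne j)
    f : Choice π′
    f k = H (proj₁ (σ k))
    f∈ : IsChoice π′ f
    f∈ k = from (proj₂ (σ k) _) (pick-∈ ps _ , ∈A′ _)
    ρ : ∀ j → ∃ λ k → proj₁ (σ k) ≡ j × H j ∈ lookup π′ k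
    ρ j = σ-surjective j (pick-∈ ps j) (∈A′ j)
    X≐ : ⋂ᶜ V π′ f ≐ ⋂ V Hs
    X≐ = ≐-trans ((λ { (v , k) → v , λ j → let (l , e , _) = ρ j in subst (λ j → H j _) e (k l) }) ,
                  (λ { (v , k) → v , λ l → k (proj₁ (σ l)) })) (≐-sym (pick-⋂ ps))
    lengths : length π′ ≡ length π
    lengths = ℕ.≤-antisym (Fin.injective⇒≤ {f = λ k → proj₁ (σ k)} λ {k} {l} → σ-injective k l)
      (Fin.injective⇒≤ {f = λ j → proj₁ (ρ j)} λ {j} {l} e →
        trans (sym (proj₁ (proj₂ (ρ j)))) (trans (cong (λ k → proj₁ (σ k)) e) (proj₁ (proj₂ (ρ l)))))

  module _ (X : Subspace n) (Hs : List (Subspace n)) (Hs⊆A : Hs ⊆ₗ A) (X≐ : X ≐ ⋂ V Hs) (X≢V : ¬ X ≐ V) where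
    X-dim : ∃ (HasDim X)
    X-dim = let (e , p , _) = ⋂-dim (proj₂ V-dim) (All.tabulate λ {H} H∈ → member-hyperplane arr (Hs⊆A (Any.map (λ { refl → ≐-refl }) H∈)))
            in e , hasDim-resp (≐-sym X≐) p
    X⊆V : X ⊆ V
    X⊆V x∈ = ⋂⊆ Hs (proj₁ X≐ x∈)

    X⊆Hs : ∀ {H} → H ∈ Hs → X ⊆ H
    X⊆Hs {H} H∈ {x} x∈ with at-Any H∈
    ... | j , e = proj₂ e (All-at {P = λ K → K x} (⋂-All {V = V} {Hs} (proj₁ X≐ x∈)) j)

    deleted : ∀ Ks → Ks ⊆ₗ A → ∃ λ Ls → Ls ⊆ₗ A′ × (∀ x → H₀ x → All (λ H → H x) Ks ⇔ All (λ H → H x) (map (_∩ H₀) Ls))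
    deleted [] _ = [] , (λ ()) , λ _ _ → mk⇔ (λ _ → []) (λ _ → [])
    deleted (K ∷ Ks) sub with deleted Ks (λ p → sub (there p)) | hyperplane-≐?
      (member-hyperplane arr (sub ∈-refl)) H₀-hyp
    ... | Ls , s , e | inj₁ K≐H₀ = Ls , s , λ x h → mk⇔ (λ { (k ∷ ks) → to (e x h) ks })
      (λ ls → proj₂ K≐H₀ h ∷ from (e x h) ls)
    ... | Ls , s , e | inj₂ K≢H₀ = K ∷ Ls , (λ { (here p) → ∈-resp (≐-sym p)
      (from (del K) (sub ∈-refl , K≢H₀)) ; (there p) → s p }) ,
          λ x h → mk⇔ (λ { (k ∷ ks) → (k , h) ∷ to (e x h) ks }) (λ { ((k , _) ∷ ls) → k ∷ from (e x h) ls })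

    H₀⊆X? : H₀ ⊆ X ⊎ ¬ H₀ ⊆ X
    H₀⊆X? = Sum.map (λ all h → proj₂ X≐ (All-⋂ (proj₁ H₀-hyp h) (all h)))
      (λ { (K , K∈ , ns) H₀⊆X → ns λ h → X⊆Hs K∈ (H₀⊆X h) }) (decide Hs Hs⊆A)
      where
      decide : ∀ Ks → Ks ⊆ₗ A → (∀ {x} → H₀ x → All (λ H → H x) Ks) ⊎ (∃ λ K → K ∈ Ks × ¬ H₀ ⊆ K)
      decide [] _ = inj₁ λ _ → []
      decide (K ∷ Ks) sub with ⊆-hyperplane? (proj₂ (proj₂ (proj₂ H₀-hyp))) (proj₁ H₀-hyp)
        (member-hyperplane arr (sub ∈-refl)) | decide Ks (λ p → sub (there p))
      ... | inj₂ ns | _ = inj₂ (K , ∈-refl , ns)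
      ... | inj₁ s | inj₁ ss = inj₁ λ h → s h ∷ ss h
      ... | inj₁ s | inj₂ (L , L∈ , ns) = inj₂ (L , there L∈ , ns)

    singleton-inside : X ⊆ H₀ → Any (IsSingletonAt X) π
    singleton-inside X⊆H₀ with H₀⊆X?
    ... | inj₁ H₀⊆X = Any-at π i (H₀ , (H₀∈B , X⊆H₀) , λ K K∈ X⊆K →
            ≐-sym (hyperplane-⊆⇒≐ H₀-hyp (member-hyperplane arr (block⊆ part i K∈)) λ h → X⊆K (H₀⊆X h)))
    ... | inj₂ H₀⊈X with deleted Hs Hs⊆A
    ...   | Ls , Ls⊆A′ , e = let (j , j≢i , H″ , (H″∈ , X⊆H″) , uniq) = removeAt-Any⁻ π i (Any.map⁻ (IsNice.singleton nice″ X lattice λ X≐H₀ → H₀⊈X (proj₂ X≐H₀)))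
                                 (H , H∈ , H″≐) = restrict-∈⁻ H″∈
                                 off-block : ∀ {K} → K ∈ lookup π j → K ∉ lookup π i
                                 off-block K∈ K∈i = j≢i (block-unique part j i K∈ K∈i)
                             in Any-at π j (H , (H∈ , λ x∈ → proj₁ (proj₁ H″≐ (X⊆H″ x∈))) , λ K K∈ X⊆K →
                                  RestrictionBijective.injective bij K H (block⊆ part j K∈) (off-block K∈)
                                    (block⊆ part j H∈) (off-block H∈)
                                    (≐-trans (uniq (K ∩ H₀) (restrict-∈ K∈) (λ x∈ → X⊆K x∈ , X⊆H₀ x∈)) H″≐))
      where
      lattice : InLattice H₀ (restrict H₀ A′) X
      lattice = map (_∩ H₀) Ls , (λ {K} K∈ → let (L , L∈ , K≐) = restrict-∈⁻ K∈ in ∈-resp (≐-sym K≐) (restrict-∈ (Ls⊆A′ L∈))) ,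
        (λ x∈ → All-⋂ (X⊆H₀ x∈) (to (e _ (X⊆H₀ x∈)) (⋂-All (proj₁ X≐ x∈)))) ,
        (λ x∈ → let h = ⋂⊆ (map (_∩ H₀) Ls) x∈ in proj₂ X≐ (All-⋂ (proj₁ H₀-hyp h) (from (e _ h) (⋂-All x∈))))

    singleton-off-block : ¬ X ⊆ H₀ → Any (IsSingletonAt X) π
    singleton-off-block X⊈H₀ with at-Any (IsNice.singleton nice′ X lattice X≢V)
      where
      lattice : InLattice V A′ X
      lattice = Hs , (λ {H} H∈ → from (del H) (Hs⊆A H∈ , λ H≐H₀ → X⊈H₀ λ x∈ → proj₁ H≐H₀ (X⊆Hs H∈ x∈))) , X≐
    ... | k , H , (H∈ , X⊆H) , uniq = Any-at π (proj₁ (σ k)) (H , (proj₁ (to (proj₂ (σ k) H) H∈) , X⊆H) , λ K K∈ X⊆K →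
            uniq K (from (proj₂ (σ k) K) (K∈ , in-A′ K∈ λ K≐H₀ → X⊈H₀ λ x∈ → proj₁ K≐H₀ (X⊆K x∈))) X⊆K)

    singleton : Any (IsSingletonAt X) π
    singleton with ⊆-hyperplane? (proj₂ X-dim) X⊆V H₀-hyp
    ... | inj₁ s = singleton-inside s
    ... | inj₂ ns = singleton-off-block ns

IF⇒isNice : ∀ {V : Subspace n} {A π} → IsInductivelyFactoredPair V A π → IsNice V A π
IF⇒isNice (empty V-dim) = record
  { independent = λ { .[] [] → id , _ , V-dim , V-dim }
  ; singleton = λ { X ([] , _ , X≐V) X≢V → ⊥-elim (X≢V X≐V) ; X (H ∷ Hs , sub , _) _ → ⊥-elim (¬∈[] (sub ∈-refl)) } }
  where
  ¬∈[] : ∀ {H : Subspace n} → ¬ H ∈ []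
  ¬∈[] ()
IF⇒isNice (step H₀ i A′ π′ arr part H₀∈B del ind bij f′ f″) = record
  { independent = S.independent ; singleton = λ { X (Hs , sub , X≐) X≢V → S.singleton X Hs sub X≐ X≢V } }
  where module S = StepNice i arr part H₀∈B del ind bij (IF⇒isNice f′) (IF⇒isNice f″)

inductivelyFactored⇒factored : ∀ {V : Subspace n} {A} → InductivelyFactored V A → Factored V A
inductivelyFactored⇒factored (π , f) = IF⇒isArrangement f , π , IF⇒isPartition f , IF⇒isNice f

module _ {a} {A : Set a} where
  All-insert : ∀ {p} {P : A → Set p} xs i → P (lookup xs i) → All P (removeAt xs i) → All P xs
  All-insert (x ∷ xs) zero    p ps       = p ∷ ps
  All-insert (x ∷ xs) (suc i) p (q ∷ ps) = q ∷ All-insert xs i p ps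

  All-removeAt : ∀ {p} {P : A → Set p} xs i → All P xs → All P (removeAt xs i)
  All-removeAt (x ∷ xs) zero    (p ∷ ps) = ps
  All-removeAt (x ∷ xs) (suc i) (p ∷ ps) = p ∷ All-removeAt xs i ps

  Any-insert : ∀ {p} {P : A → Set p} xs i → Any P (removeAt xs i) → Any P xs
  Any-insert (x ∷ xs) zero    p         = there p
  Any-insert (x ∷ xs) (suc i) (here p)  = here p
  Any-insert (x ∷ xs) (suc i) (there p) = there (Any-insert xs i p)

  Any-split : ∀ {p} {P : A → Set p} xs i → Any P xs → P (lookup xs i) ⊎ Any P (removeAt xs i)
  Any-split (x ∷ xs) zero    (here p)  = inj₁ p
  Any-split (x ∷ xs) zero    (there p) = inj₂ p
  Any-split (x ∷ xs) (suc i) (here p)  = inj₂ (here p)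
  Any-split (x ∷ xs) (suc i) (there p) = Sum.map₂ there (Any-split xs i p)

  AllPairs-insert : ∀ {r} {R : A → A → Set r} → (∀ {x y} → R x y → R y x) →
    ∀ xs i → All (R (lookup xs i)) (removeAt xs i) → AllPairs R (removeAt xs i) → AllPairs R xs
  AllPairs-insert sym-R (x ∷ xs) zero    rs       ps       = rs ∷ ps
  AllPairs-insert sym-R (x ∷ xs) (suc i) (r ∷ rs) (q ∷ ps) =
    All-insert xs i (sym-R r) q ∷ AllPairs-insert sym-R xs i rs ps

-- Invariance under equality of the sets involved

infix 4 _≋_
_≋_ : List (Subspace n) → List (Subspace n) → Set₁
A ≋ B = (A ⊆ₗ B) × (B ⊆ₗ A)

≋-refl : {A : List (Subspace n)} → A ≋ A
≋-refl = id , id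

≋-sym : {A B : List (Subspace n)} → A ≋ B → B ≋ A
≋-sym (p , q) = q , p

restrict-mono : ∀ {H₀ : Subspace n} {A B} → A ⊆ₗ B → restrict H₀ A ⊆ₗ restrict H₀ B
restrict-mono {H₀ = H₀} sub K∈ with restrict-∈⁻ K∈
... | H , H∈ , K≐ = ∈-resp (≐-sym K≐) (restrict-∈ (sub H∈))

module _ {n : ℕ} where
  private
    lookup-≋ : ∀ {π ρ : List (List (Subspace n))} → Pointwise _≋_ π ρ → (i : Fin (length π)) →
      ∃ λ j → lookup π i ≋ lookup ρ j × Pointwise _≋_ (removeAt π i) (removeAt ρ j)
    lookup-≋ (e ∷ es) zero = zero , e , es
    lookup-≋ (e ∷ es) (suc i) with lookup-≋ es i
    ... | j , p , ps = suc j , p , e ∷ ps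

    restrict-≋ : ∀ H₀ {π ρ : List (List (Subspace n))} → Pointwise _≋_ π ρ → Pointwise _≋_
      (map (restrict H₀) π) (map (restrict H₀) ρ)
    restrict-≋ H₀ [] = []
    restrict-≋ H₀ ((p , q) ∷ es) = (restrict-mono p , restrict-mono q) ∷ restrict-≋ H₀ es

    Any-≋ : ∀ {π ρ : List (List (Subspace n))} {H} → Pointwise _≋_ π ρ → Any (H ∈_) π ⇔ Any (H ∈_) ρ
    Any-≋ [] = mk⇔ (λ ()) (λ ())
    Any-≋ ((p , q) ∷ es) = mk⇔ (λ { (here x) → here (p x) ; (there x) → there (to (Any-≋ es) x) })
                               (λ { (here x) → here (q x) ; (there x) → there (from (Any-≋ es) x) })

    nonempty-≋ : ∀ {π ρ : List (List (Subspace n))} → Pointwise _≋_ π ρ → All (λ B → ∃ (_∈ B)) π → All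
      (λ B → ∃ (_∈ B)) ρ
    nonempty-≋ [] [] = []
    nonempty-≋ ((p , _) ∷ es) ((H , H∈) ∷ ne) = (H , p H∈) ∷ nonempty-≋ es ne

    disjoint-≋ : ∀ {π ρ : List (List (Subspace n))} → Pointwise _≋_ π ρ → AllPairs Disjoint π → AllPairs Disjoint ρ
    disjoint-≋ [] [] = []
    disjoint-≋ ((_ , q) ∷ es) (d ∷ ds) = go es d ∷ disjoint-≋ es ds
      where
      go : ∀ {π ρ} → Pointwise _≋_ π ρ → All (Disjoint _) π → All (Disjoint _) ρ
      go [] [] = []
      go ((_ , q′) ∷ es) (d ∷ ds) = (λ { (x , y) → d (q x , q′ y) }) ∷ go es ds

    blocks-≋ : ∀ {π ρ : List (List (Subspace n))} {A′ B′} → Pointwise _≋_ π ρ →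
      Any (λ B → ∀ H → H ∈ B′ ⇔ (H ∈ B × H ∈ A′)) π → Any (λ B → ∀ H → H ∈ B′ ⇔ (H ∈ B × H ∈ A′)) ρ
    blocks-≋ ((p , q) ∷ es) (here b) = here λ H → mk⇔ (λ h → let (x , y) = to (b H) h in p x , y) (λ { (x , y) → from (b H) (q x , y) })
    blocks-≋ (e ∷ es) (there b) = there (blocks-≋ es b)

  IF-resp : ∀ {V W : Subspace n} {A B π ρ} → V ≐ W → A ≋ B → Pointwise _≋_ π ρ →
            IsInductivelyFactoredPair V A π → IsInductivelyFactoredPair W B ρ
  IF-resp {B = []} V≐W A≋B [] (empty V-dim) = empty (hasDim-resp V≐W V-dim)
  IF-resp {B = K ∷ B} V≐W A≋B [] (empty V-dim) with proj₂ A≋B ∈-refl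
  ... | ()
  IF-resp {V} {W} {A} {B} {π} {ρ} V≐W (A⊆B , B⊆A) π≋ρ (step H₀ i A′ π′ arr part H₀∈ del ind bij f′ f″) with
    lookup-≋ π≋ρ i
  ... | j , (p , q) , removed = step H₀ j A′ π′ arr′ part′ (p H₀∈) del′ ind′ bij′
    (IF-resp V≐W ≋-refl (Pointwise.refl ≋-refl) f′)
        (IF-resp ≐-refl ≋-refl (restrict-≋ H₀ removed) f″)
    where
    arr′ : IsArrangement W B
    arr′ = record
      { finiteDimensional = let (d , V-dim) = IsArrangement.finiteDimensional arr in d , hasDim-resp V≐W V-dim
      ; hyperplanes = All.tabulate λ {H} H∈ → let (H⊆V , d , V-dim , H-dim) = member-hyperplane arr (B⊆A (Any.map (λ { refl → ≐-refl }) H∈))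
                                              in (λ h → proj₁ V≐W (H⊆V h)) , d , hasDim-resp V≐W V-dim , H-dim }
    part′ : IsPartition B ρ
    part′ = record
      { nonempty = nonempty-≋ π≋ρ (IsPartition.nonempty part)
      ; disjoint = disjoint-≋ π≋ρ (IsPartition.disjoint part)
      ; covers = λ H → mk⇔ (λ h → to (Any-≋ π≋ρ) (to (IsPartition.covers part H) (B⊆A h)))
                           (λ h → A⊆B (from (IsPartition.covers part H) (from (Any-≋ π≋ρ) h))) }
    del′ : IsDeletion B H₀ A′
    del′ H = mk⇔ (λ h → let (x , y) = to (del H) h in A⊆B x , y) (λ { (x , y) → from (del H) (B⊆A x , y) })
    ind′ : IsInducedPartition ρ A′ π′
    ind′ = record { isPartition = IsInducedPartition.isPartition ind ; blocks = All.map (blocks-≋ π≋ρ)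
      (IsInducedPartition.blocks ind) }
    bij′ : RestrictionBijective B (lookup ρ j) H₀ (restrict H₀ A′)
    bij′ = record
      { injective = λ H K H∈ H∉ K∈ K∉ → RestrictionBijective.injective bij H K (B⊆A H∈) (H∉ ∘ p) (B⊆A K∈) (K∉ ∘ p)
      ; surjective = λ K K∈ → let (H , H∈ , H∉ , e) = RestrictionBijective.surjective bij K K∈ in H , A⊆B H∈ , H∉ ∘ q , e }

IF : Subspace n → List (List (Subspace n)) → Set₁
IF V π = IsInductivelyFactoredPair V (concat π) π

concat-∈ : ∀ {π : List (List (Subspace n))} {H} → H ∈ concat π ⇔ Any (H ∈_) π
concat-∈ {π = π} = mk⇔ (Any.concat⁻ π) Any.concat⁺

concat-≋ : ∀ {π ρ : List (List (Subspace n))} → Pointwise _≋_ π ρ → concat π ≋ concat ρ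
concat-≋ {n} e = (λ h → from concat-∈ (go e (to concat-∈ h))) ,
  (λ h → from concat-∈ (go (Pointwise.symmetric ≋-sym e) (to concat-∈ h)))
  where
  go : ∀ {π ρ : List (List (Subspace n))} {H} → Pointwise _≋_ π ρ → Any (H ∈_) π → Any (H ∈_) ρ
  go ((p , _) ∷ es) (here h) = here (p h)
  go (_ ∷ es) (there h) = there (go es h)

IF-≋ : ∀ {V : Subspace n} {π ρ} → Pointwise _≋_ π ρ → IF V π → IF V ρ
IF-≋ e = IF-resp ≐-refl (concat-≋ e) e

-- Adding a hyperplane to a block

module _ {V H₀ : Subspace n} (ρ : List (List (Subspace n))) (i : Fin (length ρ)) (B A′ : List (Subspace n)) (π′ : List (List (Subspace n)))
  (H₀-hyp : IsHyperplaneIn V H₀)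
  (block : ∀ H → H ∈ lookup ρ i ⇔ (H ≐ H₀ ⊎ H ∈ B))
  (H₀∉B : H₀ ∉ B)
  (A′-members : ∀ H → H ∈ A′ ⇔ (H ∈ B ⊎ Any (H ∈_) (removeAt ρ i)))
  (disj : All (Disjoint (lookup ρ i)) (removeAt ρ i))
  (f′ : IsInductivelyFactoredPair V A′ π′)
  (blocks′ : All (λ B′ → B′ ≋ B ⊎ Any (B′ ≋_) (removeAt ρ i)) π′)
  (f″ : IF H₀ (map (restrict H₀) (removeAt ρ i)))
  (inj : All (λ C → ∀ H K → H ∈ C → K ∈ C → (H ∩ H₀) ≐ (K ∩ H₀) → H ≐ K) (removeAt ρ i))
  (surj : ∀ K → K ∈ B → Any (λ C → ∃ λ H → H ∈ C × (K ∩ H₀) ≐ (H ∩ H₀)) (removeAt ρ i))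
  where
  private
    rest = removeAt ρ i
    part″ = IF⇒isPartition f″

    rest-disjoint : AllPairs Disjoint rest
    rest-disjoint = go rest (IsPartition.disjoint part″)
      where
      go : ∀ π → AllPairs Disjoint (map (restrict H₀) π) → AllPairs Disjoint π
      go [] _ = []
      go (C ∷ π) (d ∷ ds) = go′ π d ∷ go π ds
        where
        go′ : ∀ π → All (Disjoint (restrict H₀ C)) (map (restrict H₀) π) → All (Disjoint C) π
        go′ [] _ = []
        go′ (E ∷ π) (d ∷ ds) = (λ { (x , y) → d (restrict-∈ x , restrict-∈ y) }) ∷ go′ π ds

    rest-nonempty : All (λ C → ∃ (_∈ C)) rest
    rest-nonempty = go rest (IsPartition.nonempty part″)
      where
      go : ∀ π → All (λ C → ∃ (_∈ C)) (map (restrict H₀) π) → All (λ C → ∃ (_∈ C)) π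
      go [] _ = []
      go (C ∷ π) ((K , K∈) ∷ ne) = (let (H , H∈ , _) = restrict-∈⁻ K∈ in H , H∈) ∷ go π ne

    H₀∈ : H₀ ∈ lookup ρ i
    H₀∈ = from (block H₀) (inj₁ ≐-refl)

    rest∌H₀ : ∀ {H C : Subspace n} → Any (H ∈_) rest → C ≐ H → ¬ C ≐ H₀
    rest∌H₀ {H} any C≐H C≐H₀ with at-Any any
    ... | j , H∈j = All-at disj j (∈-resp (≐-trans (≐-sym C≐H₀) C≐H) H₀∈ , H∈j)

    members : ∀ H → H ∈ concat ρ ⇔ (H ≐ H₀ ⊎ H ∈ A′)
    members H = mk⇔
      (λ h → Sum.[ (λ b → Sum.map₂ (λ x → from (A′-members H) (inj₁ x)) (to (block H) b)) ,
        (λ r → inj₂ (from (A′-members H) (inj₂ r))) ]′ (Any-split ρ i (to concat-∈ h)))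
      (λ { (inj₁ e) → from concat-∈ (Any-at ρ i (from (block H) (inj₁ e)))
         ; (inj₂ a) → from concat-∈ (Sum.[ (λ b → Any-at ρ i (from (block H) (inj₂ b))) , Any-insert ρ i ]′
           (to (A′-members H) a)) })

    A′≢H₀ : ∀ {H} → H ∈ A′ → ¬ H ≐ H₀
    A′≢H₀ {H} H∈ e with to (A′-members H) H∈
    ... | inj₁ b = H₀∉B (∈-resp e b)
    ... | inj₂ r = rest∌H₀ r ≐-refl e

    arr : IsArrangement V (concat ρ)
    arr = record
      { finiteDimensional = IsArrangement.finiteDimensional arr′
      ; hyperplanes = All.tabulate λ {H} H∈ → hyp H (to (members H) (Any.map (λ { refl → ≐-refl }) H∈)) }
      where
      arr′ = IF⇒isArrangement f′
      hyp : ∀ H → H ≐ H₀ ⊎ H ∈ A′ → IsHyperplaneIn V H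
      hyp H (inj₁ e) = HasCodimIn-resp (≐-sym e) H₀-hyp
      hyp H (inj₂ a) = member-hyperplane arr′ a

    part : IsPartition (concat ρ) ρ
    part = record
      { nonempty = All-insert ρ i (H₀ , H₀∈) rest-nonempty
      ; disjoint = AllPairs-insert (λ d → λ { (x , y) → d (y , x) }) ρ i disj rest-disjoint
      ; covers = λ H → concat-∈ }

    del : IsDeletion (concat ρ) H₀ A′
    del H = mk⇔ (λ a → from (members H) (inj₂ a) , A′≢H₀ a)
                (λ { (h , ne) → Sum.[ ⊥-elim ∘ ne , id ]′ (to (members H) h) })

    ind : IsInducedPartition ρ A′ π′
    ind = record { isPartition = IF⇒isPartition f′ ; blocks = All.map blk blocks′ }
      where
      blk : ∀ {B′} → B′ ≋ B ⊎ Any (B′ ≋_) rest → Any (λ C → ∀ H → H ∈ B′ ⇔ (H ∈ C × H ∈ A′)) ρ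
      blk (inj₁ (p , q)) = Any-at ρ i λ H → mk⇔
        (λ h → from (block H) (inj₂ (p h)) , from (A′-members H) (inj₁ (p h)))
        (λ { (h , a) → Sum.[ (λ e → ⊥-elim (A′≢H₀ a e)) , q ]′ (to (block H) h) })
      blk (inj₂ any) = Any-insert ρ i (let (j , p , q) = at-Any any in Any-at rest j λ H → mk⇔
        (λ h → p h , from (A′-members H) (inj₂ (Any-at rest j (p h)))) (λ { (h , _) → q h }))

    off-block : ∀ {H} → H ∈ concat ρ → H ∉ lookup ρ i → Any (H ∈_) rest
    off-block H∈ H∉ = Sum.[ ⊥-elim ∘ H∉ , id ]′ (Any-split ρ i (to concat-∈ H∈))

    rest∉ : ∀ {H} → Any (H ∈_) rest → H ∉ lookup ρ i
    rest∉ any h with at-Any any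
    ... | j , H∈j = All-at disj j (h , H∈j)

    rest-inj : ∀ {H K} → Any (H ∈_) rest → Any (K ∈_) rest → (H ∩ H₀) ≐ (K ∩ H₀) → H ≐ K
    rest-inj {H} {K} H∈ K∈ e = go rest inj (IsPartition.disjoint part″) H∈ K∈
      where
      no-cross : ∀ {C} π → All (Disjoint (restrict H₀ C)) (map (restrict H₀) π) → ∀ {L M} → L ∈ C → Any
        (M ∈_) π → (L ∩ H₀) ≐ (M ∩ H₀) → H ≐ K
      no-cross (E ∷ π) (d ∷ _) L∈ (here M∈) e = ⊥-elim (d (∈-resp e (restrict-∈ L∈) , restrict-∈ M∈))
      no-cross (E ∷ π) (_ ∷ ds) L∈ (there M∈) e = no-cross π ds L∈ M∈ e
      go : ∀ π → All (λ C → ∀ H K → H ∈ C → K ∈ C → (H ∩ H₀) ≐ (K ∩ H₀) → H ≐ K) π → AllPairs Disjoint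
        (map (restrict H₀) π) →
           Any (H ∈_) π → Any (K ∈_) π → H ≐ K
      go (C ∷ π) (c ∷ cs) (d ∷ ds) (here h) (here k) = c H K h k e
      go (C ∷ π) (c ∷ cs) (d ∷ ds) (here h) (there k) = no-cross π d h k e
      go (C ∷ π) (c ∷ cs) (d ∷ ds) (there h) (here k) = no-cross π d k h (≐-sym e)
      go (C ∷ π) (c ∷ cs) (d ∷ ds) (there h) (there k) = go π cs ds h k

    A″-members : ∀ {K} → K ∈ restrict H₀ A′ → ∃ λ H → Any (H ∈_) rest × K ≐ (H ∩ H₀)
    A″-members {K} K∈ with restrict-∈⁻ K∈
    ... | H , H∈ , e with to (A′-members H) H∈
    ...   | inj₂ r = H , r , e
    ...   | inj₁ b = let (j , L , L∈ , e′) = at-Any (surj H b) in L , Any-at rest j L∈ , ≐-trans e e′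

    bij : RestrictionBijective (concat ρ) (lookup ρ i) H₀ (restrict H₀ A′)
    bij = record
      { injective = λ H K H∈ H∉ K∈ K∉ e → rest-inj (off-block H∈ H∉) (off-block K∈ K∉) e
      ; surjective = λ K K∈ → let (H , any , e) = A″-members K∈ in H , from concat-∈ (Any-insert ρ i any) , rest∉ any , e }

    A″≋ : concat (map (restrict H₀) rest) ≋ restrict H₀ A′
    A″≋ = (λ {K} K∈ → let q : Any (λ C → K ∈ restrict H₀ C) rest
                          q = Any.map⁻ (to concat-∈ K∈)
                          (j , L∈) = at-Any q ; (H , H∈ , e) = restrict-∈⁻ L∈
                      in ∈-resp (≐-sym e) (restrict-∈ (from (A′-members H) (inj₂ (Any-at rest j H∈))))) ,
          (λ {K} K∈ → let (H , any , e) = A″-members K∈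
                      in from concat-∈ (Any.map⁺ (Any.map (λ h → ∈-resp (≐-sym e) (restrict-∈ h)) any)))

  addHyperplane : IF V ρ
  addHyperplane = step H₀ i A′ π′ arr part H₀∈ del ind bij f′ (IF-resp ≐-refl A″≋ (Pointwise.refl ≋-refl) f″)

FiniteDim : Subspace n → Set
FiniteDim V = ∃ (HasDim V)

1≢0 : 1ℚ ≢ 0ℚ
1≢0 ()

shift : ∀ {V : Subspace n} → FiniteDim V → ∀ {x y} c → V x → V y → V (x +ᵥ (c *ᵥ y))
shift (_ , vs , li , to , from) c x∈ y∈ =
  let (as , p) = to x∈ ; (bs , q) = to y∈
  in from ((as +ᵥ (c *ᵥ bs)) , trans (linComb-+ as (c *ᵥ bs) vs)
    (cong₂ _+ᵥ_ p (trans (linComb-* c bs vs) (cong (c *ᵥ_) q))))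

-- Configurations of forms

Config : ℕ → Set
Config n = List (List (Form n))

block : Subspace n → List (Form n) → List (Subspace n)
block V = map λ f → V ∩ ker f

real : Subspace n → Config n → List (List (Subspace n))
real V = map (block V)

block-∈ : ∀ {V : Subspace n} {C H} → H ∈ block V C → Any (λ f → H ≐ (V ∩ ker f)) C
block-∈ = Any.map⁻

∈-block : ∀ {V : Subspace n} {C H} → Any (λ f → H ≐ (V ∩ ker f)) C → H ∈ block V C
∈-block = Any.map⁺

restrict-real : ∀ (V : Subspace n) h π → Pointwise _≋_ (map (restrict (V ∩ ker h)) (real V π)) (real (V ∩ ker h) π)
restrict-real V h [] = []
restrict-real V h (C ∷ π) = go C ∷ restrict-real V h π
  where
  swap : ∀ f → ((V ∩ ker f) ∩ (V ∩ ker h)) ≐ ((V ∩ ker h) ∩ ker f)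
  swap f = (λ { ((v , f0) , (_ , h0)) → (v , h0) , f0 }) , (λ { ((v , h0) , f0) → (v , f0) , (v , h0) })
  go : ∀ C → restrict (V ∩ ker h) (block V C) ≋ block (V ∩ ker h) C
  go [] = ≋-refl
  go (f ∷ C) = (λ { (here p) → here (≐-trans p (swap f)) ; (there p) → there (proj₁ (go C) p) }) ,
               (λ { (here p) → here (≐-trans p (≐-sym (swap f))) ; (there p) → there (proj₂ (go C) p) })

module _ {a} {A : Set a} where
  insertAfter : Maybe A → A → List A → List A
  insertAfter nothing  x xs = x ∷ xs
  insertAfter (just y) x xs = y ∷ x ∷ xs

  without : Maybe A → List A → List A
  without nothing  xs = xs
  without (just y) xs = y ∷ xs

  All-insertAfter : ∀ {p} {P : A → Set p} m {x xs} → P x → All P (without m xs) → All P (insertAfter m x xs)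
  All-insertAfter nothing p ps = p ∷ ps
  All-insertAfter (just y) p (q ∷ ps) = q ∷ p ∷ ps

SameRestriction : Subspace n → Form n → Form n → Form n → Set
SameRestriction V h f g = ∀ x → V x → h ⟨ x ⟩ ≡ 0ℚ → f ⟨ x ⟩ ≡ 0ℚ ⇔ g ⟨ x ⟩ ≡ 0ℚ

Determined : Subspace n → Form n → Form n → Form n → Set
Determined V h f g = SameRestriction V h f g → ∀ x → V x → f ⟨ x ⟩ ≡ 0ℚ ⇔ g ⟨ x ⟩ ≡ 0ℚ

Distinct : Subspace n → Form n → Form n → Set
Distinct V f g = ¬ ((V ∩ ker f) ≐ (V ∩ ker g))

module _ {V : Subspace n} (V-dim : FiniteDim V) where

  addForm : ∀ front (h : Form n) (B : List (Form n)) (π : Config n) →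
    (∃ λ w → V w × h ⟨ w ⟩ ≢ 0ℚ) →
    All (Distinct V h) B →
    All (λ C → Disjoint (block V (h ∷ B)) (block V C)) (without front π) →
    (B ≡ [] → IF V (real V (without front π))) →
    (B ≢ [] → IF V (real V (insertAfter front B π))) →
    IF (V ∩ ker h) (real (V ∩ ker h) (without front π)) →
    All (λ C → All (λ f → All (Determined V h f) C) C) (without front π) →
    All (λ b → Any (Any (SameRestriction V h b)) (without front π)) B →
    IF V (real V (insertAfter front (h ∷ B) π))
  addForm front h B π (w , w∈V , hw) h∉B disj₀ f′₀ f′₁ f″₀ inj₀ surj₀ = go front B refl f′₀ f′₁ disj₀ f″₀ inj₀ surj₀
    where
    H₀ = V ∩ ker h
    H₀-hyp : IsHyperplaneIn V H₀
    H₀-hyp = nonvanishing⇒codim1 {g = h} (proj₂ V-dim) (record { H≐ = ≐-refl ; w = w ; w∈V = w∈V ; gw≢0 = hw })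
    H₀∉ : H₀ ∉ block V B
    H₀∉ p = let (i , e) = at-Any (block-∈ p) in All-at {P = Distinct V h} h∉B i e
    inj′ : ∀ π → All (λ C → All (λ f → All (Determined V h f) C) C) π →
           All (λ C → ∀ H K → H ∈ C → K ∈ C → (H ∩ H₀) ≐ (K ∩ H₀) → H ≐ K) (real V π)
    inj′ [] [] = []
    inj′ (C ∷ π) (c ∷ cs) = go c ∷ inj′ π cs
      where
      go : All (λ f → All (Determined V h f) C) C → ∀ H K → H ∈ block V C → K ∈ block V C → (H ∩ H₀) ≐ (K ∩ H₀) → H ≐ K
      go c H K H∈ K∈ e = let (i , p) = at-Any (block-∈ H∈) ; (j , q) = at-Any (block-∈ K∈)
                             f = lookup C i ; g = lookup C j
                             same : SameRestriction V h f g
                             same x x∈V hx = mk⇔ (λ fx → proj₂ (proj₁ q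
                               (proj₁ (proj₁ e (proj₂ p (x∈V , fx) , x∈V , hx)))))
                                                 (λ gx → proj₂ (proj₁ p (proj₁
                                                   (proj₂ e (proj₂ q (x∈V , gx) , x∈V , hx)))))
                             d = All-at {P = Determined V h f} (All-at c i) j same
                         in ≐-trans p (≐-trans ((λ { (x∈V , fx) → x∈V , to (d _ x∈V) fx }) ,
                           (λ { (x∈V , gx) → x∈V , from (d _ x∈V) gx })) (≐-sym q))
    surj′ : ∀ π → All (λ b → Any (Any (SameRestriction V h b)) π) B → ∀ K → K ∈ block V B →
            Any (λ C → ∃ λ H → H ∈ C × (K ∩ H₀) ≐ (H ∩ H₀)) (real V π)
    surj′ π s K K∈ = let (i , e) = at-Any (block-∈ K∈) in Any.map⁺ (Any.map (λ {C} → one C {lookup B i} e) (All-at {P = λ b → Any (Any (SameRestriction V h b)) π} s i))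
      where
      one : ∀ C {b} → K ≐ (V ∩ ker b) → Any (SameRestriction V h b) C → ∃ λ H → H ∈ block V C × (K ∩ H₀) ≐ (H ∩ H₀)
      one C {b} e any = let (j , s) = at-Any any in V ∩ ker (lookup C j) , ∈-block {V = V} {C} (Any-at C j ≐-refl) ,
        (λ { (k , v , hx) → (v , to (s _ v hx) (proj₂ (proj₁ e k))) , v , hx }) ,
          (λ { ((_ , fx) , v , hx) → proj₂ e (v , from (s _ v hx) fx) , v , hx })
    members₁ : ∀ {π′ : List (List (Subspace n))} → (∀ H → Any (H ∈_) π′ ⇔
      (H ∈ block V B ⊎ Any (H ∈_) (real V π))) → ∀ H → H ∈ concat π′ ⇔ (H ∈ block V B ⊎ Any (H ∈_) (real V π))
    members₁ m H = mk⇔ (λ x → to (m H) (to concat-∈ x)) (λ x → from concat-∈ (from (m H) x))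
    block-eq : ∀ H → H ∈ block V (h ∷ B) ⇔ (H ≐ H₀ ⊎ H ∈ block V B)
    block-eq H = mk⇔ (λ { (here e) → inj₁ e ; (there p) → inj₂ p }) (λ { (inj₁ e) → here e ; (inj₂ p) → there p })
    self : ∀ (π : List (List (Subspace n))) → All (λ C → Any (C ≋_) π) π
    self [] = []
    self (C ∷ π) = here ≋-refl ∷ All.map there (self π)
    go : ∀ front B′ → B′ ≡ B → (B ≡ [] → IF V (real V (without front π))) →
         (B ≢ [] → IF V (real V (insertAfter front B π))) → 
         All (λ C → Disjoint (block V (h ∷ B)) (block V C)) (without front π) →
         IF H₀ (real H₀ (without front π)) →
         All (λ C → All (λ f → All (Determined V h f) C) C) (without front π) →
         All (λ b → Any (Any (SameRestriction V h b)) (without front π)) B →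
         IF V (real V (insertAfter front (h ∷ B) π))
    go nothing [] refl f′₀ f′₁ disj f″ inj surj = addHyperplane (real V ((h ∷ []) ∷ π)) zero []
      (concat (real V π)) (real V π)
      H₀-hyp block-eq H₀∉ (λ H → mk⇔ (λ x → inj₂ (to concat-∈ x))
        (λ { (inj₁ ()) ; (inj₂ x) → from concat-∈ x })) (All.map⁺ disj) (f′₀ refl)
      (All.map inj₂ (self _)) (IF-≋ (Pointwise.symmetric ≋-sym (restrict-real V h π)) f″) (inj′ π inj) (surj′ π surj)
    go nothing (b ∷ bs) refl f′₀ f′₁ disj f″ inj surj = addHyperplane (real V ((h ∷ B) ∷ π)) zero
      (block V B) (concat (real V (B ∷ π))) (real V (B ∷ π))
      H₀-hyp block-eq H₀∉ (members₁ λ H → mk⇔ (λ { (here x) → inj₁ x ; (there x) → inj₂ x })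
        (λ { (inj₁ x) → here x ; (inj₂ x) → there x })) (All.map⁺ disj) (f′₁ λ ())
      (inj₁ ≋-refl ∷ All.map inj₂ (self _)) (IF-≋ (Pointwise.symmetric ≋-sym (restrict-real V h π)) f″)
        (inj′ π inj) (surj′ π surj)
    go (just E) [] refl f′₀ f′₁ disj f″ inj surj = addHyperplane (real V (E ∷ (h ∷ []) ∷ π)) (suc zero) []
      (concat (real V (E ∷ π))) (real V (E ∷ π))
      H₀-hyp block-eq H₀∉ (λ H → mk⇔ (λ x → inj₂ (to concat-∈ x))
        (λ { (inj₁ ()) ; (inj₂ x) → from concat-∈ x })) (All.map⁺ disj) (f′₀ refl)
      (All.map inj₂ (self _)) (IF-≋ (Pointwise.symmetric ≋-sym (restrict-real V h (E ∷ π))) f″)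
        (inj′ (E ∷ π) inj) (surj′ (E ∷ π) surj)
    go (just E) (b ∷ bs) refl f′₀ f′₁ disj f″ inj surj = addHyperplane (real V (E ∷ (h ∷ B) ∷ π)) (suc zero)
      (block V B) (concat (real V (E ∷ B ∷ π))) (real V (E ∷ B ∷ π))
      H₀-hyp block-eq H₀∉ (λ H → mk⇔ (λ x → mem→ (to concat-∈ x)) (λ x → from concat-∈ (mem← x)))
      (All.map⁺ disj) (f′₁ λ ())
      (inj₂ (here ≋-refl) ∷ inj₁ ≋-refl ∷ All.map (λ x → inj₂ (there x)) (self _))
        (IF-≋ (Pointwise.symmetric ≋-sym (restrict-real V h (E ∷ π))) f″) (inj′ (E ∷ π) inj) (surj′ (E ∷ π) surj)
      where
      mem→ : ∀ {H} → Any (H ∈_) (real V (E ∷ B ∷ π)) → H ∈ block V B ⊎ Any (H ∈_) (real V (E ∷ π))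
      mem→ (here x) = inj₂ (here x)
      mem→ (there (here x)) = inj₁ x
      mem→ (there (there x)) = inj₂ (there x)
      mem← : ∀ {H} → H ∈ block V B ⊎ Any (H ∈_) (real V (E ∷ π)) → Any (H ∈_) (real V (E ∷ B ∷ π))
      mem← (inj₂ (here x)) = here x
      mem← (inj₁ x) = there (here x)
      mem← (inj₂ (there x)) = there (there x)

  module _ {δ : Vec ℚ n} (δ∈V : V δ) where
    Disjoint-δ : ∀ {B C} → All (λ b → b ⟨ δ ⟩ ≡ 1ℚ) B → All (λ f → f ⟨ δ ⟩ ≡ 0ℚ) C → Disjoint (block V B) (block V C)
    Disjoint-δ bs cs (p , q) = let (i , e) = at-Any (block-∈ p) ; (j , e′) = at-Any (block-∈ q) in
      1≢0 (trans (sym (All-at bs i)) (proj₂ (proj₁ (≐-trans (≐-sym e′) e) (δ∈V , All-at cs j))))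

    project : Form n → Vec ℚ n → Vec ℚ n
    project h x = x +ᵥ ((- (h ⟨ x ⟩)) *ᵥ δ)

    project-∈ : ∀ h {x} → V x → V (project h x)
    project-∈ h {x} x∈V = shift V-dim (- (h ⟨ x ⟩)) x∈V δ∈V

    project-ker : ∀ h x → h ⟨ δ ⟩ ≡ 1ℚ → h ⟨ project h x ⟩ ≡ 0ℚ
    project-ker h x hδ = trans (form-+* h x (- (h ⟨ x ⟩)) δ)
      (trans (cong (λ z → h ⟨ x ⟩ + - (h ⟨ x ⟩) * z) hδ) (solve 1 (λ a → a :+ :- a :* con 1ℚ := con 0ℚ) refl (h ⟨ x ⟩)))

    project-inv : ∀ h f x → f ⟨ δ ⟩ ≡ 0ℚ → f ⟨ project h x ⟩ ≡ f ⟨ x ⟩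
    project-inv h f x fδ = trans (form-+* f x (- (h ⟨ x ⟩)) δ)
      (trans (cong (λ z → f ⟨ x ⟩ + - (h ⟨ x ⟩) * z) fδ) (solve 2 (λ a b → b :+ :- a :* con 0ℚ := b) refl
      (h ⟨ x ⟩) (f ⟨ x ⟩)))

    determined-δ : ∀ h f g → h ⟨ δ ⟩ ≡ 1ℚ → f ⟨ δ ⟩ ≡ 0ℚ → g ⟨ δ ⟩ ≡ 0ℚ → Determined V h f g
    determined-δ h f g hδ fδ gδ same x x∈V = mk⇔
      (λ fx → trans (sym (project-inv h g x gδ)) (to s (trans (project-inv h f x fδ) fx)))
      (λ gx → trans (sym (project-inv h f x fδ)) (from s (trans (project-inv h g x gδ) gx)))
      where s = same (project h x) (project-∈ h x∈V) (project-ker h x hδ)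

    all-determined-δ : ∀ h C → h ⟨ δ ⟩ ≡ 1ℚ → All (λ f → f ⟨ δ ⟩ ≡ 0ℚ) C → All (λ f → All (Determined V h f) C) C
    all-determined-δ h C hδ c = All.map (λ {f} fδ → All.map (λ {g} gδ → determined-δ h f g hδ fδ gδ) c) c

    -- Two new hyperplanes meet inside an old one, so restricting to a new one gives back the old configuration.
    addFibre : ∀ front (π : Config n) b bs →
      All (λ b → b ⟨ δ ⟩ ≡ 1ℚ) (b ∷ bs) →
      All (All (λ f → f ⟨ δ ⟩ ≡ 0ℚ)) (without front π) →
      AllPairs (λ b b′ → Any (Any (SameRestriction V b b′)) (without front π)) (b ∷ bs) →
      IF V (real V (without front π)) →
      All (λ b → IF (V ∩ ker b) (real (V ∩ ker b) (without front π))) (b ∷ bs) →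
      IF V (real V (insertAfter front (b ∷ bs) π))
    addFibre front π b bs (bδ ∷ bsδ) πδ (diff ∷ diffs) f (fb ∷ fbs) =
      addForm front b bs π (δ , δ∈V , λ e → 1≢0 (trans (sym bδ) e)) (All.map (λ {b′} → distinct {b′}) diff)
        (All.map (λ {C} c {H} → Disjoint-δ {B = b ∷ bs} {C} (bδ ∷ bsδ) c {H}) πδ) (λ _ → f) (rest bs bsδ diffs fbs) fb
        (All.map (λ {C} → all-determined-δ b C bδ) πδ) diff
      where
      rest : ∀ bs → All (λ b → b ⟨ δ ⟩ ≡ 1ℚ) bs → AllPairs
        (λ b b′ → Any (Any (SameRestriction V b b′)) (without front π)) bs →
             All (λ b → IF (V ∩ ker b) (real (V ∩ ker b) (without front π))) bs → bs ≢ [] → IF V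
               (real V (insertAfter front bs π))
      rest [] _ _ _ ne = ⊥-elim (ne refl)
      rest (b ∷ bs) bδ ds fs _ = addFibre front π b bs bδ πδ ds f fs
      distinct : ∀ {b′} → Any (Any (SameRestriction V b b′)) (without front π) → Distinct V b b′
      distinct {b′} any e with at-Any any
      ... | i , any′ with at-Any any′
      ...   | j , s = ⊥-elim (proper _ (Any-at (without front π) i (Any-at _ j refl)) vanish)
        where
        g = lookup (lookup (without front π) i) j
        vanish : Vanishes g V
        vanish x x∈V = trans (sym (project-inv b g x (All-at (All-at πδ i) j)))
          (to (s _ (project-∈ b x∈V) (project-ker b x bδ)) (proj₂ (proj₁ e (project-∈ b x∈V , project-ker b x bδ))))
        proper : ∀ g → Any (Any (g ≡_)) (without front π) → ¬ Vanishes g V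
        proper g any van = ℕ.1+n≢n (hasDim-unique V-dim′ H-dim ((λ v → v , van _ v) , proj₁))
          where
          hyp : IsHyperplaneIn V (V ∩ ker g)
          hyp = member-hyperplane (IF⇒isArrangement f)
            (from concat-∈ (Any.map⁺ (Any.map (λ a → ∈-block (Any.map (λ { refl → ≐-refl }) a)) any)))
          V-dim′ = proj₁ (proj₂ (proj₂ hyp))
          H-dim = proj₂ (proj₂ (proj₂ hyp))

⇔-eq : ∀ {x y : ℚ} → x ≡ y → x ≡ 0ℚ ⇔ y ≡ 0ℚ
⇔-eq e = mk⇔ (trans (sym e)) (trans e)

⇔-opp : ∀ {x y : ℚ} → x + y ≡ 0ℚ → x ≡ 0ℚ ⇔ y ≡ 0ℚ
⇔-opp {x} {y} e = mk⇔ (λ { refl → trans (sym (+-identityˡ y)) e }) (λ { refl → trans (sym (+-identityʳ x)) e })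

FreeOn : Subspace n → List (Fin n) → Set
FreeOn V vs = ∀ y → ∃ λ v → V v × All (λ u → Vec.lookup v u ≡ Vec.lookup y u) vs

VanishOn : List (Fin n) → Vec ℚ n → Set
VanishOn vs x = All (λ u → Vec.lookup x u ≡ 0ℚ) vs

SupportedOn : List (Fin n) → Form n → Set
SupportedOn vs f = ∀ x → VanishOn vs x → f ⟨ x ⟩ ≡ 0ℚ

unit : Fin n → Vec ℚ n
unit t = 0ᵥ [ t ]≔ 1ℚ

unit-same : ∀ (t : Fin n) → Vec.lookup (unit t) t ≡ 1ℚ
unit-same t = lookup∘update t 0ᵥ 1ℚ

unit-other : ∀ {t u : Fin n} → t ≢ u → Vec.lookup (unit t) u ≡ 0ℚ
unit-other {t = t} {u} t≢u = trans (lookup∘update′ (t≢u ∘ sym) 0ᵥ 1ℚ) (lookup-0ᵥ u)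

record Good {n} (vs : List (Fin n)) (π : Config n) : Set₁ where
  field
    supported : All (All (SupportedOn vs)) π
    factored  : ∀ {V} → FiniteDim V → FreeOn V vs → IF V (real V π)

open Good

weaken : ∀ {vs : List (Fin n)} {π} t → Good vs π → Good (t ∷ vs) π
weaken t g = record
  { supported = All.map (All.map λ s x → λ { (_ ∷ z) → s x z }) (supported g)
  ; factored = λ V-dim free → factored g V-dim λ y → let (v , v∈ , e) = free y in v , v∈ , All.tail e }

cut-dim : ∀ {V : Subspace n} {w h} → FiniteDim V → V w → h ⟨ w ⟩ ≢ 0ℚ → FiniteDim (V ∩ ker h)
cut-dim {h = h} (d , V-dim) w∈V hw with hasDim-cut V-dim h
... | inj₁ z = ⊥-elim (hw (z _ w∈V))
... | inj₂ C = _ , ProperCut.dim C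

cut-dim₁ : ∀ {V : Subspace n} {w h} → FiniteDim V → V w → h ⟨ w ⟩ ≡ 1ℚ → FiniteDim (V ∩ ker h)
cut-dim₁ {h = h} V-dim w∈V hw = cut-dim {h = h} V-dim w∈V λ e → 1≢0 (trans (sym hw) e)

cut-free : ∀ {V : Subspace n} {vs δ} h → FiniteDim V → FreeOn V vs → V δ → VanishOn vs δ → h ⟨ δ ⟩ ≡ 1ℚ →
  FreeOn (V ∩ ker h) vs
cut-free {V = V} {vs} {δ} h V-dim free δ∈V z hδ y =
  let (v , v∈ , e) = free y in
  project V-dim δ∈V h v , (project-∈ V-dim δ∈V h v∈ , project-ker V-dim δ∈V h v hδ) ,
  All.zipWith (λ {u} → λ { (eu , zu) → trans (project-inv V-dim δ∈V h (coord u) v zu) eu }) (e , z)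

direction : ∀ {V : Subspace n} {t vs} → FreeOn V (t ∷ vs) → All (t ≢_) vs → ∃ λ δ → V δ × Vec.lookup δ t ≡
  1ℚ × VanishOn vs δ
direction {t = t} free ne with free (unit t)
... | δ , δ∈V , e ∷ es = δ , δ∈V , trans e (unit-same t) , All.zipWith
  (λ { (p , q) → trans p (unit-other q) }) (es , ne)

free-tail : ∀ {V : Subspace n} {t vs} → FreeOn V (t ∷ vs) → FreeOn V vs
free-tail free y = let (v , v∈ , e) = free y in v , v∈ , All.tail e

goodFibre : ∀ front (π : Config n) {t vs} b bs → All (t ≢_) vs →
  All (λ b → ∀ x → VanishOn vs x → b ⟨ x ⟩ ≡ Vec.lookup x t) (b ∷ bs) →
  AllPairs (λ b b′ → Any (Any (λ f → ∀ x → b ⟨ x ⟩ ≡ 0ℚ → b′ ⟨ x ⟩ ≡ 0ℚ ⇔ f ⟨ x ⟩ ≡ 0ℚ)) (without front π)) (b ∷ bs) →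
  Good vs (without front π) → Good (t ∷ vs) (insertAfter front (b ∷ bs) π)
goodFibre front π {t} {vs} b bs t∉vs heads diffs g = record
  { supported = All-insertAfter front (All.map (λ hd x → λ { (xt ∷ z) → trans (hd x z) xt }) heads)
    (supported (weaken t g))
  ; factored = λ {V} V-dim free →
      let (δ , δ∈V , δt , δz) = direction free t∉vs
          bδ = All.map (λ hd → trans (hd δ δz) δt) heads
      in addFibre V-dim δ∈V front π b bs bδ
           (All.map (All.map λ s → s δ δz) (supported g))
           (AllPairs.map (λ d → Any.map (Any.map λ p x _ → p x) d) diffs)
           (factored g V-dim (free-tail free))
           (All.map (λ {h} hδ → factored g (cut-dim₁ {h = h} V-dim δ∈V hδ)
             (cut-free h V-dim (free-tail free) δ∈V δz hδ)) bδ) }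

-- Paths

infixl 6 _+ᶠ_ _-ᶠ_
_+ᶠ_ : Form n → Form n → Form n
f +ᶠ g = record
  { fun = λ x → f ⟨ x ⟩ + g ⟨ x ⟩
  ; +-homo = λ x y → trans (cong₂ _+_ (Form.+-homo f x y) (Form.+-homo g x y))
    (solve 4 (λ a b c d → (a :+ b) :+ (c :+ d) := (a :+ c) :+ (b :+ d)) refl (f ⟨ x ⟩) (f ⟨ y ⟩) (g ⟨ x ⟩) (g ⟨ y ⟩))
  ; *-homo = λ c x → trans (cong₂ _+_ (Form.*-homo f c x) (Form.*-homo g c x))
    (solve 3 (λ c a b → c :* a :+ c :* b := c :* (a :+ b)) refl c (f ⟨ x ⟩) (g ⟨ x ⟩)) }

_-ᶠ_ : Form n → Form n → Form n
f -ᶠ g = f +ᶠ ((- 1ℚ) ·ᶠ g)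

0ᶠ : Form n
0ᶠ = record { fun = λ _ → 0ℚ ; +-homo = λ _ _ → refl ; *-homo = λ c _ → sym (*-zeroʳ c) }

sumForm : List (Fin n) → Form n
sumForm [] = 0ᶠ
sumForm (u ∷ us) = coord u +ᶠ sumForm us

sum-++ : ∀ (p q : List (Fin n)) x → sumForm (p ++ q) ⟨ x ⟩ ≡ sumForm p ⟨ x ⟩ + sumForm q ⟨ x ⟩
sum-++ [] q x = sym (+-identityˡ _)
sum-++ (u ∷ p) q x = trans (cong (Vec.lookup x u +_) (sum-++ p q x)) (sym (+-assoc (Vec.lookup x u) _ _))

sum-[] : ∀ (u : Fin n) x → sumForm (u ∷ []) ⟨ x ⟩ ≡ Vec.lookup x u
sum-[] u x = +-identityʳ _

sum-vanish : ∀ (p : List (Fin n)) x → VanishOn p x → sumForm p ⟨ x ⟩ ≡ 0ℚ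
sum-vanish [] x [] = refl
sum-vanish (u ∷ p) x (z ∷ zs) = trans (cong₂ _+_ z (sum-vanish p x zs)) (+-identityˡ 0ℚ)

module _ {n : ℕ} where

  -- The connected sets along the path p ++ ts that contain p; E lists what may follow its last vertex.

  extensions : List (List (Fin n)) → List (Fin n) → List (Fin n) → List (List (Fin n))
  extensions E p []       = p ∷ map (p ++_) E
  extensions E p (t ∷ ts) = p ∷ extensions E (p ∷ʳ t) ts

  tailBlocks : List (List (Fin n)) → List (Fin n) → List (List (List (Fin n)))
  tailBlocks E []       = []
  tailBlocks E (t ∷ ts) = extensions E (t ∷ []) ts ∷ tailBlocks E ts

  extensions-++ : ∀ E p q ts → extensions E (p ++ q) ts ≡ map (p ++_) (extensions E q ts)
  extensions-++ E p q [] = cong ((p ++ q) ∷_) (trans (List.map-cong (λ e → List.++-assoc p q e) E) (List.map-∘ E))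
  extensions-++ E p q (t ∷ ts) = cong ((p ++ q) ∷_) (trans
    (cong (λ r → extensions E r ts) (List.++-assoc p q (t ∷ []))) (extensions-++ E p (q ∷ʳ t) ts))

  extensions-vanish : ∀ E p ts → All (λ y → ∀ x → VanishOn ts x → All (λ e → VanishOn e x) E → sumForm y ⟨ x
    ⟩ ≡ sumForm p ⟨ x ⟩) (extensions E p ts)
  extensions-vanish E p [] = (λ x _ _ → refl) ∷ All.map⁺ (All.tabulate λ {e} e∈ x _ zE →
    trans (sum-++ p e x) (trans (cong (sumForm p ⟨ x ⟩ +_) (sum-vanish e x (All.lookup zE e∈))) (+-identityʳ _)))
  extensions-vanish E p (t ∷ ts) = (λ x _ _ → refl) ∷ All.map (λ h x → λ { (zt ∷ z) zE →
    trans (h x z zE) (trans (sum-++ p (t ∷ []) x) (trans (cong (sumForm p ⟨ x ⟩ +_) (trans (sum-[] t x) zt))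
      (+-identityʳ _))) }) (extensions-vanish E (p ∷ʳ t) ts)

  Difference : (List (Fin n) → Set) → List (Fin n) → List (Fin n) → Set
  Difference P p q = ∃ λ r → P r × ∀ x → sumForm q ⟨ x ⟩ ≡ sumForm p ⟨ x ⟩ + sumForm r ⟨ x ⟩

  extensions-differences : ∀ {P : List (Fin n) → Set} {E} → All P E → AllPairs (Difference P) E →
    ∀ p ts → All (All P) (tailBlocks E ts) → AllPairs (Difference P) (extensions E p ts)
  extensions-differences PE dE p [] [] =
    All.map⁺ (All.map (λ {e} Pe → e , Pe , sum-++ p e) PE) ∷
    AllPairs.map⁺ (AllPairs.map (λ { {e} {e′} (r , Pr , eq) → r , Pr , λ x →
      trans (sum-++ p e′ x) (trans (cong (sumForm p ⟨ x ⟩ +_) (eq x))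
        (trans (sym (+-assoc (sumForm p ⟨ x ⟩) _ _)) (cong (_+ sumForm r ⟨ x ⟩) (sym (sum-++ p e x))))) }) dE)
  extensions-differences {P} {E} PE dE p (t ∷ ts) (Pt ∷ Pts) =
    subst (All (Difference P p)) (sym (extensions-++ E p (t ∷ []) ts))
      (All.map⁺ (All.map (λ {r} Pr → r , Pr , sum-++ p r) Pt)) ∷
    extensions-differences PE dE (p ∷ʳ t) ts Pts

  sumBlocks : List (List (List (Fin n))) → Config n
  sumBlocks = map (map sumForm)

  Contains : Config n → List (Fin n) → Set
  Contains π r = Any (Any λ f → ∀ x → f ⟨ x ⟩ ≡ 0ℚ ⇔ sumForm r ⟨ x ⟩ ≡ 0ℚ) π

  contains-blocks : ∀ (π : Config n) bs → (∀ r → Contains (sumBlocks bs) r → Contains π r) → All (All (Contains π)) bs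
  contains-blocks π [] _ = []
  contains-blocks π (B ∷ bs) inc = go B (λ r c → inc r (here c)) ∷ contains-blocks π bs (λ r c → inc r (there c))
    where
    go : ∀ B → (∀ r → Any (λ f → ∀ x → f ⟨ x ⟩ ≡ 0ℚ ⇔ sumForm r ⟨ x ⟩ ≡ 0ℚ) (map sumForm B) → Contains π r)
      → All (Contains π) B
    go [] _ = []
    go (r ∷ B) inc = inc r (here λ x → ⇔-eq refl) ∷ go B (λ r c → inc r (there c))

  difference⇒ : ∀ {π : Config n} p q → Difference (Contains π) p q →
    Any (Any (λ f → ∀ x → sumForm p ⟨ x ⟩ ≡ 0ℚ → sumForm q ⟨ x ⟩ ≡ 0ℚ ⇔ f ⟨ x ⟩ ≡ 0ℚ)) π
  difference⇒ p q (r , any , eq) = Any.map (Any.map λ {f} f⇔r x px →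
    let q≡r : sumForm q ⟨ x ⟩ ≡ sumForm r ⟨ x ⟩
        q≡r = trans (eq x) (trans (cong (_+ sumForm r ⟨ x ⟩) px) (+-identityˡ _))
    in mk⇔ (λ qx → from (f⇔r x) (trans (sym q≡r) qx)) (λ fx → trans q≡r (to (f⇔r x) fx))) any

  extensions-good : ∀ front (π : Config n) E t ts vs → All (t ≢_) (ts ++ vs) →
    All (λ e → ∀ x → VanishOn vs x → VanishOn e x) E →
    All (Contains (without front π)) E → AllPairs (Difference (Contains (without front π))) E →
    All (All (Contains (without front π))) (tailBlocks E ts) →
    Good (ts ++ vs) (without front π) → Good (t ∷ ts ++ vs)
      (insertAfter front (map sumForm (extensions E (t ∷ []) ts)) π)
  extensions-good front π E t ts vs t∉ E⊆ cE dE cts g = go (extensions E (t ∷ []) ts) (nonempty {ts}) heads diffs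
    where
    heads : All (λ y → ∀ x → VanishOn (ts ++ vs) x → sumForm y ⟨ x ⟩ ≡ Vec.lookup x t) (extensions E (t ∷ []) ts)
    heads = All.map (λ h x z → trans (h x (All.++⁻ˡ ts z) (All.map (λ s → s x (All.++⁻ʳ ts z)) E⊆))
      (sum-[] t x)) (extensions-vanish E (t ∷ []) ts)
    diffs : AllPairs (Difference (Contains (without front π))) (extensions E (t ∷ []) ts)
    diffs = extensions-differences cE dE (t ∷ []) ts cts
    nonempty : ∀ {ts} → extensions E (t ∷ []) ts ≢ []
    nonempty {[]} ()
    nonempty {_ ∷ _} ()
    go : ∀ ys → ys ≢ [] → All (λ y → ∀ x → VanishOn (ts ++ vs) x → sumForm y ⟨ x ⟩ ≡ Vec.lookup x t) ys →
         AllPairs (Difference (Contains (without front π))) ys → Good (t ∷ ts ++ vs)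
           (insertAfter front (map sumForm ys) π)
    go [] ne _ _ = ⊥-elim (ne refl)
    go (y ∷ ys) _ hs ds = goodFibre front π (sumForm y) (map sumForm ys) t∉ (All.map⁺ {xs = y ∷ ys} hs)
      (AllPairs.map⁺ {xs = y ∷ ys} (AllPairs.map (λ {p} {q} → difference⇒ p q) ds)) g

  path-good : ∀ {vs π} ts → AllPairs _≢_ (ts ++ vs) → Good vs π → Good (ts ++ vs) (sumBlocks (tailBlocks [] ts) ++ π)
  path-good [] _ g = g
  path-good {vs} {π} (t ∷ ts) (t∉ ∷ u) g =
    extensions-good nothing (sumBlocks (tailBlocks [] ts) ++ π) [] t ts vs t∉ [] [] []
      (contains-blocks _ (tailBlocks [] ts) (λ r → Any.++⁺ˡ)) (path-good ts u g)

block-≋ : ∀ {V : Subspace n} {B C} → Pointwise (λ f g → ∀ x → V x → f ⟨ x ⟩ ≡ 0ℚ ⇔ g ⟨ x ⟩ ≡ 0ℚ) B C → block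
  V B ≋ block V C
block-≋ [] = ≋-refl
block-≋ {V = V} {f ∷ B} {g ∷ C} (e ∷ es) =
  (λ { (here p) → here (≐-trans p f≐g) ; (there p) → there (proj₁ (block-≋ es) p) }) ,
  (λ { (here p) → here (≐-trans p (≐-sym f≐g)) ; (there p) → there (proj₂ (block-≋ es) p) })
  where
  f≐g : (V ∩ ker f) ≐ (V ∩ ker g)
  f≐g = (λ { (v , fx) → v , to (e _ v) fx }) , (λ { (v , gx) → v , from (e _ v) gx })

-- Kites

-- A kite is a path ts with two adjacent vertices a and b joined to its last vertex.  The block
-- `apex` collects a, b and the sets s ∷ʳ a for s a suffix of ts.  Restricting to the longest of
-- them yields the kite of the shorter path together with the hyperplane x_a = x_b, hence `aux`.

module KiteConfig {n} {vs : List (Fin n)} {π : Config n} (g : Good vs π) (a b : Fin n) where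

  ends : List (List (Fin n))
  ends = (b ∷ []) ∷ (a ∷ b ∷ []) ∷ []

  edge : Form n
  edge = sumForm (a ∷ b ∷ [])

  apex₀ : Bool → List (Form n)
  apex₀ true  = sumForm (a ∷ []) ∷ (coord a -ᶠ coord b) ∷ sumForm (b ∷ []) ∷ []
  apex₀ false = sumForm (a ∷ []) ∷ sumForm (b ∷ []) ∷ []

  apex : Bool → List (Fin n) → List (Form n)
  apex aux []       = apex₀ aux
  apex aux     (t ∷ ts) = sumForm ((t ∷ ts) ∷ʳ a) ∷ apex aux ts

  tails : List (Fin n) → Config n
  tails ts = sumBlocks (tailBlocks ends ts) ++ (edge ∷ []) ∷ π

  kite : Bool → List (Fin n) → Config n
  kite aux ts = apex aux ts ∷ tails ts

  apex-All : ∀ {p} {P : Form n → Set p} ts → All P (apex true ts) → ∀ aux → All P (apex aux ts)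
  apex-All ts ps true = ps
  apex-All [] (p ∷ q ∷ r ∷ []) false = p ∷ r ∷ []
  apex-All (t ∷ ts) (p ∷ ps) false = p ∷ apex-All ts ps false

  private
    ab-point : ℚ → ℚ → Vec ℚ n
    ab-point α β = (0ᵥ [ b ]≔ β) [ a ]≔ α

  module _ (a∉ : All (a ≢_) (b ∷ vs)) (b∉ : All (b ≢_) vs) where
    private
      a≢b : a ≢ b
      a≢b = All.head a∉

      point : ∀ {V : Subspace n} → FreeOn V (a ∷ b ∷ vs) → ∀ α β →
              ∃ λ v → V v × Vec.lookup v a ≡ α × Vec.lookup v b ≡ β × VanishOn vs v
      point free α β with free (ab-point α β)
      ... | v , v∈ , ea ∷ eb ∷ es = v , v∈ , trans ea (lookup∘update a (0ᵥ [ b ]≔ β) α) ,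
            trans eb (trans (lookup∘update′ (a≢b ∘ sym) (0ᵥ [ b ]≔ β) α) (lookup∘update b 0ᵥ β)) ,
            All.zipWith (λ { {u} (e , a≢u , b≢u) → trans e (trans
              (lookup∘update′ (a≢u ∘ sym) (0ᵥ [ b ]≔ β) α) (trans (lookup∘update′ (b≢u ∘ sym) 0ᵥ β) (lookup-0ᵥ u))) })
              (es , All.zip (All.tail a∉ , b∉))

      edge-value : ∀ x → edge ⟨ x ⟩ ≡ Vec.lookup x a + Vec.lookup x b
      edge-value x = cong (Vec.lookup x a +_) (+-identityʳ _)

      base-supported : All (All (SupportedOn (a ∷ b ∷ vs))) ((edge ∷ []) ∷ π)
      base-supported = ((λ x → λ { (za ∷ zb ∷ _) → sum-vanish (a ∷ b ∷ []) x (za ∷ zb ∷ []) }) ∷ []) ∷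
        supported (weaken a (weaken b g))

      edge-factored : ∀ {V} → FiniteDim V → FreeOn V vs → ∀ {δ} → V δ → VanishOn vs δ → edge ⟨ δ ⟩ ≡ 1ℚ → IF
        V (real V ((edge ∷ []) ∷ π))
      edge-factored V-dim free {δ} δ∈V z eδ = addFibre V-dim δ∈V nothing π edge [] (eδ ∷ [])
        (All.map (All.map λ s → s δ z) (supported g)) ([] ∷ [])
        (factored g V-dim free) (factored g (cut-dim₁ {h = edge} V-dim δ∈V eδ) (cut-free edge V-dim free δ∈V z eδ) ∷ [])

      -- Scaled to take the value 1 in the direction (1, -1), on which x_a + x_b vanishes.
      scaled : Bool → List (Form n)
      scaled true  = (½ ·ᶠ (coord a -ᶠ coord b)) ∷ ((- 1ℚ) ·ᶠ sumForm (b ∷ [])) ∷ []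
      scaled false = ((- 1ℚ) ·ᶠ sumForm (b ∷ [])) ∷ []

      apex₀-factored : ∀ aux {V} → FiniteDim V → FreeOn V (a ∷ b ∷ vs) → IF V
        (real V ((sumForm (a ∷ []) ∷ scaled aux) ∷ (edge ∷ []) ∷ π))
      apex₀-factored aux {V} V-dim free with point free 1ℚ (- 1ℚ)
      ... | δ , δ∈V , δa , δb , δz = addFibre V-dim δ∈V nothing ((edge ∷ []) ∷ π) (sumForm (a ∷ [])) (scaled aux)
              (aδ ∷ scaled-1 aux) (((trans (edge-value δ) (cong₂ _+_ δa δb)) ∷ []) ∷ All.map
                (All.map λ s → s δ δz) (supported g))
              (diffs aux) (edge-here free-vs) (cut-a ∷ cuts aux)
        where
        fa = sumForm (a ∷ [])
        fab = ½ ·ᶠ (coord a -ᶠ coord b)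
        fb = (- 1ℚ) ·ᶠ sumForm (b ∷ [])
        free-vs : FreeOn V vs
        free-vs = free-tail (free-tail free)
        aδ : fa ⟨ δ ⟩ ≡ 1ℚ
        aδ = trans (sum-[] a δ) δa
        abδ : fab ⟨ δ ⟩ ≡ 1ℚ
        abδ = cong₂ (λ x y → ½ * (x + - 1ℚ * y)) δa δb
        bδ : fb ⟨ δ ⟩ ≡ 1ℚ
        bδ = cong (- 1ℚ *_) (trans (sum-[] b δ) δb)
        scaled-1 : ∀ aux → All (λ f → f ⟨ δ ⟩ ≡ 1ℚ) (scaled aux)
        scaled-1 true = abδ ∷ bδ ∷ []
        scaled-1 false = bδ ∷ []
        viaEdge : ∀ f g → (∀ A B → f ⟨ A ⟩ ≡ B → B ≡ 0ℚ → g ⟨ A ⟩ ≡ 0ℚ ⇔ edge ⟨ A ⟩ ≡ 0ℚ) → Any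
          (Any (SameRestriction V f g)) ((edge ∷ []) ∷ π)
        viaEdge f g p = here (here λ x _ fx → p x _ refl fx)
        ⇔-scale : ∀ {x y} c d → x ≡ c * y → y ≡ d * x → x ≡ 0ℚ ⇔ y ≡ 0ℚ
        ⇔-scale c d p q = mk⇔ (λ { refl → trans q (*-zeroʳ d) }) (λ { refl → trans p (*-zeroʳ c) })
        a-ab : Any (Any (SameRestriction V fa fab)) ((edge ∷ []) ∷ π)
        a-ab = viaEdge fa fab λ x _ r e → let A = Vec.lookup x a ; B = Vec.lookup x b
                                              A≡0 : A ≡ 0ℚ
                                              A≡0 = trans (sym (sum-[] a x)) (trans r e)
          in ⇔-scale (- ½) (- (1ℚ + 1ℚ))
               (trans (cong (λ z → ½ * (z + - 1ℚ * B)) A≡0) (trans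
                 (solve 1 (λ B → con ½ :* (con 0ℚ :+ :- con 1ℚ :* B) := :- con ½ :* (con 0ℚ :+ B)) refl B)
                 (cong (- ½ *_) (trans (cong (_+ B) (sym A≡0)) (sym (edge-value x))))))
               (trans (edge-value x) (trans (cong (_+ B) A≡0)
                 (trans (solve 1 (λ B → con 0ℚ :+ B := :- (con 1ℚ :+ con 1ℚ) :*
                 (con ½ :* (con 0ℚ :+ :- con 1ℚ :* B))) refl B)
                 (cong (λ z → - (1ℚ + 1ℚ) * (½ * (z + - 1ℚ * B))) (sym A≡0)))))
        a-b : Any (Any (SameRestriction V fa fb)) ((edge ∷ []) ∷ π)
        a-b = viaEdge fa fb λ x _ r e → let A = Vec.lookup x a ; B = Vec.lookup x b
                                            A≡0 : A ≡ 0ℚ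
                                            A≡0 = trans (sym (sum-[] a x)) (trans r e)
          in ⇔-scale (- 1ℚ) (- 1ℚ)
               (cong (- 1ℚ *_) (trans (sum-[] b x) (trans (sym (+-identityˡ B))
                 (trans (cong (_+ B) (sym A≡0)) (sym (edge-value x))))))
               (trans (edge-value x) (trans (cong (_+ B) A≡0)
                 (trans (solve 1 (λ B → con 0ℚ :+ B := :- con 1ℚ :* (:- con 1ℚ :* (B :+ con 0ℚ))) refl B) refl)))
        ab-b : Any (Any (SameRestriction V fab fb)) ((edge ∷ []) ∷ π)
        ab-b = viaEdge fab fb λ x _ r e → let A = Vec.lookup x a ; B = Vec.lookup x b
                                              A≡B : A ≡ B
                                              A≡B = trans (solve 2 (λ A B → A := (con 1ℚ :+ con 1ℚ) :*
                                                (con ½ :* (A :+ :- con 1ℚ :* B)) :+ B) refl A B)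
                                                     (trans (cong (λ z → (1ℚ + 1ℚ) * z + B) (trans r e))
                                                       (solve 1 (λ B → (con 1ℚ :+ con 1ℚ) :* con 0ℚ :+ B := B) refl B))
          in ⇔-scale (- ½) (- (1ℚ + 1ℚ))
               (trans (solve 1 (λ B → :- con 1ℚ :* (B :+ con 0ℚ) := :- con ½ :* (B :+ B)) refl B)
                 (cong (- ½ *_) (trans (cong (_+ B) (sym A≡B)) (sym (edge-value x)))))
               (trans (edge-value x) (trans (cong (_+ B) A≡B)
                 (solve 1 (λ B → B :+ B := :- (con 1ℚ :+ con 1ℚ) :* (:- con 1ℚ :* (B :+ con 0ℚ))) refl B)))
        diffs : ∀ aux → AllPairs (λ f g → Any (Any (SameRestriction V f g)) ((edge ∷ []) ∷ π)) (fa ∷ scaled aux)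
        diffs true = (a-ab ∷ a-b ∷ []) ∷ (ab-b ∷ []) ∷ [] ∷ []
        diffs false = (a-b ∷ []) ∷ [] ∷ []
        edge-here : FreeOn V vs → IF V (real V ((edge ∷ []) ∷ π))
        edge-here fr = let (v , v∈ , va , vb , vz) = point free 1ℚ 0ℚ in edge-factored V-dim fr v∈ vz (trans (edge-value v) (cong₂ _+_ va vb))
        cutAt : ∀ h α β → h ⟨ δ ⟩ ≡ 1ℚ → α + β ≡ 1ℚ → (∀ x → Vec.lookup x a ≡ α → Vec.lookup x b ≡ β → h ⟨ x
          ⟩ ≡ 0ℚ) → IF (V ∩ ker h) (real (V ∩ ker h) ((edge ∷ []) ∷ π))
        cutAt h α β hδ αβ z = let (v , v∈ , va , vb , vz) = point free α β in
          edge-factored (cut-dim₁ {h = h} V-dim δ∈V hδ) (cut-free h V-dim free-vs δ∈V δz hδ)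
            (v∈ , z v va vb) vz (trans (edge-value v) (trans (cong₂ _+_ va vb) αβ))
        cut-a : IF (V ∩ ker fa) (real (V ∩ ker fa) ((edge ∷ []) ∷ π))
        cut-a = cutAt fa 0ℚ 1ℚ aδ refl λ x xa _ → trans (sum-[] a x) xa
        cut-ab : IF (V ∩ ker fab) (real (V ∩ ker fab) ((edge ∷ []) ∷ π))
        cut-ab = cutAt fab ½ ½ abδ refl λ x xa xb → cong₂ (λ p q → ½ * (p + - 1ℚ * q)) xa xb
        cut-b : IF (V ∩ ker fb) (real (V ∩ ker fb) ((edge ∷ []) ∷ π))
        cut-b = cutAt fb 1ℚ 0ℚ bδ refl λ x _ xb → cong (- 1ℚ *_) (trans (sum-[] b x) xb)
        cuts : ∀ aux → All (λ h → IF (V ∩ ker h) (real (V ∩ ker h) ((edge ∷ []) ∷ π))) (scaled aux)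
        cuts true = cut-ab ∷ cut-b ∷ []
        cuts false = cut-b ∷ []

      unscale : ∀ aux (V : Subspace n) → block V (sumForm (a ∷ []) ∷ scaled aux) ≋ block V (apex aux [])
      unscale aux V = block-≋ {V = V} (rest aux)
        where
        R = λ (f g : Form n) → ∀ x → V x → f ⟨ x ⟩ ≡ 0ℚ ⇔ g ⟨ x ⟩ ≡ 0ℚ
        same : ∀ f → R f f
        same f x _ = ⇔-eq refl
        neg : ∀ c d f → d * c ≡ 1ℚ → R (c ·ᶠ f) f
        neg c d f dc x _ = mk⇔
          (λ e → trans (trans (solve 3 (λ c d f → f := (d :* c) :* f :+ (con 1ℚ :+ :- (d :* c)) :* f) refl c
            d (f ⟨ x ⟩)) (trans (cong (λ z → z * f ⟨ x ⟩ + (1ℚ + - z) * f ⟨ x ⟩) dc)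
            (solve 1 (λ f → con 1ℚ :* f :+ (con 1ℚ :+ :- con 1ℚ) :* f := f) refl (f ⟨ x ⟩))))
                   (trans (trans (solve 1 (λ f → f := con 1ℚ :* f) refl (f ⟨ x ⟩))
                     (trans (cong (_* f ⟨ x ⟩) (sym dc)) (solve 3 (λ c d f → (d :* c) :* f := d :* (c :* f))
                     refl c d (f ⟨ x ⟩)))) (trans (cong (d *_) e) (*-zeroʳ d))))
          (λ e → trans (cong (c *_) e) (*-zeroʳ c))
        rest : ∀ aux → Pointwise R (sumForm (a ∷ []) ∷ scaled aux) (apex aux [])
        rest true = same (sumForm (a ∷ [])) ∷ neg ½ (1ℚ + 1ℚ) (coord a -ᶠ coord b) refl ∷ neg (- 1ℚ) (- 1ℚ)
          (sumForm (b ∷ [])) refl ∷ []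
        rest false = same (sumForm (a ∷ [])) ∷ neg (- 1ℚ) (- 1ℚ) (sumForm (b ∷ [])) refl ∷ []

    apex-supported : ∀ aux ts → All (SupportedOn (ts ++ a ∷ b ∷ vs)) (apex aux ts)
    apex-supported aux ts = apex-All ts (go ts) aux
      where
      go : ∀ ts → All (SupportedOn (ts ++ a ∷ b ∷ vs)) (apex true ts)
      go [] = (λ x → λ { (za ∷ _) → trans (sum-[] a x) za }) ∷
        (λ x → λ { (za ∷ zb ∷ _) → cong₂ (λ p q → p + - 1ℚ * q) za zb }) ∷
        (λ x → λ { (_ ∷ zb ∷ _) → trans (sum-[] b x) zb }) ∷ []
      go (t ∷ ts) = (λ x z → sum-vanish ((t ∷ ts) ∷ʳ a) x
        (All.++⁺ (All.++⁻ˡ (t ∷ ts) z) (All.head (All.++⁻ʳ (t ∷ ts) z) ∷ []))) ∷ All.map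
        (λ s x z → s x (All.tail z)) (go ts)

    kite₀-good : ∀ aux → Good (a ∷ b ∷ vs) (kite aux [])
    kite₀-good aux = record
      { supported = apex-supported aux [] ∷ base-supported
      ; factored = λ {V} V-dim free → IF-≋ {V = V} (unscale aux V ∷ Pointwise.refl ≋-refl)
        (apex₀-factored aux V-dim free) }

    private
      pairing : ∀ p ts → Pointwise (λ f g → ∀ x → sumForm p ⟨ x ⟩ + sumForm (ts ∷ʳ a) ⟨ x ⟩ ≡ 0ℚ → f ⟨ x ⟩ ≡
        0ℚ ⇔ g ⟨ x ⟩ ≡ 0ℚ)
                  (apex true ts) (map sumForm (extensions ends p ts))
      pairing p [] =
        (λ x h → ⇔-opp (trans (+-comm (sumForm (a ∷ []) ⟨ x ⟩) _) h)) ∷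
        (λ x h → ⇔-opp (trans (cong ((Vec.lookup x a + - 1ℚ * Vec.lookup x b) +_) (sum-++ p (b ∷ []) x))
                        (trans (solve 3 (λ A B P → (A :+ :- con 1ℚ :* B) :+ (P :+ (B :+ con 0ℚ)) := P :+
                          (A :+ con 0ℚ)) refl (Vec.lookup x a) (Vec.lookup x b) (sumForm p ⟨ x ⟩)) h))) ∷
        (λ x h → ⇔-eq (sym (trans (sum-++ p (a ∷ b ∷ []) x)
                        (trans (solve 3 (λ A B P → P :+ (A :+ (B :+ con 0ℚ)) := (P :+ (A :+ con 0ℚ)) :+
                          (B :+ con 0ℚ)) refl (Vec.lookup x a) (Vec.lookup x b) (sumForm p ⟨ x ⟩))
                        (trans (cong (_+ (Vec.lookup x b + 0ℚ)) h) (+-identityˡ _)))))) ∷ []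
      pairing p (t ∷ ts) =
        (λ x h → ⇔-opp (trans (+-comm (sumForm ((t ∷ ts) ∷ʳ a) ⟨ x ⟩) _) h)) ∷
        Pointwise.map (λ r x h → r x (trans (cong (_+ sumForm (ts ∷ʳ a) ⟨ x ⟩) (sum-++ p (t ∷ []) x))
          (trans (solve 3 (λ P T S → (P :+ (T :+ con 0ℚ)) :+ S := P :+ (T :+ S)) refl (sumForm p ⟨ x ⟩)
            (Vec.lookup x t) (sumForm (ts ∷ʳ a) ⟨ x ⟩)) h))) (pairing (p ∷ʳ t) ts)

      Avoids Full : List (Fin n) → List (Fin n) → List (Fin n) → Set
      Avoids p ts y = ∀ x → VanishOn ts x → Vec.lookup x b ≡ 0ℚ → sumForm y ⟨ x ⟩ ≡ sumForm p ⟨ x ⟩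
      Full p ts y = ∀ x → sumForm y ⟨ x ⟩ ≡ (sumForm p ⟨ x ⟩ + sumForm (ts ∷ʳ a) ⟨ x ⟩) + Vec.lookup x b

      shapes : ∀ p ts → All (λ y → Avoids p ts y ⊎ Full p ts y) (extensions ends p ts)
      shapes p [] =
        inj₁ (λ x _ _ → refl) ∷
        inj₁ (λ x _ xb → trans (sum-++ p (b ∷ []) x) (trans
          (cong (sumForm p ⟨ x ⟩ +_) (trans (sum-[] b x) xb)) (+-identityʳ _))) ∷
        inj₂ (λ x → trans (sum-++ p (a ∷ b ∷ []) x) (solve 3
          (λ A B P → P :+ (A :+ (B :+ con 0ℚ)) := (P :+ (A :+ con 0ℚ)) :+ B) refl (Vec.lookup x a)
          (Vec.lookup x b) (sumForm p ⟨ x ⟩))) ∷ []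
      shapes p (t ∷ ts) = inj₁ (λ x _ _ → refl) ∷ All.map (Sum.map
        (λ av x → λ { (zt ∷ z) xb → trans (av x z xb) (trans (sum-++ p (t ∷ []) x)
          (trans (cong (sumForm p ⟨ x ⟩ +_) (trans (sum-[] t x) zt)) (+-identityʳ _))) })
        (λ fl x → trans (fl x) (cong (_+ Vec.lookup x b) (trans
          (cong (_+ sumForm (ts ∷ʳ a) ⟨ x ⟩) (sum-++ p (t ∷ []) x))
          (solve 3 (λ P T S → (P :+ (T :+ con 0ℚ)) :+ S := P :+ (T :+ S)) refl (sumForm p ⟨ x ⟩)
            (Vec.lookup x t) (sumForm (ts ∷ʳ a) ⟨ x ⟩))))))
        (shapes (p ∷ʳ t) ts)

      apex-contains : ∀ aux ts → Any (λ f → ∀ x → f ⟨ x ⟩ ≡ 0ℚ ⇔ sumForm (a ∷ []) ⟨ x ⟩ ≡ 0ℚ) (apex aux ts) ×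
                               Any (λ f → ∀ x → f ⟨ x ⟩ ≡ 0ℚ ⇔ sumForm (b ∷ []) ⟨ x ⟩ ≡ 0ℚ) (apex aux ts)
      apex-contains true [] = here (λ x → ⇔-eq refl) , there (there (here λ x → ⇔-eq refl))
      apex-contains false [] = here (λ x → ⇔-eq refl) , there (here λ x → ⇔-eq refl)
      apex-contains aux (t ∷ ts) = let (p , q) = apex-contains aux ts in there p , there q

    module Step (aux : Bool) (t : Fin n) (ts : List (Fin n)) (t∉ : All (t ≢_) (ts ++ a ∷ b ∷ vs)) (unique : AllPairs _≢_ (ts ++ a ∷ b ∷ vs))
      (g-aux : Good (ts ++ a ∷ b ∷ vs) (kite aux ts)) (g⊤ : Good (ts ++ a ∷ b ∷ vs) (kite true ts)) where

      h₀ : Form n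
      h₀ = sumForm ((t ∷ ts) ∷ʳ a)

      Y : List (List (Fin n))
      Y = extensions ends (t ∷ []) ts

      fibre-good : Good (t ∷ ts ++ a ∷ b ∷ vs) (apex aux ts ∷ map sumForm Y ∷ tails ts)
      fibre-good = extensions-good (just (apex aux ts)) (tails ts) ends t ts (a ∷ b ∷ vs) t∉
        ((λ x → λ { (_ ∷ zb ∷ _) → zb ∷ [] }) ∷ (λ x → λ { (za ∷ zb ∷ _) → za ∷ zb ∷ [] }) ∷ [])
        (here (proj₂ (apex-contains aux ts)) ∷ there (Any.++⁺ʳ (sumBlocks (tailBlocks ends ts))
          (here (here λ x → ⇔-eq refl))) ∷ [])
        (((a ∷ [] , here (proj₁ (apex-contains aux ts)) , λ x → solve 2
          (λ A B → A :+ (B :+ con 0ℚ) := (B :+ con 0ℚ) :+ (A :+ con 0ℚ)) refl (Vec.lookup x a)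
          (Vec.lookup x b)) ∷ []) ∷ [] ∷ [])
        (contains-blocks (kite aux ts) (tailBlocks ends ts) (λ r c → there (Any.++⁺ˡ c)))
        g-aux

      same-restriction : Pointwise (λ f g → ∀ x → h₀ ⟨ x ⟩ ≡ 0ℚ → f ⟨ x ⟩ ≡ 0ℚ ⇔ g ⟨ x ⟩ ≡ 0ℚ)
        (apex true ts) (map sumForm Y)
      same-restriction = Pointwise.map (λ r x h → r x (trans
        (cong (_+ sumForm (ts ∷ʳ a) ⟨ x ⟩) (sum-[] t x)) h)) (pairing (t ∷ []) ts)

      h₀-value : ∀ x → VanishOn ts x → h₀ ⟨ x ⟩ ≡ Vec.lookup x t + Vec.lookup x a
      h₀-value x z = cong (Vec.lookup x t +_) (trans (sum-++ ts (a ∷ []) x)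
        (trans (cong₂ _+_ (sum-vanish ts x z) (sum-[] a x)) (+-identityˡ _)))

      module _ {V : Subspace n} (V-dim : FiniteDim V) (free : FreeOn V (t ∷ ts ++ a ∷ b ∷ vs)) where
        private
          t≢a : t ≢ a
          t≢a = All.head (All.++⁻ʳ ts t∉)
          t≢b : t ≢ b
          t≢b = All.head (All.tail (All.++⁻ʳ ts t∉))
          cross : ∀ ts → AllPairs _≢_ (ts ++ a ∷ b ∷ vs) → All (a ≢_) ts × All (b ≢_) ts
          cross [] _ = [] , []
          cross (s ∷ ts) (n ∷ u) = let (p , q) = cross ts u ; r = All.++⁻ʳ ts n
                                   in (All.head r ∘ sym) ∷ p , (All.head (All.tail r) ∘ sym) ∷ q
          a∉ts = proj₁ (cross ts unique)
          b∉ts = proj₂ (cross ts unique)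

          sample : ∀ y → ∃ λ v → V v × Vec.lookup v t ≡ Vec.lookup y t × All
            (λ u → Vec.lookup v u ≡ Vec.lookup y u) ts ×
                     Vec.lookup v a ≡ Vec.lookup y a × Vec.lookup v b ≡ Vec.lookup y b
          sample y with free y
          ... | v , v∈ , et ∷ es = v , v∈ , et , All.++⁻ˡ ts es , All.head (All.++⁻ʳ ts es) , All.head
            (All.tail (All.++⁻ʳ ts es))

          vanish-at : ∀ (y v : Vec ℚ n) {us} → All (λ u → Vec.lookup v u ≡ Vec.lookup y u) us → All
            (λ u → Vec.lookup y u ≡ 0ℚ) us → VanishOn us v
          vanish-at y v es zs = All.zipWith (λ { (p , q) → trans p q }) (es , zs)

          δ-all = direction free t∉
          δ = proj₁ δ-all
          δ∈V = proj₁ (proj₂ δ-all)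
          δt = proj₁ (proj₂ (proj₂ δ-all))
          δz = proj₂ (proj₂ (proj₂ δ-all))
          h₀δ : h₀ ⟨ δ ⟩ ≡ 1ℚ
          h₀δ = trans (h₀-value δ (All.++⁻ˡ ts δz)) (trans (cong₂ _+_ δt (All.head (All.++⁻ʳ ts δz))) (+-identityʳ 1ℚ))
          apexδ : All (λ f → f ⟨ δ ⟩ ≡ 0ℚ) (apex aux ts)
          apexδ = All.map (λ s → s δ δz) (apex-supported aux ts)
          tailsδ : All (All (λ f → f ⟨ δ ⟩ ≡ 0ℚ)) (tails ts)
          tailsδ = All.map (All.map λ s → s δ δz) (All.tail (supported g-aux))

          α-all = sample (unit a)
          α = proj₁ α-all
          α∈V = proj₁ (proj₂ α-all)
          αts : VanishOn ts α
          αts = vanish-at (unit a) α (proj₁ (proj₂ (proj₂ (proj₂ α-all)))) (All.map unit-other a∉ts)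
          αt : Vec.lookup α t ≡ 0ℚ
          αt = trans (proj₁ (proj₂ (proj₂ α-all))) (unit-other (t≢a ∘ sym))
          αb : Vec.lookup α b ≡ 0ℚ
          αb = trans (proj₂ (proj₂ (proj₂ (proj₂ (proj₂ α-all))))) (unit-other a≢b)
          αa : Vec.lookup α a ≡ 1ℚ
          αa = trans (proj₁ (proj₂ (proj₂ (proj₂ (proj₂ α-all))))) (unit-same a)
          h₀α : h₀ ⟨ α ⟩ ≡ 1ℚ
          h₀α = trans (h₀-value α αts) (trans (cong₂ _+_ αt αa) (+-identityˡ 1ℚ))

          β-all = sample (unit b)
          β = proj₁ β-all
          β∈V = proj₁ (proj₂ β-all)
          βts : VanishOn ts β
          βts = vanish-at (unit b) β (proj₁ (proj₂ (proj₂ (proj₂ β-all)))) (All.map unit-other b∉ts)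
          h₀β : h₀ ⟨ β ⟩ ≡ 0ℚ
          h₀β = trans (h₀-value β βts) (trans (cong₂ _+_ (trans (proj₁ (proj₂ (proj₂ β-all))) (unit-other (t≢b ∘ sym)))
                  (trans (proj₁ (proj₂ (proj₂ (proj₂ (proj₂ β-all))))) (unit-other (a≢b ∘ sym)))) (+-identityˡ 0ℚ))
          βb : Vec.lookup β b ≡ 1ℚ
          βb = trans (proj₂ (proj₂ (proj₂ (proj₂ (proj₂ β-all))))) (unit-same b)

          γ : Vec ℚ n
          γ = project V-dim α∈V h₀ δ
          γ∈V : V γ
          γ∈V = project-∈ V-dim α∈V h₀ δ∈V
          h₀γ : h₀ ⟨ γ ⟩ ≡ 0ℚ
          h₀γ = project-ker V-dim α∈V h₀ δ h₀α
          γts : VanishOn ts γ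
          γts = All.zipWith (λ {u} → λ { (z , z′) → trans (project-inv V-dim α∈V h₀ (coord u) δ z) z′ })
            (αts , All.++⁻ˡ ts δz)
          γb : Vec.lookup γ b ≡ 0ℚ
          γb = trans (project-inv V-dim α∈V h₀ (coord b) δ αb) (All.head (All.tail (All.++⁻ʳ ts δz)))
          γt : Vec.lookup γ t ≡ 1ℚ
          γt = trans (project-inv V-dim α∈V h₀ (coord t) δ αt) δt

          avoids-γ : ∀ y → Avoids (t ∷ []) ts y → sumForm y ⟨ γ ⟩ ≡ 1ℚ
          avoids-γ y av = trans (av γ γts γb) (trans (sum-[] t γ) γt)
          avoids-α : ∀ y → Avoids (t ∷ []) ts y → sumForm y ⟨ α ⟩ ≡ 0ℚ
          avoids-α y av = trans (av α αts αb) (trans (sum-[] t α) αt)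
          full-value : ∀ y → Full (t ∷ []) ts y → ∀ x → h₀ ⟨ x ⟩ ≡ 0ℚ → sumForm y ⟨ x ⟩ ≡ Vec.lookup x b
          full-value y fl x h = trans (fl x) (trans (cong (_+ Vec.lookup x b)
            (trans (cong (_+ sumForm (ts ∷ʳ a) ⟨ x ⟩) (sum-[] t x)) h)) (+-identityˡ _))

          distinct-Y : ∀ y → Avoids (t ∷ []) ts y ⊎ Full (t ∷ []) ts y → Distinct V h₀ (sumForm y)
          distinct-Y y (inj₁ av) e = 1≢0 (trans (sym (avoids-γ y av)) (proj₂ (proj₁ e (γ∈V , h₀γ))))
          distinct-Y y (inj₂ fl) e = 1≢0 (trans (sym (trans (full-value y fl β h₀β) βb)) (proj₂ (proj₁ e (β∈V , h₀β))))

          determined-Y : ∀ y z → Avoids (t ∷ []) ts y ⊎ Full (t ∷ []) ts y → Avoids (t ∷ []) ts z ⊎ Full (t ∷ []) ts z →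
                         Determined V h₀ (sumForm y) (sumForm z)
          determined-Y y z (inj₁ av) (inj₁ av′) = determined-δ V-dim α∈V h₀ (sumForm y) (sumForm z) h₀α
            (avoids-α y av) (avoids-α z av′)
          determined-Y y z (inj₁ av) (inj₂ fl) same = ⊥-elim
            (1≢0 (trans (sym (avoids-γ y av)) (from (same γ γ∈V h₀γ) (trans (full-value z fl γ h₀γ) γb))))
          determined-Y y z (inj₂ fl) (inj₁ av) same = ⊥-elim
            (1≢0 (trans (sym (avoids-γ z av)) (to (same γ γ∈V h₀γ) (trans (full-value y fl γ h₀γ) γb))))
          determined-Y y z (inj₂ fl) (inj₂ fl′) same x _ = ⇔-eq (trans (fl x) (sym (fl′ x)))

          apex-disjoint : All (Disjoint (block V (apex aux ts))) (real V (map sumForm Y ∷ tails ts))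
          apex-disjoint = AllPairs.head (IsPartition.disjoint (IF⇒isPartition (factored fibre-good V-dim free)))

          disjoint-∷ : ∀ {C} → Disjoint (block V (h₀ ∷ [])) (block V C) → Disjoint (block V (apex aux ts))
            (block V C) → Disjoint (block V (h₀ ∷ apex aux ts)) (block V C)
          disjoint-∷ d _ (here p , q) = d (here p , q)
          disjoint-∷ _ d (there p , q) = d (p , q)

          h₀∉Y : Disjoint (block V (h₀ ∷ [])) (block V (map sumForm Y))
          h₀∉Y (here p , q) with at-Any (Any.map⁻ (block-∈ {V = V} {C = map sumForm Y} q))
          ... | i , e = distinct-Y (lookup Y i) (All-at (shapes (t ∷ []) ts) i) (≐-trans (≐-sym p) e)

          disjoint-tails : ∀ π → All (All (λ f → f ⟨ δ ⟩ ≡ 0ℚ)) π → All (Disjoint (block V (apex aux ts)))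
            (real V π) → All (λ C → Disjoint (block V (h₀ ∷ apex aux ts)) (block V C)) π
          disjoint-tails [] _ _ = []
          disjoint-tails (C ∷ π) (c ∷ cs) (d ∷ ds) = (λ {H} → disjoint-∷ {C}
            (λ {H} → Disjoint-δ V-dim δ∈V {h₀ ∷ []} {C} (h₀δ ∷ []) c {H}) d {H}) ∷ disjoint-tails π cs ds

          apex⇒Y : All (λ f → Any (SameRestriction V h₀ f) (map sumForm Y)) (apex true ts)
          apex⇒Y = go same-restriction
            where
            go : ∀ {fs gs : List (Form n)} → Pointwise (λ f g → ∀ x → h₀ ⟨ x ⟩ ≡ 0ℚ → f ⟨ x ⟩ ≡ 0ℚ ⇔ g ⟨ x ⟩
              ≡ 0ℚ) fs gs → All (λ f → Any (SameRestriction V h₀ f) gs) fs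
            go [] = []
            go (r ∷ rs) = here (λ x _ h → r x h) ∷ All.map there (go rs)

          apex≢[] : ∀ aux ts → apex aux ts ≢ []
          apex≢[] true [] ()
          apex≢[] false [] ()
          apex≢[] aux (t ∷ ts) ()

        step-factored : IF V (real V (kite aux (t ∷ ts)))
        step-factored = addForm V-dim nothing h₀ (apex aux ts) (map sumForm Y ∷ tails ts)
          (δ , δ∈V , λ e → 1≢0 (trans (sym h₀δ) e))
          (All.map (λ {f} fδ e → 1≢0 (trans (sym h₀δ) (proj₂ (proj₂ e (δ∈V , fδ))))) apexδ)
          ((λ {H} → disjoint-∷ {map sumForm Y} (λ {H} → h₀∉Y {H}) (All.head apex-disjoint) {H}) ∷
            disjoint-tails (tails ts) tailsδ (All.tail apex-disjoint))
          (λ e → ⊥-elim (apex≢[] aux ts e)) (λ _ → factored fibre-good V-dim free)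
          (IF-≋ {V = V ∩ ker h₀} (block-≋ {V = V ∩ ker h₀} (Pointwise.map (λ r x vh → r x (proj₂ vh))
            same-restriction) ∷ Pointwise.refl ≋-refl)
            (factored g⊤ (cut-dim₁ {h = h₀} V-dim δ∈V h₀δ) (cut-free h₀ V-dim (free-tail free) δ∈V δz h₀δ)))
          (All.map⁺ (All.map (λ {y} s → All.map⁺ (All.map (λ {z} s′ → determined-Y y z s s′)
            (shapes (t ∷ []) ts))) (shapes (t ∷ []) ts)) ∷
           All.map (λ {C} c → all-determined-δ V-dim δ∈V h₀ C h₀δ c) tailsδ)
          (All.map here (apex-All ts apex⇒Y aux))

      step-good : Good (t ∷ ts ++ a ∷ b ∷ vs) (kite aux (t ∷ ts))
      step-good = record
        { supported = apex-supported aux (t ∷ ts) ∷ All.tail (supported fibre-good)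
        ; factored = step-factored }

    kite-good : ∀ aux ts → AllPairs _≢_ (ts ++ a ∷ b ∷ vs) → Good (ts ++ a ∷ b ∷ vs) (kite aux ts)
    kite-good aux [] _ = kite₀-good aux
    kite-good aux (t ∷ ts) (t∉ ∷ u) = Step.step-good aux t ts t∉ u (kite-good aux ts u) (kite-good true ts u)

subset-ext : ∀ {P Q : Subset n} → (∀ u → u ∈ₛ P → u ∈ₛ Q) → (∀ u → u ∈ₛ Q → u ∈ₛ P) → P ≡ Q
subset-ext p q = ⊆-antisym (p _) (q _)

-- Hyperplanes of subsets

ind : Bool → ℚ
ind false = 0ℚ
ind true  = 1ℚ

sumOver-+ : ∀ (I : Subset n) x y → sumOver I (x +ᵥ y) ≡ sumOver I x + sumOver I y
sumOver-+ [] [] [] = refl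
sumOver-+ (true ∷ I) (a ∷ x) (b ∷ y) = trans (cong ((a + b) +_) (sumOver-+ I x y))
  (solve 4 (λ a b c d → (a :+ b) :+ (c :+ d) := (a :+ c) :+ (b :+ d)) refl a b (sumOver I x) (sumOver I y))
sumOver-+ (false ∷ I) (a ∷ x) (b ∷ y) = sumOver-+ I x y

sumOver-* : ∀ (I : Subset n) c x → sumOver I (c *ᵥ x) ≡ c * sumOver I x
sumOver-* [] c [] = sym (*-zeroʳ c)
sumOver-* (true ∷ I) c (a ∷ x) = trans (cong (c * a +_) (sumOver-* I c x))
  (solve 3 (λ c a s → c :* a :+ c :* s := c :* (a :+ s)) refl c a (sumOver I x))
sumOver-* (false ∷ I) c (a ∷ x) = sumOver-* I c x

subsetForm : Subset n → Form n
subsetForm I = record { fun = sumOver I ; +-homo = sumOver-+ I ; *-homo = sumOver-* I }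

sumOver-unit : ∀ (I : Subset n) i → sumOver I (unit i) ≡ ind (Vec.lookup I i)
sumOver-unit (true ∷ I) zero = trans (cong (1ℚ +_) (form-0 (subsetForm I))) (+-identityʳ 1ℚ)
sumOver-unit (false ∷ I) zero = form-0 (subsetForm I)
sumOver-unit (true ∷ I) (suc i) = trans (+-identityˡ _) (sumOver-unit I i)
sumOver-unit (false ∷ I) (suc i) = sumOver-unit I i

_⊖_ : Fin n → Fin n → Vec ℚ n
i ⊖ j = unit i +ᵥ ((- 1ℚ) *ᵥ unit j)

sumOver-⊖ : ∀ (I : Subset n) i j → sumOver I (i ⊖ j) ≡ ind (Vec.lookup I i) + - 1ℚ * ind (Vec.lookup I j)
sumOver-⊖ I i j = trans (form-+* (subsetForm I) (unit i) (- 1ℚ) (unit j))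
  (cong₂ (λ a b → a + - 1ℚ * b) (sumOver-unit I i) (sumOver-unit I j))

module _ (J K L : Subset n) (sub : (hyperplane J ∩ hyperplane K) ⊆ hyperplane L) where
  private
    j k l : Fin n → Bool
    j = Vec.lookup J
    k = Vec.lookup K
    l = Vec.lookup L

    in-L : ∀ x → sumOver J x ≡ 0ℚ → sumOver K x ≡ 0ℚ → sumOver L x ≡ 0ℚ
    in-L x p q = sub (p , q)

  outside-both : ∀ i → j i ≡ false → k i ≡ false → l i ≡ false
  outside-both i ji ki with l i | trans (sym (sumOver-unit L i))
    (in-L (unit i) (trans (sumOver-unit J i) (cong ind ji)) (trans (sumOver-unit K i) (cong ind ki)))
  ... | false | _ = refl
  ... | true | ()

  same-type : ∀ i i′ → j i ≡ j i′ → k i ≡ k i′ → l i ≡ l i′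
  same-type i i′ ji ki with l i | l i′ | trans (sym (sumOver-⊖ L i i′)) (in-L (i ⊖ i′) (vanish J ji) (vanish K ki))
    where
    cancel : ∀ b → ind b + - 1ℚ * ind b ≡ 0ℚ
    cancel false = refl
    cancel true = refl
    vanish : ∀ I → Vec.lookup I i ≡ Vec.lookup I i′ → sumOver I (i ⊖ i′) ≡ 0ℚ
    vanish I e = trans (sumOver-⊖ I i i′) (trans (cong (λ b → ind b + - 1ℚ * ind (Vec.lookup I i′)) e)
      (cancel (Vec.lookup I i′)))
  ... | false | false | _ = refl
  ... | true | true | _ = refl
  ... | false | true | ()
  ... | true | false | ()

  additive : ∀ i i′ i″ → j i ≡ true → k i ≡ false → j i′ ≡ false → k i′ ≡ true → j i″ ≡ true → k i″ ≡ true →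
             (ind (l i) + ind (l i′)) + - 1ℚ * ind (l i″) ≡ 0ℚ
  additive i i′ i″ ji ki ji′ ki′ ji″ ki″ = trans (sym (value L))
    (in-L x (trans (value J) (at J ji ji′ ji″)) (trans (value K) (at K ki ki′ ki″)))
    where
    x = (unit i +ᵥ unit i′) +ᵥ ((- 1ℚ) *ᵥ unit i″)
    value : ∀ I → sumOver I x ≡ (ind (Vec.lookup I i) + ind (Vec.lookup I i′)) + - 1ℚ * ind (Vec.lookup I i″)
    value I = trans (form-+* (subsetForm I) (unit i +ᵥ unit i′) (- 1ℚ) (unit i″))
      (cong₂ (λ a b → a + - 1ℚ * b) (trans (sumOver-+ I (unit i) (unit i′))
        (cong₂ _+_ (sumOver-unit I i) (sumOver-unit I i′))) (sumOver-unit I i″))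
    at : ∀ I {p q r} → Vec.lookup I i ≡ p → Vec.lookup I i′ ≡ q → Vec.lookup I i″ ≡ r →
         (ind (Vec.lookup I i) + ind (Vec.lookup I i′)) + - 1ℚ * ind (Vec.lookup I i″) ≡ (ind p + ind q) + - 1ℚ * ind r
    at I refl refl refl = refl

hyperplane-≢U : ∀ {J : Subset n} → Nonempty J → ∃ λ x → ¬ hyperplane J x
hyperplane-≢U {J = J} (i , i∈) = unit i , λ h → bad (trans
  (sym (trans (sumOver-unit J i) (cong ind ([]=⇒lookup i∈)))) h)
  where
  bad : 1ℚ ≢ 0ℚ
  bad ()

hyperplane-injective : ∀ {J K : Subset n} → Nonempty J → Nonempty K → hyperplane J ⊆ hyperplane K → J ≡ K
hyperplane-injective {J = J} {K} _ (a , a∈K) sub = subset-ext J⊆K K⊆J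
  where
  sub′ : (hyperplane J ∩ hyperplane J) ⊆ hyperplane K
  sub′ (h , _) = sub h
  K⊆J : ∀ u → u ∈ₛ K → u ∈ₛ J
  K⊆J u u∈K with Vec.lookup J u in eq
  ... | true = lookup⇒[]= u J eq
  ... | false with trans (sym (outside-both J J K sub′ u eq eq)) ([]=⇒lookup u∈K)
  ...   | ()
  J⊆K : ∀ u → u ∈ₛ J → u ∈ₛ K
  J⊆K u u∈J = lookup⇒[]= u K (trans (same-type J J K sub′ u a j≡ j≡) ([]=⇒lookup a∈K))
    where j≡ = trans ([]=⇒lookup u∈J) (sym ([]=⇒lookup (K⊆J a a∈K)))

Sum : Subset n → Subset n → Subset n → Set
Sum J K L = (∀ i → i ∈ₛ J → i ∉ₛ K) × (∀ i → i ∈ₛ L ⇔ (i ∈ₛ J ⊎ i ∈ₛ K))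

Third : Subset n → Subset n → Subset n → Set
Third J K L = Sum J K L ⊎ Sum J L K ⊎ Sum K L J

module Dependent (J K L : Subset n) (sub : (hyperplane J ∩ hyperplane K) ⊆ hyperplane L) (L≢∅ : Nonempty L) where
  private
    j k l : Fin n → Bool
    j = Vec.lookup J
    k = Vec.lookup K
    l = Vec.lookup L

    Type : Bool → Bool → Bool → Set
    Type p q r = ∀ i → j i ≡ p → k i ≡ q → l i ≡ r

    data Info (p q : Bool) : Set where
      absent  : (∀ r → Type p q r) → Info p q
      present : ∀ i r → j i ≡ p → k i ≡ q → l i ≡ r → Type p q r → Info p q

    info : ∀ p q → Info p q
    info p q with Fin.any? (λ i → (j i Bool.≟ p) ×-dec (k i Bool.≟ q))
    ... | no none = absent λ r i ji ki → ⊥-elim (none (i , ji , ki))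
    ... | yes (i , ji , ki) = present i (l i) ji ki refl λ i′ ji′ ki′ → same-type J K L sub i′ i
      (trans ji′ (sym ji)) (trans ki′ (sym ki))

    00⇒0 : Type false false false
    00⇒0 = outside-both J K L sub

    table : (f : Bool → Bool → Bool) → f false false ≡ false → Type true false (f true false) → Type false
      true (f false true) → Type true true (f true true) →
            ∀ i → l i ≡ f (j i) (k i)
    table f z t10 t01 t11 i with j i in ji | k i in ki
    ... | false | false = trans (00⇒0 i ji ki) (sym z)
    ... | false | true = t01 i ji ki
    ... | true | false = t10 i ji ki
    ... | true | true = t11 i ji ki

    bits-ext : ∀ {P Q : Subset n} → (∀ i → Vec.lookup P i ≡ Vec.lookup Q i) → P ≡ Q
    bits-ext e = subset-ext (λ u u∈ → lookup⇒[]= u _ (trans (sym (e u)) ([]=⇒lookup u∈)))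
      (λ u u∈ → lookup⇒[]= u _ (trans (e u) ([]=⇒lookup u∈)))

    bits-Sum : ∀ {P Q R : Subset n} → (∀ i → (Vec.lookup P i ∧ Vec.lookup Q i ≡ false) ×
      (Vec.lookup R i ≡ Vec.lookup P i ∨ Vec.lookup Q i)) → Sum P Q R
    bits-Sum {P} {Q} {R} e = disj , λ i → mk⇔ (fwd i) (bwd i)
      where
      disj : ∀ i → i ∈ₛ P → i ∉ₛ Q
      disj i p q with trans (sym (proj₁ (e i))) (cong₂ _∧_ ([]=⇒lookup p) ([]=⇒lookup q))
      ... | ()
      fwd : ∀ i → i ∈ₛ R → i ∈ₛ P ⊎ i ∈ₛ Q
      fwd i r with Vec.lookup P i in pi | Vec.lookup Q i in qi | trans (sym ([]=⇒lookup r)) (proj₂ (e i))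
      ... | true | _ | _ = inj₁ (lookup⇒[]= i P pi)
      ... | false | true | _ = inj₂ (lookup⇒[]= i Q qi)
      bwd : ∀ i → i ∈ₛ P ⊎ i ∈ₛ Q → i ∈ₛ R
      bwd i (inj₁ p) = lookup⇒[]= i R (trans (proj₂ (e i)) (cong (_∨ Vec.lookup Q i) ([]=⇒lookup p)))
      bwd i (inj₂ q) = lookup⇒[]= i R (trans (proj₂ (e i))
        (trans (cong (Vec.lookup P i ∨_) ([]=⇒lookup q)) (∨-true (Vec.lookup P i))))
        where
        ∨-true : ∀ b → b ∨ true ≡ true
        ∨-true false = refl
        ∨-true true = refl

    Conclusion : Set
    Conclusion = L ≡ J ⊎ L ≡ K ⊎ Third J K L

    is-J : Type true false true → Type false true false → Type true true true → Conclusion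
    is-J p q r = inj₁ (bits-ext (table (λ x _ → x) refl p q r))
    is-K : Type true false false → Type false true true → Type true true true → Conclusion
    is-K p q r = inj₂ (inj₁ (bits-ext (table (λ _ y → y) refl p q r)))

    none : Type true true false → Type true true true → ∀ i → ¬ (j i ≡ true × k i ≡ true)
    none p q i (ji , ki) with trans (sym (p i ji ki)) (q i ji ki)
    ... | ()
    none₂ : ∀ {x y} → Type x y false → Type x y true → ∀ i → ¬ (j i ≡ x × k i ≡ y)
    none₂ p q i (ji , ki) with trans (sym (p i ji ki)) (q i ji ki)
    ... | ()

    is-union : Type true false true → Type false true true → (∀ r → Type true true r) → Conclusion
    is-union p q r = inj₂ (inj₂ (inj₁ (bits-Sum λ i → both i , table _∨_ refl p q (r true) i)))
      where
      both : ∀ i → j i ∧ k i ≡ false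
      both i with j i in ji | k i in ki
      ... | true | true = ⊥-elim (none (r false) (r true) i (ji , ki))
      ... | true | false = refl
      ... | false | _ = refl
    is-K∖J : (∀ r → Type true false r) → Type false true true → Type true true false → Conclusion
    is-K∖J p q r = inj₂ (inj₂ (inj₂ (inj₁ (bits-Sum go))))
      where
      go : ∀ i → (j i ∧ l i ≡ false) × (k i ≡ j i ∨ l i)
      go i with j i in ji | k i in ki
      ... | true | true = r i ji ki , refl
      ... | true | false = ⊥-elim (none₂ (p false) (p true) i (ji , ki))
      ... | false | true = refl , sym (q i ji ki)
      ... | false | false = refl , sym (00⇒0 i ji ki)
    is-J∖K : Type true false true → (∀ r → Type false true r) → Type true true false → Conclusion
    is-J∖K p q r = inj₂ (inj₂ (inj₂ (inj₂ (bits-Sum go))))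
      where
      go : ∀ i → (k i ∧ l i ≡ false) × (j i ≡ k i ∨ l i)
      go i with j i in ji | k i in ki
      ... | true | true = r i ji ki , refl
      ... | true | false = refl , sym (p i ji ki)
      ... | false | true = ⊥-elim (none₂ (q false) (q true) i (ji , ki))
      ... | false | false = refl , sym (00⇒0 i ji ki)
    is-empty : Type true false false → Type false true false → Type true true false → Conclusion
    is-empty p q r with table (λ _ _ → false) refl p q r (proj₁ L≢∅)
    ... | e with trans (sym e) ([]=⇒lookup (proj₂ L≢∅))
    ...   | ()

    contradiction : ∀ {i i′ i″ p q r} → j i ≡ true → k i ≡ false → l i ≡ p → j i′ ≡ false → k i′ ≡ true → l
      i′ ≡ q → j i″ ≡ true → k i″ ≡ true → l i″ ≡ r →
                    (ind p + ind q) + - 1ℚ * ind r ≢ 0ℚ → Conclusion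
    contradiction {i} {i′} {i″} a b refl c d refl e f refl ne = ⊥-elim (ne (additive J K L sub i i′ i″ a b c d e f))

    cases : Info true false → Info false true → Info true true → Conclusion
    cases (absent p) (absent q) (absent r) = is-empty (p false) (q false) (r false)
    cases (absent p) (absent q) (present _ true _ _ _ r) = is-J (p true) (q false) r
    cases (absent p) (absent q) (present _ false _ _ _ r) = is-empty (p false) (q false) r
    cases (absent p) (present _ true _ _ _ q) (absent r) = is-K (p false) q (r true)
    cases (absent p) (present _ false _ _ _ q) (absent r) = is-empty (p false) q (r false)
    cases (absent p) (present _ true _ _ _ q) (present _ true _ _ _ r) = is-K (p false) q r
    cases (absent p) (present _ true _ _ _ q) (present _ false _ _ _ r) = is-K∖J p q r
    cases (absent p) (present _ false _ _ _ q) (present _ true _ _ _ r) = is-J (p true) q r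
    cases (absent p) (present _ false _ _ _ q) (present _ false _ _ _ r) = is-empty (p false) q r
    cases (present _ true _ _ _ p) (absent q) (absent r) = is-J p (q false) (r true)
    cases (present _ false _ _ _ p) (absent q) (absent r) = is-empty p (q false) (r false)
    cases (present _ true _ _ _ p) (absent q) (present _ true _ _ _ r) = is-J p (q false) r
    cases (present _ true _ _ _ p) (absent q) (present _ false _ _ _ r) = is-J∖K p q r
    cases (present _ false _ _ _ p) (absent q) (present _ true _ _ _ r) = is-K p (q true) r
    cases (present _ false _ _ _ p) (absent q) (present _ false _ _ _ r) = is-empty p (q false) r
    cases (present _ true _ _ _ p) (present _ true _ _ _ q) (absent r) = is-union p q r
    cases (present _ true _ _ _ p) (present _ false _ _ _ q) (absent r) = is-J p q (r true)
    cases (present _ false _ _ _ p) (present _ true _ _ _ q) (absent r) = is-K p q (r true)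
    cases (present _ false _ _ _ p) (present _ false _ _ _ q) (absent r) = is-empty p q (r false)
    cases (present _ true _ _ _ p) (present _ false _ _ _ q) (present _ true _ _ _ r) = is-J p q r
    cases (present _ false _ _ _ p) (present _ true _ _ _ q) (present _ true _ _ _ r) = is-K p q r
    cases (present _ false _ _ _ p) (present _ false _ _ _ q) (present _ false _ _ _ r) = is-empty p q r
    cases (present _ true a b c _) (present _ true d e f _) (present _ true g h m _) = contradiction a b c d
      e f g h m λ ()
    cases (present _ true a b c _) (present _ true d e f _) (present _ false g h m _) = contradiction a b c
      d e f g h m λ ()
    cases (present _ true a b c _) (present _ false d e f _) (present _ false g h m _) = contradiction a b c
      d e f g h m λ ()
    cases (present _ false a b c _) (present _ true d e f _) (present _ false g h m _) = contradiction a b c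
      d e f g h m λ ()
    cases (present _ false a b c _) (present _ false d e f _) (present _ true g h m _) = contradiction a b c
      d e f g h m λ ()

  dependent : L ≡ J ⊎ L ≡ K ⊎ Third J K L
  dependent = cases (info true false) (info false true) (info true true)

sumOver-Sum : ∀ {J K L : Subset n} → Sum J K L → ∀ x → sumOver L x ≡ sumOver J x + sumOver K x
sumOver-Sum {J = []} {[]} {[]} _ [] = sym (+-identityˡ 0ℚ)
sumOver-Sum {J = a ∷ J} {b ∷ K} {c ∷ L} (disj , mem) (x ∷ xs) = go a b c
  (λ p q → disj zero (lookup⇒[]= zero (a ∷ J) p) (lookup⇒[]= zero (b ∷ K) q))
  (λ r → Sum.map []=⇒lookup []=⇒lookup (to (mem zero) (lookup⇒[]= zero (c ∷ L) r)))
  (λ s → []=⇒lookup (from (mem zero) (Sum.map (lookup⇒[]= zero (a ∷ J)) (lookup⇒[]= zero (b ∷ K)) s)))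
  (sumOver-Sum ((λ i p q → disj (suc i) (Vec.there p) (Vec.there q)) ,
    λ i → mk⇔ (λ r → Sum.map drop drop (to (mem (suc i)) (Vec.there r)))
      (λ s → drop (from (mem (suc i)) (Sum.map Vec.there Vec.there s)))) xs)
  where
  drop : ∀ {n} {b : Bool} {P : Subset n} {i} → (b ∷ P) Vec.[ suc i ]= true → P Vec.[ i ]= true
  drop (Vec.there p) = p
  go : ∀ a b c → (a ≡ true → ¬ b ≡ true) → (c ≡ true → a ≡ true ⊎ b ≡ true) → (a ≡ true ⊎ b ≡ true → c ≡ true) →
       sumOver L xs ≡ sumOver J xs + sumOver K xs → sumOver (c ∷ L) (x ∷ xs) ≡ sumOver (a ∷ J) (x ∷ xs) +
         sumOver (b ∷ K) (x ∷ xs)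
  go true true _ d _ _ _ = ⊥-elim (d refl refl)
  go false false false _ _ _ ih = ih
  go false false true _ f _ _ with f refl
  ... | inj₁ ()
  ... | inj₂ ()
  go true false false _ _ f _ with f (inj₁ refl)
  ... | ()
  go false true false _ _ f _ with f (inj₂ refl)
  ... | ()
  go true false true _ _ _ ih = trans (cong (x +_) ih) (solve 3 (λ a b c → a :+ (b :+ c) := (a :+ b) :+ c)
    refl x (sumOver J xs) (sumOver K xs))
  go false true true _ _ _ ih = trans (cong (x +_) ih) (solve 3 (λ a b c → a :+ (b :+ c) := b :+ (a :+ c))
    refl x (sumOver J xs) (sumOver K xs))

Connected : SimpleGraph n → Subset n → Set
Connected G I = Nonempty I × InducedConnected G I

connected? : ∀ (G : SimpleGraph n) I → Dec (Connected G I)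
connected? G I = nonempty? I ×-dec inducedConnected? G I

∈-subsets : ∀ (I : Subset n) → I ∈ₚ subsets n
∈-subsets [] = here refl
∈-subsets (true ∷ I) = ∈-cartesianProductWith⁺ _∷_ {xs = inside ∷ outside ∷ []} (here refl) (∈-subsets I)
∈-subsets (false ∷ I) = ∈-cartesianProductWith⁺ _∷_ {xs = inside ∷ outside ∷ []} (there (here refl)) (∈-subsets I)

module _ (G : SimpleGraph n) where
  connected⇒∈ : ∀ {I} → Connected G I → hyperplane I ∈ connectedSubgraphArrangement G
  connected⇒∈ {I} c = Any.map (λ { refl → ≐-refl }) (∈-map⁺ hyperplane (∈-filter⁺ (connected? G) (∈-subsets I) c))

  ∈⇒connected : ∀ {H} → H ∈ connectedSubgraphArrangement G → ∃ λ I → Connected G I × H ≐ hyperplane I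
  ∈⇒connected {H} H∈ = go (filter (connected? G) (subsets n))
    (λ I∈ → proj₂ (∈-filter⁻ (connected? G) {xs = subsets n} I∈)) H∈
    where
    go : ∀ Is → (∀ {I} → I ∈ₚ Is → Connected G I) → H ∈ map hyperplane Is → ∃ λ I → Connected G I × H ≐ hyperplane I
    go (I ∷ Is) c (here e) = I , c (here refl) , e
    go (I ∷ Is) c (there p) = go Is (λ I∈ → c (there I∈)) p

-- Colourings

-- What a nice partition says about rank two: the localisation at H_J ∩ H_K meets at most two
-- blocks, and one of them in a single hyperplane.
record Colouring (G : SimpleGraph n) : Set where
  field
    colour : Subset n → ℕ
    same   : ∀ {J K} → Connected G J → Connected G K → J ≢ K → colour J ≡ colour K →
             ∃ λ L → Connected G L × Third J K L × colour L ≢ colour J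
    triple : ∀ {J K L} → Connected G J → Connected G K → Connected G L → Sum J K L →
             colour J ≡ colour K ⊎ colour J ≡ colour L ⊎ colour K ≡ colour L

⋂ᶜ-dim : ∀ {V : Subspace n} {A π} → IsArrangement V A → IsPartition A π → ∀ f → IsChoice π f → HasDim V d → ∀ i →
         ∃ λ e → HasDim (λ x → V x × (∀ j → j ≢ i → f j x)) e × suc d ℕ.≤ length π ℕ.+ e
⋂ᶜ-dim {d = d} {V = V} {A} {π@(B ∷ π′)} arr part f f∈ V-dim i =
  let (e , X-dim , le) = ⋂-dim V-dim (All.tabulate⁺ {f = λ k → f (punchIn i k)} λ k → member-hyperplane arr (block⊆ part (punchIn i k) (f∈ (punchIn i k))))
  in e , hasDim-resp ((λ x∈ → ⋂⊆ Ks x∈ , λ j j≢i → subst (λ j → f j _) (Fin.punchIn-punchOut (j≢i ∘ sym))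
    (All.tabulate⁻ {f = λ k → f (punchIn i k)} (⋂-All x∈) (punchOut (j≢i ∘ sym)))) ,
                      (λ { (v , k) → All-⋂ v (All.tabulate⁺ {f = λ k → f (punchIn i k)} λ j → k
                        (punchIn i j) (Fin.punchInᵢ≢i i j)) })) X-dim ,
     ℕ.s≤s (subst (λ m → d ℕ.≤ m ℕ.+ e) (List.length-tabulate (λ k → f (punchIn i k))) le)
  where
  Ks = tabulate (λ k → f (punchIn i k))

module _ {n} {G : SimpleGraph n} {π : List (List (Subspace n))} (arr : IsArrangement U (connectedSubgraphArrangement G))
  (part : IsPartition (connectedSubgraphArrangement G) π) (nice : IsNice U (connectedSubgraphArrangement G) π) where
  private
    A = connectedSubgraphArrangement G

    index : ∀ {I} → Connected G I → ∃ λ i → hyperplane I ∈ lookup π i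
    index c = block-of part (connected⇒∈ G c)

    colourOf : ∀ {I} → Dec (Connected G I) → ℕ
    colourOf (yes c) = toℕ (proj₁ (index c))
    colourOf (no _) = 0

    colour : Subset n → ℕ
    colour I = colourOf (connected? G I)

    colour-index : ∀ {I} (c : Connected G I) → colour I ≡ toℕ (proj₁ (index c))
    colour-index {I} c with connected? G I
    ... | no ¬c = ⊥-elim (¬c c)
    ... | yes c′ = cong toℕ (block-unique part _ _ (proj₂ (index c′)) (proj₂ (index c)))

    in-block : ∀ {I J} (c : Connected G I) (c′ : Connected G J) → colour I ≡ colour J → hyperplane J ∈
      lookup π (proj₁ (index c))
    in-block c c′ e = subst (λ i → _ ∈ lookup π i) (Fin.toℕ-injective
      (trans (sym (colour-index c′)) (trans (sym e) (colour-index c)))) (proj₂ (index c′))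

  factored-same : ∀ {J K} → Connected G J → Connected G K → J ≢ K → colour J ≡ colour K →
         ∃ λ L → Connected G L × Third J K L × colour L ≢ colour J
  factored-same {J} {K} cJ cK J≢K eq = separate (at-Any
    (IsNice.singleton nice X (hyperplane J ∷ hyperplane K ∷ [] , sub , (λ { (p , q) → p , q , _ }) ,
    (λ { (p , q , _) → p , q })) λ X≐U → proj₂ (hyperplane-≢U (proj₁ cJ)) (proj₁ (proj₂ X≐U _))))
    where
    X = hyperplane J ∩ hyperplane K
    sub : (hyperplane J ∷ hyperplane K ∷ []) ⊆ₗ A
    sub (here e) = ∈-resp (≐-sym e) (connected⇒∈ G cJ)
    sub (there (here e)) = ∈-resp (≐-sym e) (connected⇒∈ G cK)
    separate : (∃ λ i → IsSingletonAt X (lookup π i)) → ∃ λ L → Connected G L × Third J K L × colour L ≢ colour J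
    separate (i , H , (H∈ , X⊆H) , unique) = found (∈⇒connected G (block⊆ part i H∈))
      where
      found : (∃ λ L → Connected G L × H ≐ hyperplane L) → ∃ λ L → Connected G L × Third J K L × colour L ≢ colour J
      found (L , cL , H≐L) = L , cL , third (Dependent.dependent J K L (λ x → proj₁ H≐L (X⊆H x)) (proj₁ cL)) , L≢J
        where
        L∈ : hyperplane L ∈ lookup π i
        L∈ = ∈-resp H≐L H∈
        L≢J : colour L ≢ colour J
        L≢J e = J≢K (hyperplane-injective (proj₁ cJ) (proj₁ cK)
          (proj₁ (≐-trans (unique (hyperplane J) (at cJ (sym e)) proj₁)
          (≐-sym (unique (hyperplane K) (at cK (trans (sym eq) (sym e))) proj₂)))))
          where
          at : ∀ {I} (c : Connected G I) → colour I ≡ colour L → hyperplane I ∈ lookup π i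
          at {I} c e = subst (λ k → hyperplane I ∈ lookup π k) (block-unique part _ _ (proj₂ (index cL)) L∈)
            (in-block cL c (sym e))
        third : L ≡ J ⊎ L ≡ K ⊎ Third J K L → Third J K L
        third (inj₁ refl) = ⊥-elim (L≢J refl)
        third (inj₂ (inj₁ refl)) = ⊥-elim (L≢J (sym eq))
        third (inj₂ (inj₂ t)) = t

  factored-triple : ∀ {J K L} → Connected G J → Connected G K → Connected G L → Sum J K L →
           colour J ≡ colour K ⊎ colour J ≡ colour L ⊎ colour K ≡ colour L
  factored-triple {J} {K} {L} cJ cK cL sum = decide (i₁ Fin.≟ i₂) (i₁ Fin.≟ i₃) (i₂ Fin.≟ i₃)
    where
    i₁ = proj₁ (index cJ)
    i₂ = proj₁ (index cK)
    i₃ = proj₁ (index cL)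
    equal : ∀ {I I′} (c : Connected G I) (c′ : Connected G I′) → proj₁ (index c) ≡ proj₁ (index c′) → colour
      I ≡ colour I′
    equal c c′ e = trans (colour-index c) (trans (cong toℕ e) (sym (colour-index c′)))
    choice : ∀ j → Dec (j ≡ i₁) → Dec (j ≡ i₂) → Dec (j ≡ i₃) → ∃ λ H → H ∈ lookup π j
    choice j (yes refl) _ _ = hyperplane J , proj₂ (index cJ)
    choice j (no _) (yes refl) _ = hyperplane K , proj₂ (index cK)
    choice j (no _) (no _) (yes refl) = hyperplane L , proj₂ (index cL)
    choice j (no _) (no _) (no _) = All-at (IsPartition.nonempty part) j
    ch : ∀ j → ∃ λ H → H ∈ lookup π j
    ch j = choice j (j Fin.≟ i₁) (j Fin.≟ i₂) (j Fin.≟ i₃)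
    f : Choice π
    f j = proj₁ (ch j)
    at-J : ∀ p q r {x} → proj₁ (choice i₁ p q r) x → hyperplane J x
    at-J (yes refl) _ _ = id
    at-J (no ne) _ _ = ⊥-elim (ne refl)
    at-K : i₁ ≢ i₂ → ∀ p q r {x} → proj₁ (choice i₂ p q r) x → hyperplane K x
    at-K j≢k (yes e) _ _ = ⊥-elim (j≢k (sym e))
    at-K j≢k (no _) (yes refl) _ = id
    at-K j≢k (no _) (no ne) _ = ⊥-elim (ne refl)
    at-L : i₁ ≢ i₃ → i₂ ≢ i₃ → ∀ p q r {x} → hyperplane L x → proj₁ (choice i₃ p q r) x
    at-L j≢l k≢l (yes e) _ _ = ⊥-elim (j≢l (sym e))
    at-L j≢l k≢l (no _) (yes e) _ = ⊥-elim (k≢l (sym e))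
    at-L j≢l k≢l (no _) (no _) (yes refl) = id
    at-L j≢l k≢l (no _) (no _) (no ne) = ⊥-elim (ne refl)
    absurd : i₁ ≢ i₂ → i₁ ≢ i₃ → i₂ ≢ i₃ → ⊥
    absurd j≢k j≢l k≢l = bound (independentᶜ (IsNice.independent nice) f (λ j → proj₂ (ch j)))
      where
      Y⊆X : ∀ {x} → (U x × (∀ j → j ≢ i₃ → f j x)) → U x × (∀ j → f j x)
      Y⊆X {x} (u , k) = u , go
        where
        go : ∀ j → f j x
        go j = by (j Fin.≟ i₃)
          where
          sum-hyperplane : sumOver J x ≡ 0ℚ → sumOver K x ≡ 0ℚ → sumOver L x ≡ 0ℚ
          sum-hyperplane p q = trans (sumOver-Sum sum x) (trans (cong₂ _+_ p q) (+-identityˡ 0ℚ))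
          by : Dec (j ≡ i₃) → f j x
          by (no ne) = k j ne
          by (yes refl) = at-L j≢l k≢l (i₃ Fin.≟ i₁) (i₃ Fin.≟ i₂) (i₃ Fin.≟ i₃) (sum-hyperplane
            (at-J (i₁ Fin.≟ i₁) (i₁ Fin.≟ i₂) (i₁ Fin.≟ i₃) (k i₁ j≢l))
              (at-K j≢k (i₂ Fin.≟ i₁) (i₂ Fin.≟ i₂) (i₂ Fin.≟ i₃) (k i₂ k≢l)))
      bound : HasCodimIn U (⋂ᶜ U π f) (length π) → ⊥
      bound (_ , d , U-dim , X-dim) =
        let (d′ , Y-dim , le) = ⋂ᶜ-dim arr part f (λ j → proj₂ (ch j)) U-dim i₃
        in ℕ.1+n≰n (subst (λ k → suc (length π ℕ.+ d) ℕ.≤ length π ℕ.+ k)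
          (hasDim-unique Y-dim X-dim (Y⊆X , λ { (u , k) → u , λ j _ → k j })) le)

    decide : Dec (i₁ ≡ i₂) → Dec (i₁ ≡ i₃) → Dec (i₂ ≡ i₃) → colour J ≡ colour K ⊎ colour J ≡ colour L ⊎
      colour K ≡ colour L
    decide (yes e) _ _ = inj₁ (equal cJ cK e)
    decide (no _) (yes e) _ = inj₂ (inj₁ (equal cJ cL e))
    decide (no _) (no _) (yes e) = inj₂ (inj₂ (equal cK cL e))
    decide (no j≢k) (no j≢l) (no k≢l) = ⊥-elim (absurd j≢k j≢l k≢l)

  nice⇒colouring : Colouring G
  nice⇒colouring = record { colour = colour ; same = factored-same ; triple = factored-triple }

private
  T-true : ∀ {b} → T b → b ≡ true
  T-true {true} _ = refl
  true-T : ∀ {b} → b ≡ true → T b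
  true-T refl = _

fromDec : ∀ {P : Fin n → Set} → (∀ u → Dec (P u)) → Subset n
fromDec P? = Vec.tabulate λ u → isYes (P? u)

∈-fromDec : ∀ {P : Fin n → Set} (P? : ∀ u → Dec (P u)) u → u ∈ₛ fromDec P? ⇔ P u
∈-fromDec P? u = mk⇔
  (λ u∈ → toWitness {a? = P? u} (true-T (trans (sym (lookup∘tabulate (λ u → isYes (P? u)) u)) ([]=⇒lookup u∈))))
  (λ p → lookup⇒[]= u _ (trans (lookup∘tabulate (λ u → isYes (P? u)) u) (T-true (fromWitness {a? = P? u} p))))

-- Induced minors

record Model {m n} (M : SimpleGraph m) (G : SimpleGraph n) : Set where
  field
    part      : Fin m → List (Fin n)
    inhabited : ∀ a → ∃ λ u → u ∈ₚ part a
    linked    : ∀ a {u v} → u ∈ₚ part a → v ∈ₚ part a → Star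
      (λ x y → x ∈ₚ part a × y ∈ₚ part a × SimpleGraph.Adj G x y) u v
    disjoint  : ∀ {a b u} → u ∈ₚ part a → u ∈ₚ part b → a ≡ b
    edge      : ∀ {a b} → SimpleGraph.Adj M a b → ∃₂ λ u v → u ∈ₚ part a × v ∈ₚ part b × SimpleGraph.Adj G u v
    nonedge   : ∀ {a b u v} → a ≢ b → u ∈ₚ part a → v ∈ₚ part b → SimpleGraph.Adj G u v → SimpleGraph.Adj M a b

module Pullback {m n} {M : SimpleGraph m} {G : SimpleGraph n} (μ : Model M G) where
  open Model μ
  open DecMembership (Fin._≟_ {n}) using () renaming (_∈?_ to _∈ₚ?_)

  Covers : Subset m → Fin n → Set
  Covers S u = ∃ λ a → a ∈ₛ S × u ∈ₚ part a

  ⋃ : Subset m → Subset n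
  ⋃ S = fromDec λ u → Fin.any? λ a → a ∈ₛ? S ×-dec u ∈ₚ? part a

  ∈⋃ : ∀ S u → u ∈ₛ ⋃ S ⇔ Covers S u
  ∈⋃ S = ∈-fromDec λ u → Fin.any? λ a → a ∈ₛ? S ×-dec u ∈ₚ? part a

  ∈⋃⁺ : ∀ {S a u} → a ∈ₛ S → u ∈ₚ part a → u ∈ₛ ⋃ S
  ∈⋃⁺ a∈ u∈ = from (∈⋃ _ _) (_ , a∈ , u∈)

  ∈⋃-part : ∀ {S a u} → u ∈ₚ part a → u ∈ₛ ⋃ S → a ∈ₛ S
  ∈⋃-part {S} u∈ u∈⋃ with to (∈⋃ S _) u∈⋃
  ... | b , b∈ , u∈′ = subst (_∈ₛ S) (disjoint u∈′ u∈) b∈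

  ⋃-connected : ∀ {S} → Connected M S → Connected G (⋃ S)
  ⋃-connected {S} ((a , a∈) , conn) = (_ , ∈⋃⁺ a∈ (proj₂ (inhabited a))) , connect
    where
    walk : ∀ {a b u v} → Star (InducedAdj M S) a b → a ∈ₛ S → u ∈ₚ part a → v ∈ₚ part b → Star (InducedAdj G (⋃ S)) u v
    walk ε a∈ u∈ v∈ = Star.map (λ { (x∈ , y∈ , xy) → ∈⋃⁺ a∈ x∈ , ∈⋃⁺ a∈ y∈ , xy }) (linked _ u∈ v∈)
    walk ((_ , c∈ , ac) ◅ w) a∈ u∈ v∈ with edge ac
    ... | x , y , x∈ , y∈ , xy = walk ε a∈ u∈ x∈ ◅◅ (∈⋃⁺ a∈ x∈ , ∈⋃⁺ c∈ y∈ , xy) ◅ walk w c∈ y∈ v∈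
    connect : InducedConnected G (⋃ S)
    connect u u∈ v v∈ with to (∈⋃ S u) u∈ | to (∈⋃ S v) v∈
    ... | a , a∈ , u∈a | b , b∈ , v∈b = walk (conn a a∈ b b∈) a∈ u∈a v∈b

  ⋃-connected⁻ : ∀ {S} → Connected G (⋃ S) → Connected M S
  ⋃-connected⁻ {S} ((u , u∈) , conn) = (let (a , a∈ , _) = to (∈⋃ S u) u∈ in a , a∈) , connect
    where
    walk : ∀ {a b u v} → Star (InducedAdj G (⋃ S)) u v → a ∈ₛ S → u ∈ₚ part a → v ∈ₚ part b → Star (InducedAdj M S) a b
    walk ε a∈ u∈ v∈ with disjoint u∈ v∈
    ... | refl = ε
    walk {a} ((_ , y∈ , uy) ◅ w) a∈ u∈ v∈ with to (∈⋃ S _) y∈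
    ... | c , c∈ , y∈c with a Fin.≟ c
    ...   | yes refl = walk w a∈ y∈c v∈
    ...   | no a≢c = (a∈ , c∈ , nonedge a≢c u∈ y∈c uy) ◅ walk w c∈ y∈c v∈
    connect : InducedConnected M S
    connect a a∈ b b∈ = walk (conn _ (∈⋃⁺ a∈ (proj₂ (inhabited a))) _ (∈⋃⁺ b∈ (proj₂ (inhabited b)))) a∈
      (proj₂ (inhabited a)) (proj₂ (inhabited b))

  ⋃-⊆ : ∀ {S S′} → (∀ u → u ∈ₛ ⋃ S → u ∈ₛ ⋃ S′) → ∀ a → a ∈ₛ S → a ∈ₛ S′
  ⋃-⊆ sub a a∈ = ∈⋃-part (proj₂ (inhabited a)) (sub _ (∈⋃⁺ a∈ (proj₂ (inhabited a))))

  ⋃-injective : ∀ {S S′} → ⋃ S ≡ ⋃ S′ → S ≡ S′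
  ⋃-injective e = subset-ext (⋃-⊆ λ u → subst (u ∈ₛ_) e) (⋃-⊆ λ u → subst (u ∈ₛ_) (sym e))

  ⋃-Sum : ∀ {S S′ R} → Sum S S′ R → Sum (⋃ S) (⋃ S′) (⋃ R)
  ⋃-Sum {S} {S′} {R} (disj , mem) =
    (λ u u∈ u∈′ → let (a , a∈ , u∈a) = to (∈⋃ S u) u∈ in disj a a∈ (∈⋃-part u∈a u∈′)) ,
    λ u → mk⇔
      (λ u∈ → let (a , a∈ , u∈a) = to (∈⋃ R u) u∈ in Sum.map (λ p → ∈⋃⁺ p u∈a) (λ p → ∈⋃⁺ p u∈a) (to (mem a) a∈))
      (λ { (inj₁ u∈) → let (a , a∈ , u∈a) = to (∈⋃ S u) u∈ in ∈⋃⁺ (from (mem a) (inj₁ a∈)) u∈a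
         ; (inj₂ u∈) → let (a , a∈ , u∈a) = to (∈⋃ S′ u) u∈ in ∈⋃⁺ (from (mem a) (inj₂ a∈)) u∈a })

  union⁻ : ∀ {S S′ L} → Sum (⋃ S) (⋃ S′) L → ∃ λ R → L ≡ ⋃ R × Sum S S′ R
  union⁻ {S} {S′} {L} (disj , mem) = S ∪ S′ , subset-ext L⊆ ⊆L ,
    (λ a a∈ a∈′ → disj _ (∈⋃⁺ a∈ (proj₂ (inhabited a))) (∈⋃⁺ a∈′ (proj₂ (inhabited a)))) , λ a → mk⇔
      (x∈p∪q⁻ S S′) x∈p∪q⁺
    where
    L⊆ : ∀ u → u ∈ₛ L → u ∈ₛ ⋃ (S ∪ S′)
    L⊆ u u∈ with to (mem u) u∈
    ... | inj₁ p = let (a , a∈ , u∈a) = to (∈⋃ S u) p in ∈⋃⁺ (x∈p∪q⁺ (inj₁ a∈)) u∈a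
    ... | inj₂ p = let (a , a∈ , u∈a) = to (∈⋃ S′ u) p in ∈⋃⁺ (x∈p∪q⁺ (inj₂ a∈)) u∈a
    ⊆L : ∀ u → u ∈ₛ ⋃ (S ∪ S′) → u ∈ₛ L
    ⊆L u u∈ = let (a , a∈ , u∈a) = to (∈⋃ (S ∪ S′) u) u∈ in from (mem u) (Sum.map (λ p → ∈⋃⁺ p u∈a) (λ p → ∈⋃⁺ p u∈a) (x∈p∪q⁻ S S′ a∈))

  difference⁻ : ∀ {S S′ L} → Sum (⋃ S) L (⋃ S′) → ∃ λ R → L ≡ ⋃ R × Sum S R S′
  difference⁻ {S} {S′} {L} (disj , mem) = S′ ∩ₛ ∁ S , subset-ext L⊆ ⊆L ,
    (λ a a∈ a∈′ → x∈∁p⇒x∉p (proj₂ (x∈p∩q⁻ S′ (∁ S) a∈′)) a∈) , λ a → mk⇔ (split a) join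
    where
    L⊆ : ∀ u → u ∈ₛ L → u ∈ₛ ⋃ (S′ ∩ₛ ∁ S)
    L⊆ u u∈ = let (a , a∈ , u∈a) = to (∈⋃ S′ u) (from (mem u) (inj₂ u∈)) in
      ∈⋃⁺ (x∈p∩q⁺ (a∈ , x∉p⇒x∈∁p λ a∈S → disj u (∈⋃⁺ a∈S u∈a) u∈)) u∈a
    ⊆L : ∀ u → u ∈ₛ ⋃ (S′ ∩ₛ ∁ S) → u ∈ₛ L
    ⊆L u u∈ with to (∈⋃ (S′ ∩ₛ ∁ S) u) u∈
    ... | a , a∈ , u∈a with to (mem u) (∈⋃⁺ (proj₁ (x∈p∩q⁻ S′ (∁ S) a∈)) u∈a)
    ...   | inj₁ u∈S = ⊥-elim (x∈∁p⇒x∉p (proj₂ (x∈p∩q⁻ S′ (∁ S) a∈)) (∈⋃-part u∈a u∈S))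
    ...   | inj₂ u∈L = u∈L
    split : ∀ a → a ∈ₛ S′ → a ∈ₛ S ⊎ a ∈ₛ S′ ∩ₛ ∁ S
    split a a∈ with a ∈ₛ? S
    ... | yes p = inj₁ p
    ... | no np = inj₂ (x∈p∩q⁺ (a∈ , x∉p⇒x∈∁p np))
    join : ∀ {a} → a ∈ₛ S ⊎ a ∈ₛ S′ ∩ₛ ∁ S → a ∈ₛ S′
    join {a} (inj₁ p) = ∈⋃-part (proj₂ (inhabited a)) (from (mem _) (inj₁ (∈⋃⁺ p (proj₂ (inhabited a)))))
    join (inj₂ p) = proj₁ (x∈p∩q⁻ S′ (∁ S) p)

  third⁻ : ∀ {S S′ L} → Third (⋃ S) (⋃ S′) L → ∃ λ R → L ≡ ⋃ R × Third S S′ R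
  third⁻ (inj₁ s) = let (R , p , q) = union⁻ s in R , p , inj₁ q
  third⁻ (inj₂ (inj₁ s)) = let (R , p , q) = difference⁻ s in R , p , inj₂ (inj₁ q)
  third⁻ (inj₂ (inj₂ s)) = let (R , p , q) = difference⁻ s in R , p , inj₂ (inj₂ q)

  pullback : Colouring G → Colouring M
  pullback χ = record
    { colour = λ S → colour (⋃ S)
    ; same = λ cS cS′ ne e → go (same (⋃-connected cS) (⋃-connected cS′) (ne ∘ ⋃-injective) e)
    ; triple = λ cS cS′ cR s → triple (⋃-connected cS) (⋃-connected cS′) (⋃-connected cR) (⋃-Sum s) }
    where
    open Colouring χ
    go : ∀ {S S′} → (∃ λ L → Connected G L × Third (⋃ S) (⋃ S′) L × colour L ≢ colour (⋃ S)) →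
         ∃ λ R → Connected M R × Third S S′ R × colour (⋃ R) ≢ colour (⋃ S)
    go (L , cL , t , ne) with third⁻ t
    ... | R , refl , t′ = R , ⋃-connected⁻ cL , t′ , ne

_⇔-dec_ : ∀ {A B : Set} → Dec A → Dec B → Dec (A ⇔ B)
a? ⇔-dec b? = map′ (λ { (f , g) → mk⇔ f g }) (λ e → to e , from e) ((a? →-dec b?) ×-dec (b? →-dec a?))

-- Evaluates the cheap conclusion before the expensive premise.
_→-dec′_ : ∀ {A B : Set} → Dec A → Dec B → Dec (A → B)
a? →-dec′ yes b = yes λ _ → b
a? →-dec′ no ¬b = map′ (λ ¬a a → ⊥-elim (¬a a)) (λ f a → ¬b (f a)) (¬? a?)

sum? : ∀ (J K L : Subset n) → Dec (Sum J K L)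
sum? J K L = Fin.all? (λ i → i ∈ₛ? J →-dec ¬? (i ∈ₛ? K)) ×-dec Fin.all? (λ i → (i ∈ₛ? L) ⇔-dec (i ∈ₛ? J ⊎-dec i ∈ₛ? K))

third? : ∀ (J K L : Subset n) → Dec (Third J K L)
third? J K L = sum? J K L ⊎-dec sum? J L K ⊎-dec sum? K L J

_≟ₛ_ : (S R : Subset n) → Dec (S ≡ R)
_≟ₛ_ = Vec.≡-dec Bool._≟_

-- Exhaustive search for a colouring, up to renaming of the colours

module Exhaust {m} (M : SimpleGraph m) (connecteds : List (Subset m)) (complete : ∀ {S} → Connected M S → S ∈ₚ connecteds) where

  Assignment : Set
  Assignment = List (Subset m × ℕ)

  PairOK : Subset m × ℕ → Subset m × ℕ → Set
  PairOK (S , c) (R , c′) = c ≡ c′ → S ≢ R → Any (Third S R) connecteds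

  TripleOK : Subset m × ℕ → Subset m × ℕ → Subset m × ℕ → Set
  TripleOK (S , c) (R , c′) (L , c″) = Sum S R L → (c ≡ c′ × c ≢ c″) ⊎ (c ≢ c′ × (c ≡ c″ ⊎ c′ ≡ c″))

  Consistent : Subset m × ℕ → Assignment → Set
  Consistent p ps = All (λ q → All (λ r → TripleOK p q r × TripleOK q r p) ps) ps × All (PairOK p) ps

  consistent? : ∀ p ps → Dec (Consistent p ps)
  consistent? p ps = All.all? (λ q → All.all? (λ r → tripleOK? p q r ×-dec tripleOK? q r p) ps) ps ×-dec
    All.all? (pairOK? p) ps
    where
    tripleOK? : ∀ p q r → Dec (TripleOK p q r)
    tripleOK? (S , c) (R , c′) (L , c″) = sum? S R L →-dec′
      (((c ℕ.≟ c′) ×-dec ¬? (c ℕ.≟ c″)) ⊎-dec (¬? (c ℕ.≟ c′) ×-dec ((c ℕ.≟ c″) ⊎-dec (c′ ℕ.≟ c″))))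
    pairOK? : ∀ q r → Dec (PairOK q r)
    pairOK? (S , c) (R , c′) = (c ℕ.≟ c′) →-dec (¬? (S ≟ₛ R) →-dec Any.any? (third? S R) connecteds)

  tryUpTo : ℕ → (ℕ → Bool) → Bool
  tryUpTo zero    f = f zero
  tryUpTo (suc k) f = f (suc k) ∨ tryUpTo k f

  tryUpTo-true : ∀ {k f c} → c ≤ k → f c ≡ true → tryUpTo k f ≡ true
  tryUpTo-true {zero} z≤n e = e
  tryUpTo-true {suc k} {f} {c} c≤ e with c ℕ.≟ suc k
  ... | yes refl = cong (_∨ tryUpTo k f) e
  ... | no c≢ = trans (cong (f (suc k) ∨_) (tryUpTo-true {k} {f} (ℕ.≤-pred (ℕ.≤∧≢⇒< c≤ c≢)) e))
    (Bool.∨-zeroʳ (f (suc k)))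

  search : List (Subset m) → ℕ → Assignment → Bool
  search []       k ps = true
  search (S ∷ Ss) k ps = tryUpTo k λ c → does (consistent? (S , c) ps) ∧ search Ss (k ℕ.⊔ suc c) ((S , c) ∷ ps)

  module _ (χ : Colouring M) where
    open Colouring χ

    record Faithful (ps : Assignment) (k : ℕ) : Set where
      field
        connected : All (λ p → Connected M (proj₁ p)) ps
        bounded   : All (λ p → proj₂ p < k) ps
        faithful  : All (λ p → All (λ q → proj₂ p ≡ proj₂ q ⇔ colour (proj₁ p) ≡ colour (proj₁ q)) ps) ps
    open Faithful

    choose : ∀ {ps k} → Faithful ps k → ∀ S → ∃ λ c → c ≤ k × All (λ p → c ≡ proj₂ p ⇔ colour S ≡ colour (proj₁ p)) ps
    choose {ps} {k} F S with Any.any? (λ p → colour S ℕ.≟ colour (proj₁ p)) ps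
    ... | no none = k , ℕ.≤-refl , All.tabulate λ {p} p∈ → mk⇔
      (λ { refl → ⊥-elim (ℕ.<-irrefl refl (All.lookup (bounded F) p∈)) }) (λ e → ⊥-elim (none (lose p∈ e)))
    ... | yes any with find any
    ...   | p , p∈ , e = proj₂ p , ℕ.<⇒≤ (All.lookup (bounded F) p∈) ,
            All.map (λ eq → mk⇔ (λ x → trans e (to eq x)) (λ y → from eq (trans (sym e) y)))
              (All.lookup (faithful F) p∈)

    extend : ∀ {ps k S c} → Faithful ps k → Connected M S → All
      (λ p → c ≡ proj₂ p ⇔ colour S ≡ colour (proj₁ p)) ps → Faithful ((S , c) ∷ ps) (k ℕ.⊔ suc c)
    extend {ps} {k} {S} {c} F cS new = record
      { connected = cS ∷ connected F
      ; bounded = ℕ.m≤n⊔m k (suc c) ∷ All.map (λ b → ℕ.≤-trans b (ℕ.m≤m⊔n k (suc c))) (bounded F)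
      ; faithful = (mk⇔ (λ _ → refl) (λ _ → refl) ∷ new) ∷ All.zipWith
        (λ { (eq , row) → mk⇔ (λ x → sym (to eq (sym x))) (λ y → sym (from eq (sym y))) ∷ row }) (new , faithful F) }

    module _ {ps k} (F : Faithful ps k) where
      rel : ∀ {p q} → p ∈ₚ ps → q ∈ₚ ps → proj₂ p ≡ proj₂ q ⇔ colour (proj₁ p) ≡ colour (proj₁ q)
      rel p∈ q∈ = All.lookup (All.lookup (faithful F) p∈) q∈

      pairOK : ∀ {p q} → p ∈ₚ ps → q ∈ₚ ps → PairOK p q
      pairOK p∈ q∈ e ne with same (All.lookup (connected F) p∈) (All.lookup (connected F) q∈) ne (to (rel p∈ q∈) e)
      ... | L , cL , t , _ = lose (complete cL) t

      tripleOK : ∀ {p q r} → p ∈ₚ ps → q ∈ₚ ps → r ∈ₚ ps → TripleOK p q r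
      tripleOK {S , c} {R , c′} {L , c″} p∈ q∈ r∈ s with c ℕ.≟ c′
      ... | no c≢c′ = inj₂ (c≢c′ , Sum.[ (λ e → ⊥-elim (c≢c′ (from (rel p∈ q∈) e))) , Sum.map
        (from (rel p∈ r∈)) (from (rel q∈ r∈)) ]′
              (triple (All.lookup (connected F) p∈) (All.lookup (connected F) q∈) (All.lookup (connected F) r∈) s))
      ... | yes e = inj₁ (e , λ e′ → not-all (same cS cR S≢R (to (rel p∈ q∈) e)) (sym (to (rel p∈ r∈) e′)))
        where
        cS = All.lookup (connected F) p∈
        cR = All.lookup (connected F) q∈
        disjoint : ∀ {i} → i ∈ₛ S → i ∈ₛ R → ⊥
        disjoint = proj₁ s _
        S≢R : S ≢ R
        S≢R refl = disjoint (proj₂ (proj₁ cS)) (proj₂ (proj₁ cS))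
        not-all : (∃ λ L′ → Connected M L′ × Third S R L′ × colour L′ ≢ colour S) → colour L ≢ colour S
        not-all (L′ , _ , inj₁ s′ , ne) e = ne (trans (cong colour
          (subset-ext (λ u u∈ → from (proj₂ s u) (to (proj₂ s′ u) u∈))
          (λ u u∈ → from (proj₂ s′ u) (to (proj₂ s u) u∈)))) e)
        not-all (L′ , _ , inj₂ (inj₁ s′) , _) _ = disjoint (proj₂ (proj₁ cS))
          (from (proj₂ s′ _) (inj₁ (proj₂ (proj₁ cS))))
        not-all (L′ , _ , inj₂ (inj₂ s′) , _) _ = disjoint (from (proj₂ s′ _) (inj₁ (proj₂ (proj₁ cR))))
          (proj₂ (proj₁ cR))

    consistent : ∀ {p ps k} → Faithful (p ∷ ps) k → Consistent p ps
    consistent F = All.tabulate (λ q∈ → All.tabulate λ r∈ → tripleOK F (here refl) (there q∈) (there r∈) ,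
      tripleOK F (there q∈) (there r∈) (here refl)) ,
                   All.tabulate (λ q∈ → pairOK F (here refl) (there q∈))

    search-true : ∀ Ss {k ps} → All (Connected M) Ss → Faithful ps k → search Ss k ps ≡ true
    search-true [] _ _ = refl
    search-true (S ∷ Ss) {k} {ps} (cS ∷ cSs) F with choose F S
    ... | c , c≤k , new = tryUpTo-true {k} c≤k (cong₂ _∧_
      (dec-true (consistent? (S , c) ps) (consistent F′)) (search-true Ss cSs F′))
      where F′ = extend F cS new

matrixGraph : ∀ {m} (A : Vec (Vec Bool m) m) → (∀ i j → Vec.lookup (Vec.lookup A i) j ≡ Vec.lookup
  (Vec.lookup A j) i) → (∀ i → Vec.lookup (Vec.lookup A i) i ≡ false) → SimpleGraph m
matrixGraph A symm irr = record
  { Adj = λ i j → Vec.lookup (Vec.lookup A i) j ≡ true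
  ; adj? = λ i j → Vec.lookup (Vec.lookup A i) j Bool.≟ true
  ; symmetric = λ {i} {j} e → trans (symm j i) e
  ; irreflexive = λ { {i} refl e → Bool.not-¬ (irr i) e } }

pattern ◦ = false
pattern • = true

symmetric? : ∀ {m} (A : Vec (Vec Bool m) m) → Dec (∀ i j → Vec.lookup (Vec.lookup A i) j ≡ Vec.lookup
  (Vec.lookup A j) i)
symmetric? A = Fin.all? λ i → Fin.all? λ j → Vec.lookup (Vec.lookup A i) j Bool.≟ Vec.lookup (Vec.lookup A j) i

irreflexive? : ∀ {m} (A : Vec (Vec Bool m) m) → Dec (∀ i → Vec.lookup (Vec.lookup A i) i ≡ false)
irreflexive? A = Fin.all? λ i → Vec.lookup (Vec.lookup A i) i Bool.≟ false

claw : SimpleGraph 4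
claw = matrixGraph A (from-yes (symmetric? A)) (from-yes (irreflexive? A))
  where
  A = (◦ ∷ • ∷ • ∷ • ∷ []) ∷
      (• ∷ ◦ ∷ ◦ ∷ ◦ ∷ []) ∷
      (• ∷ ◦ ∷ ◦ ∷ ◦ ∷ []) ∷
      (• ∷ ◦ ∷ ◦ ∷ ◦ ∷ []) ∷ []

square : SimpleGraph 4
square = matrixGraph A (from-yes (symmetric? A)) (from-yes (irreflexive? A))
  where
  A = (◦ ∷ • ∷ ◦ ∷ • ∷ []) ∷
      (• ∷ ◦ ∷ • ∷ ◦ ∷ []) ∷
      (◦ ∷ • ∷ ◦ ∷ • ∷ []) ∷
      (• ∷ ◦ ∷ • ∷ ◦ ∷ []) ∷ []

diamond : SimpleGraph 4
diamond = matrixGraph A (from-yes (symmetric? A)) (from-yes (irreflexive? A))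
  where
  A = (◦ ∷ • ∷ • ∷ • ∷ []) ∷
      (• ∷ ◦ ∷ • ∷ • ∷ []) ∷
      (• ∷ • ∷ ◦ ∷ ◦ ∷ []) ∷
      (• ∷ • ∷ ◦ ∷ ◦ ∷ []) ∷ []

K₄ : SimpleGraph 4
K₄ = matrixGraph A (from-yes (symmetric? A)) (from-yes (irreflexive? A))
  where
  A = (◦ ∷ • ∷ • ∷ • ∷ []) ∷
      (• ∷ ◦ ∷ • ∷ • ∷ []) ∷
      (• ∷ • ∷ ◦ ∷ • ∷ []) ∷
      (• ∷ • ∷ • ∷ ◦ ∷ []) ∷ []

butterfly : SimpleGraph 5
butterfly = matrixGraph A (from-yes (symmetric? A)) (from-yes (irreflexive? A))
  where
  A = (◦ ∷ • ∷ • ∷ • ∷ • ∷ []) ∷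
      (• ∷ ◦ ∷ • ∷ ◦ ∷ ◦ ∷ []) ∷
      (• ∷ • ∷ ◦ ∷ ◦ ∷ ◦ ∷ []) ∷
      (• ∷ ◦ ∷ ◦ ∷ ◦ ∷ • ∷ []) ∷
      (• ∷ ◦ ∷ ◦ ∷ • ∷ ◦ ∷ []) ∷ []

module _ {m} (M : SimpleGraph m) where
  connecteds : List (Subset m)
  connecteds = filter (connected? M) (subsets m)

  ∈-connecteds : ∀ {S} → Connected M S → S ∈ₚ connecteds
  ∈-connecteds c = ∈-filter⁺ (connected? M) (∈-subsets _) c

  uncolourable : (Ss : List (Subset m)) → All (Connected M) Ss → Exhaust.search M connecteds ∈-connecteds Ss
    0 [] ≡ false → ¬ Colouring M
  uncolourable Ss cSs e χ with trans (sym e) (Exhaust.search-true M connecteds ∈-connecteds χ Ss cSs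
    (record { connected = [] ; bounded = [] ; faithful = [] }))
  ... | ()

-- The orders in which the sets are coloured were chosen to keep the search trees small.

¬colouring-claw : ¬ Colouring claw
¬colouring-claw = uncolourable claw order (from-yes (All.all? (connected? claw) order)) refl
  where
  order : List (Subset 4)
  order =
    (• ∷ • ∷ ◦ ∷ • ∷ []) ∷
    (• ∷ ◦ ∷ ◦ ∷ ◦ ∷ []) ∷
    (• ∷ • ∷ • ∷ • ∷ []) ∷
    (◦ ∷ ◦ ∷ • ∷ ◦ ∷ []) ∷
    (• ∷ ◦ ∷ • ∷ ◦ ∷ []) ∷
    (• ∷ • ∷ • ∷ ◦ ∷ []) ∷
    (◦ ∷ ◦ ∷ ◦ ∷ • ∷ []) ∷
    (• ∷ ◦ ∷ ◦ ∷ • ∷ []) ∷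
    (◦ ∷ • ∷ ◦ ∷ ◦ ∷ []) ∷
    (• ∷ • ∷ ◦ ∷ ◦ ∷ []) ∷
    (• ∷ ◦ ∷ • ∷ • ∷ []) ∷ []

¬colouring-square : ¬ Colouring square
¬colouring-square = uncolourable square order (from-yes (All.all? (connected? square) order)) refl
  where
  order : List (Subset 4)
  order =
    (• ∷ • ∷ ◦ ∷ • ∷ []) ∷
    (◦ ∷ • ∷ • ∷ ◦ ∷ []) ∷
    (• ∷ ◦ ∷ • ∷ • ∷ []) ∷
    (◦ ∷ ◦ ∷ • ∷ ◦ ∷ []) ∷
    (• ∷ • ∷ • ∷ • ∷ []) ∷
    (◦ ∷ • ∷ ◦ ∷ ◦ ∷ []) ∷
    (• ∷ ◦ ∷ ◦ ∷ • ∷ []) ∷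
    (◦ ∷ • ∷ • ∷ • ∷ []) ∷
    (◦ ∷ ◦ ∷ • ∷ • ∷ []) ∷
    (• ∷ • ∷ ◦ ∷ ◦ ∷ []) ∷
    (• ∷ • ∷ • ∷ ◦ ∷ []) ∷ []

¬colouring-diamond : ¬ Colouring diamond
¬colouring-diamond = uncolourable diamond order (from-yes (All.all? (connected? diamond) order)) refl
  where
  order : List (Subset 4)
  order =
    (• ∷ ◦ ∷ • ∷ ◦ ∷ []) ∷
    (• ∷ ◦ ∷ ◦ ∷ • ∷ []) ∷
    (◦ ∷ • ∷ • ∷ ◦ ∷ []) ∷
    (• ∷ • ∷ • ∷ • ∷ []) ∷
    (◦ ∷ • ∷ ◦ ∷ • ∷ []) ∷
    (◦ ∷ • ∷ • ∷ • ∷ []) ∷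
    (• ∷ • ∷ • ∷ ◦ ∷ []) ∷
    (◦ ∷ ◦ ∷ ◦ ∷ • ∷ []) ∷
    (• ∷ ◦ ∷ • ∷ • ∷ []) ∷
    (• ∷ ◦ ∷ ◦ ∷ ◦ ∷ []) ∷
    (• ∷ • ∷ ◦ ∷ • ∷ []) ∷ []

¬colouring-K₄ : ¬ Colouring K₄
¬colouring-K₄ = uncolourable K₄ order (from-yes (All.all? (connected? K₄) order)) refl
  where
  order : List (Subset 4)
  order =
    (• ∷ ◦ ∷ ◦ ∷ • ∷ []) ∷
    (• ∷ • ∷ • ∷ ◦ ∷ []) ∷
    (◦ ∷ • ∷ • ∷ • ∷ []) ∷
    (◦ ∷ • ∷ • ∷ ◦ ∷ []) ∷
    (• ∷ • ∷ • ∷ • ∷ []) ∷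
    (• ∷ ◦ ∷ ◦ ∷ ◦ ∷ []) ∷
    (◦ ∷ ◦ ∷ ◦ ∷ • ∷ []) ∷
    (◦ ∷ • ∷ ◦ ∷ • ∷ []) ∷
    (• ∷ ◦ ∷ • ∷ ◦ ∷ []) ∷
    (• ∷ ◦ ∷ • ∷ • ∷ []) ∷
    (• ∷ • ∷ ◦ ∷ • ∷ []) ∷ []

¬colouring-butterfly : ¬ Colouring butterfly
¬colouring-butterfly = uncolourable butterfly order (from-yes (All.all? (connected? butterfly) order)) refl
  where
  order : List (Subset 5)
  order =
    (• ∷ • ∷ • ∷ • ∷ • ∷ []) ∷
    (• ∷ ◦ ∷ ◦ ∷ ◦ ∷ • ∷ []) ∷
    (• ∷ ◦ ∷ ◦ ∷ • ∷ ◦ ∷ []) ∷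
    (◦ ∷ • ∷ • ∷ ◦ ∷ ◦ ∷ []) ∷
    (• ∷ • ∷ • ∷ ◦ ∷ • ∷ []) ∷
    (• ∷ • ∷ • ∷ • ∷ ◦ ∷ []) ∷
    (◦ ∷ ◦ ∷ ◦ ∷ ◦ ∷ • ∷ []) ∷
    (• ∷ ◦ ∷ ◦ ∷ ◦ ∷ ◦ ∷ []) ∷
    (◦ ∷ ◦ ∷ ◦ ∷ • ∷ ◦ ∷ []) ∷
    (• ∷ ◦ ∷ • ∷ • ∷ ◦ ∷ []) ∷
    (• ∷ • ∷ ◦ ∷ • ∷ ◦ ∷ []) ∷
    (◦ ∷ • ∷ ◦ ∷ ◦ ∷ ◦ ∷ []) ∷
    (• ∷ ◦ ∷ • ∷ ◦ ∷ • ∷ []) ∷ []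

module Graph {n} (G : SimpleGraph n) where
  open SimpleGraph G

  ~-sym : ∀ {u v} → Adj u v → Adj v u
  ~-sym = symmetric

  ~⇒≢ : ∀ {u v} → Adj u v → u ≢ v
  ~⇒≢ uv e = irreflexive e uv

  Far : Fin n → List (Fin n) → Set
  Far v = All λ x → v ≢ x × ¬ Adj v x

  Far-swap : ∀ {v x} → v ≢ x × ¬ Adj v x → x ≢ v × ¬ Adj x v
  Far-swap (ne , na) = ne ∘ sym , na ∘ ~-sym

  data Path : List (Fin n) → Set where
    point : ∀ {v} → Path (v ∷ [])
    cons  : ∀ {v w ws} → Adj v w → Far v ws → Path (w ∷ ws) → Path (v ∷ w ∷ ws)

  path-tail : ∀ {v w ws} → Path (v ∷ w ∷ ws) → Path (w ∷ ws)
  path-tail (cons _ _ p) = p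

  path-snoc : ∀ xs {y z} → Path (xs ∷ʳ y) → Adj y z → Far z xs → Path ((xs ∷ʳ y) ∷ʳ z)
  path-snoc [] point yz [] = cons yz [] point
  path-snoc (x ∷ []) (cons xy _ p) yz (fx ∷ []) = cons xy (Far-swap fx ∷ []) (path-snoc [] p yz [])
  path-snoc (x ∷ x′ ∷ xs) (cons xx′ fx p) yz (fz ∷ fzs) = cons xx′ (All.++⁺ fx (Far-swap fz ∷ []))
    (path-snoc (x′ ∷ xs) p yz fzs)

  path-++ʳ : ∀ xs {y ys} → Path (xs ++ y ∷ ys) → Path (y ∷ ys)
  path-++ʳ [] p = p
  path-++ʳ (x ∷ []) (cons _ _ p) = p
  path-++ʳ (x ∷ x′ ∷ xs) (cons _ _ p) = path-++ʳ (x′ ∷ xs) p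

  path-++ˡ : ∀ x xs {ys} → Path (x ∷ xs ++ ys) → Path (x ∷ xs)
  path-++ˡ x [] p = point
  path-++ˡ x (x′ ∷ xs) (cons a f p) = cons a (All.++⁻ˡ xs f) (path-++ˡ x′ xs p)

  path-cross : ∀ xs {v ys} → Path (xs ++ v ∷ ys) → All (λ x → Far x ys) xs
  path-cross [] p = []
  path-cross (x ∷ []) (cons _ f _) = f ∷ []
  path-cross (x ∷ x′ ∷ xs) (cons _ f p) = All.tail (All.++⁻ʳ xs f) ∷ path-cross (x′ ∷ xs) p

  path-join : ∀ xs {x v ys} → Path ((xs ∷ʳ x) ++ v ∷ ys) → Adj x v
  path-join [] (cons a _ _) = a
  path-join (y ∷ []) (cons _ _ p) = path-join [] p
  path-join (y ∷ y′ ∷ xs) (cons _ _ p) = path-join (y′ ∷ xs) p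

  path-unique : ∀ {xs} → Path xs → AllPairs _≢_ xs
  path-unique point = [] ∷ []
  path-unique (cons a f p) = (~⇒≢ a ∷ All.map proj₁ f) ∷ path-unique p

  path-reverse : ∀ {xs} → Path xs → Path (reverse xs)
  path-reverse point = point
  path-reverse {v ∷ w ∷ ws} (cons a f p) =
    subst Path (sym (trans (List.unfold-reverse v (w ∷ ws)) (cong (_∷ʳ v) (List.unfold-reverse w ws))))
      (path-snoc (reverse ws) (subst Path (List.unfold-reverse w ws) (path-reverse p)) (~-sym a)
        (All.tabulate λ x∈ → All.lookup f (Any.reverse⁻ x∈)))

  path-linked : ∀ {xs} → Path xs → ∀ {u v} → u ∈ₚ xs → v ∈ₚ xs → Star (λ x y → x ∈ₚ xs × y ∈ₚ xs × Adj x y) u v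
  path-linked point (here refl) (here refl) = ε
  path-linked (cons a f p) (here refl) (here refl) = ε
  path-linked (cons a f p) (here refl) (there v∈) = (here refl , there (here refl) , a) ◅ Star.map
    (λ { (x , y , e) → there x , there y , e }) (path-linked p (here refl) v∈)
  path-linked (cons a f p) (there u∈) (here refl) = Star.map (λ { (x , y , e) → there x , there y , e })
    (path-linked p u∈ (here refl)) ◅◅ (there (here refl) , here refl , ~-sym a) ◅ ε
  path-linked (cons a f p) (there u∈) (there v∈) = Star.map (λ { (x , y , e) → there x , there y , e })
    (path-linked p u∈ v∈)

  Related : Bool → List (Fin n) → List (Fin n) → Set
  Related true  xs ys = (∀ {u} → u ∈ₚ xs → u ∉ₚ ys) × ∃₂ λ u v → u ∈ₚ xs × v ∈ₚ ys × Adj u v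
  Related false xs ys = (∀ {u} → u ∈ₚ xs → u ∉ₚ ys) × (∀ {u v} → u ∈ₚ xs → v ∈ₚ ys → ¬ Adj u v)

  related-disjoint : ∀ b {xs ys} → Related b xs ys → ∀ {u} → u ∈ₚ xs → u ∉ₚ ys
  related-disjoint true  (d , _) = d
  related-disjoint false (d , _) = d

  related-sym : ∀ b {xs ys} → Related b xs ys → Related b ys xs
  related-sym true (d , u , v , u∈ , v∈ , uv) = (λ p q → d q p) , v , u , v∈ , u∈ , ~-sym uv
  related-sym false (d , na) = (λ p q → d q p) , λ u∈ v∈ uv → na v∈ u∈ (~-sym uv)

  Row : ∀ m → (Fin m → Set) → Set
  Row zero    P = ⊤
  Row (suc m) P = P zero × Row m (P ∘ suc)

  row-at : ∀ {m P} → Row m P → ∀ a → P a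
  row-at (p , ps) zero = p
  row-at (p , ps) (suc a) = row-at ps a

  Upper : ∀ m → (Fin m → Fin m → Bool) → (Fin m → List (Fin n)) → Set
  Upper zero    A part = ⊤
  Upper (suc m) A part = Row m (λ b → Related (A zero (suc b)) (part zero) (part (suc b))) × Upper m
    (λ a b → A (suc a) (suc b)) (part ∘ suc)

  upper-at : ∀ {m A part} → Upper m A part → (∀ a b → A a b ≡ A b a) → ∀ a b → a ≢ b → Related (A a b) (part a) (part b)
  upper-at (r , us) symm zero zero ne = ⊥-elim (ne refl)
  upper-at (r , us) symm zero (suc b) ne = row-at r b
  upper-at {A = A} {part} (r , us) symm (suc a) zero ne = subst (λ z → Related z (part (suc a)) (part zero))
    (symm zero (suc a)) (related-sym (A zero (suc a)) (row-at r a))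
  upper-at (r , us) symm (suc a) (suc b) ne = upper-at us (λ a b → symm (suc a) (suc b)) a b (ne ∘ cong suc)

  partsModel : ∀ {m} (M : SimpleGraph m) (parts : Vec (List (Fin n)) m) → Row m (λ a → Path (Vec.lookup parts a)) →
    Upper m (λ a b → does (SimpleGraph.adj? M a b)) (Vec.lookup parts) → Model M G
  partsModel {m} M parts paths upper = record
    { part = Vec.lookup parts
    ; inhabited = λ a → nonempty (row-at paths a)
    ; linked = λ a → path-linked (row-at paths a)
    ; disjoint = disj
    ; edge = λ {a} {b} → edge a b
    ; nonedge = λ {a} {b} → nonedge a b }
    where
    module M = SimpleGraph M
    nonempty : ∀ {xs} → Path xs → ∃ λ u → u ∈ₚ xs
    nonempty point = _ , here refl
    nonempty (cons _ _ _) = _ , here refl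
    does-sym : ∀ a b → does (M.adj? a b) ≡ does (M.adj? b a)
    does-sym a b with M.adj? a b | M.adj? b a
    ... | yes p | yes q = refl
    ... | no p | no q = refl
    ... | yes p | no q = ⊥-elim (q (M.symmetric p))
    ... | no p | yes q = ⊥-elim (p (M.symmetric q))
    rel : ∀ a b → a ≢ b → Related (does (M.adj? a b)) (Vec.lookup parts a) (Vec.lookup parts b)
    rel = upper-at upper does-sym
    disj : ∀ {a b u} → u ∈ₚ Vec.lookup parts a → u ∈ₚ Vec.lookup parts b → a ≡ b
    disj {a} {b} p q with a Fin.≟ b
    ... | yes e = e
    ... | no ne = ⊥-elim (related-disjoint (does (M.adj? a b)) (rel a b ne) p q)
    edge : ∀ a b → M.Adj a b → ∃₂ λ u v → u ∈ₚ Vec.lookup parts a × v ∈ₚ Vec.lookup parts b × Adj u v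
    edge a b ab with M.adj? a b | rel a b (λ e → M.irreflexive e ab)
    ... | yes _ | _ , r = r
    ... | no na | _ = ⊥-elim (na ab)
    nonedge : ∀ a b {u v} → a ≢ b → u ∈ₚ Vec.lookup parts a → v ∈ₚ Vec.lookup parts b → Adj u v → M.Adj a b
    nonedge a b ne u∈ v∈ uv with M.adj? a b | rel a b ne
    ... | yes ab | _ = ab
    ... | no _ | _ , na = ⊥-elim (na u∈ v∈ uv)

  touch : ∀ {xs ys} → All (λ x → All (x ≢_) ys) xs → Any (λ x → Any (Adj x) ys) xs → Related true xs ys
  touch ne any = (λ u∈ u∈′ → All.lookup (All.lookup ne u∈) u∈′ refl) ,
    let (x , x∈ , any′) = find any ; (y , y∈ , xy) = find any′ in x , y , x∈ , y∈ , xy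

  apart : ∀ {xs ys} → All (λ x → Far x ys) xs → Related false xs ys
  apart far = (λ u∈ u∈′ → proj₁ (All.lookup (All.lookup far u∈) u∈′) refl) , λ u∈ v∈ → proj₂
    (All.lookup (All.lookup far u∈) v∈)

  edge₁ : ∀ {u v} → Adj u v → Related true [ u ] [ v ]
  edge₁ uv = touch ((~⇒≢ uv ∷ []) ∷ []) (here (here uv))

  apart₁ : ∀ {u v} → u ≢ v × ¬ Adj u v → Related false [ u ] [ v ]
  apart₁ f = apart ((f ∷ []) ∷ [])

  module Excluded (no-claw : ¬ Model claw G) (no-square : ¬ Model square G) (no-diamond : ¬ Model diamond G) (no-K₄ : ¬ Model K₄ G) (no-butterfly : ¬ Model butterfly G) where

    ¬gap : ∀ {w p s seg u zs} → Path (p ∷ (s ∷ seg) ++ u ∷ zs) → All (w ≢_) (p ∷ (s ∷ seg) ++ u ∷ zs) → Adj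
      w p → Far w (s ∷ seg) → Adj w u → ⊥
    ¬gap {w} {p} {s} {seg} {u} {zs} P@(cons ps fp P′) w≢ wp fw wu = no-square
      (partsModel _ ([ w ] ∷ [ p ] ∷ (s ∷ seg) ∷ [ u ] ∷ [])
      (point , point , path-++ˡ s seg P′ , point , tt)
      ((edge₁ wp , apart (fw ∷ []) , edge₁ wu , tt) , (touch ((All.++⁻ˡ (s ∷ seg) p≢) ∷ [])
        (here (here ps)) , apart₁ (All.head (All.++⁻ʳ seg fp)) , tt) ,
       (touch (All.map (λ f → f ∷ []) (seg≢u (s ∷ seg) (path-unique P′))) (last-edge s seg P′) , tt) , tt , tt))
      where
      p≢ : All (p ≢_) ((s ∷ seg) ++ u ∷ zs)
      p≢ = AllPairs.head (path-unique P)
      seg≢u : ∀ xs → AllPairs _≢_ (xs ++ u ∷ zs) → All (_≢ u) xs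
      seg≢u [] _ = []
      seg≢u (x ∷ xs) (ne ∷ ps) = All.head (All.++⁻ʳ xs ne) ∷ seg≢u xs ps
      last-edge : ∀ s seg → Path ((s ∷ seg) ++ u ∷ zs) → Any (λ x → Any (Adj x) [ u ]) (s ∷ seg)
      last-edge s [] (cons a _ _) = here (here a)
      last-edge s (s′ ∷ seg) (cons _ _ p) = there (last-edge s′ seg p)

    data Attachment (w : Fin n) (P : List (Fin n)) : Set where
      none     : Far w P → Attachment w P
      first    : ∀ v vs → P ≡ v ∷ vs → Adj w v → Far w vs → Attachment w P
      last     : ∀ xs v → P ≡ xs ∷ʳ v → Adj w v → Far w xs → Attachment w P
      firstTwo : ∀ u v xs → P ≡ u ∷ v ∷ xs → Adj w u → Adj w v → Far w xs → Attachment w P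
      lastTwo  : ∀ xs u v → P ≡ (xs ∷ʳ u) ∷ʳ v → Adj w u → Adj w v → Far w xs → Attachment w P

    data FirstNeighbour (w : Fin n) : List (Fin n) → Set where
      none  : ∀ {xs} → Far w xs → FirstNeighbour w xs
      found : ∀ xs v ys → Far w xs → Adj w v → FirstNeighbour w (xs ++ v ∷ ys)

    firstNeighbour : ∀ w xs → All (w ≢_) xs → FirstNeighbour w xs
    firstNeighbour w [] [] = none []
    firstNeighbour w (x ∷ xs) (ne ∷ nes) with adj? w x
    ... | yes wx = found [] x xs [] wx
    ... | no ¬wx with firstNeighbour w xs nes
    ...   | none far = none ((ne , ¬wx) ∷ far)
    ...   | found ys v zs far wv = found (x ∷ ys) v zs ((ne , ¬wx) ∷ far) wv

    data SnocView : List (Fin n) → Set where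
      []   : SnocView []
      _∷ʳ′_ : ∀ xs x → SnocView (xs ∷ʳ x)

    snocView : ∀ xs → SnocView xs
    snocView [] = []
    snocView (x ∷ xs) with snocView xs
    ... | [] = [] ∷ʳ′ x
    ... | ys ∷ʳ′ y = (x ∷ ys) ∷ʳ′ y

    attach : ∀ w P → Path P → All (w ≢_) P → Attachment w P
    attach w P path w≢ with firstNeighbour w P w≢
    ... | none far = none far
    ... | found xs v ys far wv = after ys path w≢
      where
      after : ∀ ys → Path (xs ++ v ∷ ys) → All (w ≢_) (xs ++ v ∷ ys) → Attachment w (xs ++ v ∷ ys)
      after [] path w≢ = last xs v refl wv far
      after (y ∷ ys) path w≢ with adj? w y | firstNeighbour w ys (All.tail (All.tail (All.++⁻ʳ xs w≢)))
      ... | no ¬wy | found seg u zs far′ wu = ⊥-elim (¬gap {seg = seg} (path-++ʳ xs path) (All.++⁻ʳ xs w≢)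
        wv ((All.head (All.tail (All.++⁻ʳ xs w≢)) , ¬wy) ∷ far′) wu)
      ... | yes wy | found (s ∷ seg) u zs far′ wu = ⊥-elim
        (¬gap {seg = seg} (path-tail (path-++ʳ xs path)) (All.tail (All.++⁻ʳ xs w≢)) wy far′ wu)
      ... | yes wy | found [] u zs _ wu with path-++ʳ xs path
      ...   | cons vy (vu ∷ _) (cons yu _ _) = ⊥-elim (no-diamond
        (partsModel _ ([ w ] ∷ [ y ] ∷ [ v ] ∷ [ u ] ∷ []) (point , point , point , point , tt)
                ((edge₁ wy , edge₁ wv , edge₁ wu , tt) , (edge₁ (~-sym vy) , edge₁ yu , tt) ,
                  (apart₁ vu , tt) , tt , tt)))
      after (y ∷ ys) path w≢ | no ¬wy | none far′ with snocView xs
      ... | [] = first v (y ∷ ys) refl wv ((All.head (All.tail w≢) , ¬wy) ∷ far′)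
      ... | xs′ ∷ʳ′ x = ⊥-elim (no-claw (partsModel _ ([ v ] ∷ [ x ] ∷ [ y ] ∷ [ w ] ∷ [])
        (point , point , point , point , tt)
              ((edge₁ (~-sym (path-join xs′ path)) , edge₁ (join (path-++ʳ (xs′ ∷ʳ x) path)) , edge₁ (~-sym wv) , tt) ,
               (apart₁ (All.head (All.lookup (path-cross (xs′ ∷ʳ x) path) (∈-++⁺ʳ xs′ (here refl)))) ,
                 apart₁ (Far-swap (All.lookup far (∈-++⁺ʳ xs′ (here refl)))) , tt) ,
               (apart₁ (Far-swap (All.head (All.tail (All.++⁻ʳ (xs′ ∷ʳ x) w≢)) , ¬wy)) , tt) , tt , tt)))
        where
        join : Path (v ∷ y ∷ ys) → Adj v y
        join (cons a _ _) = a
      after (y ∷ ys) path w≢ | yes wy | none far′ with snocView xs | ys | path | far′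
      ... | [] | ys | path | far′ = firstTwo v y ys refl wv wy far′
      ... | xs′ ∷ʳ′ x | [] | path | far′ = lastTwo (xs′ ∷ʳ x) v y
        (sym (List.++-assoc (xs′ ∷ʳ x) (v ∷ []) (y ∷ []))) wv wy far
      ... | xs′ ∷ʳ′ x | y′ ∷ ys | path | fy′ ∷ _ = ⊥-elim
        (no-claw (partsModel _ ((v ∷ y ∷ []) ∷ [ x ] ∷ [ y′ ] ∷ [ w ] ∷ [])
        (path-++ˡ v (y ∷ []) Q , point , point , point , tt)
              ((touch ((~⇒≢ (~-sym xv) ∷ []) ∷ (proj₁ (Far-swap xy) ∷ []) ∷ []) (here (here (~-sym xv))) ,
                touch ((vy′≢ Q ∷ []) ∷ (~⇒≢ (yy′ Q) ∷ []) ∷ []) (there (here (here (yy′ Q)))) ,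
                touch ((~⇒≢ (~-sym wv) ∷ []) ∷ (~⇒≢ (~-sym wy) ∷ []) ∷ []) (here (here (~-sym wv))) , tt) ,
               (apart₁ xy′ , apart₁ (Far-swap (All.lookup far (∈-++⁺ʳ xs′ (here refl)))) , tt) ,
               (apart₁ (Far-swap fy′) , tt) , tt , tt)))
        where
        Q = path-++ʳ (xs′ ∷ʳ x) path
        xv = path-join xs′ path
        cross = All.lookup (path-cross (xs′ ∷ʳ x) path) (∈-++⁺ʳ xs′ (here refl))
        xy = All.head cross
        xy′ = All.head (All.tail cross)
        vy′≢ : Path (v ∷ y ∷ y′ ∷ ys) → v ≢ y′
        vy′≢ (cons _ f _) = proj₁ (All.head f)
        yy′ : Path (v ∷ y ∷ y′ ∷ ys) → Adj y y′
        yy′ (cons _ _ (cons a _ _)) = a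

    data Component : Set where
      path : ∀ P → Path P → Component
      kite : ∀ ts a b → Path (ts ∷ʳ a) → Path (ts ∷ʳ b) → Adj a b → Component

    vertices : Component → List (Fin n)
    vertices (path P _) = P
    vertices (kite ts a b _ _ _) = ts ++ a ∷ b ∷ []

    Closed : List (Fin n) → Set
    Closed xs = ∀ {w} → All (w ≢_) xs → ¬ Any (Adj w) xs

    Fresh : List (Fin n) → List (Fin n) → Set
    Fresh done xs = All (λ x → All (x ≢_) done) xs

    neighbour? : ∀ xs → (∃ λ w → All (w ≢_) xs × Any (Adj w) xs) ⊎ Closed xs
    neighbour? xs with Fin.any? (λ w → All.all? (λ x → ¬? (w Fin.≟ x)) xs ×-dec Any.any? (adj? w) xs)
    ... | yes r = inj₁ r
    ... | no nr = inj₂ λ ne any → nr (_ , ne , any)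

    unique-length : ∀ {xs : List (Fin n)} → AllPairs _≢_ xs → length xs ≤ n
    unique-length {xs} u = Fin.injective⇒≤ {f = lookup xs} λ {i} {j} → lookup-injective u i j
      where
      lookup-injective : ∀ {xs : List (Fin n)} → AllPairs _≢_ xs → ∀ i j → lookup xs i ≡ lookup xs j → i ≡ j
      lookup-injective (_ ∷ _) zero zero _ = refl
      lookup-injective (ne ∷ _) zero (suc j) e = ⊥-elim (All.lookup ne (∈-lookup j) e)
      lookup-injective (ne ∷ _) (suc i) zero e = ⊥-elim (All.lookup ne (∈-lookup i) (sym e))
      lookup-injective (_ ∷ u) (suc i) (suc j) e = cong suc (lookup-injective u i j e)

    far-nonadjacent : ∀ {w xs} → Far w xs → ¬ Any (Adj w) xs
    far-nonadjacent far any = let (x , x∈ , wx) = find any in proj₂ (All.lookup far x∈) wx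

    butterfly⊎diamond : ∀ {x y c u v w w′} → Path (x ∷ y ∷ (c ∷ʳ v)) → u ∈ₚ y ∷ c → Adj u v → Adj w u → Adj
      w v → w ≢ x × ¬ Adj w x → All (w ≢_) (y ∷ c) →
      Adj w′ x → Adj w′ y → Far w′ (c ∷ʳ v) → w′ ≢ w → ⊥
    butterfly⊎diamond {x} {y} {c} {u} {v} {w} {w′} (cons xy fx q) u∈ uv wu wv wx w≢ w′x w′y fw′ w′≢w = go (adj? w′ w)
      where
      centre : ∀ {z} → All (z ≢_) (y ∷ c) → Any (λ a → Any (Adj a) [ z ]) (y ∷ c) → Related true (y ∷ c) [ z ]
      centre ne any = touch (All.map (λ n → (n ∘ sym) ∷ []) ne) any
      snoc-≢ : ∀ xs → AllPairs _≢_ (xs ∷ʳ v) → ∀ {a} → a ∈ₚ xs → a ≢ v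
      snoc-≢ (x ∷ xs) (ne ∷ _) (here refl) = All.head (All.++⁻ʳ xs ne)
      snoc-≢ (x ∷ xs) (_ ∷ u) (there a∈) = snoc-≢ xs u a∈
      v-centre = centre (All.tabulate λ a∈ e → snoc-≢ (y ∷ c) (path-unique q) a∈ (sym e)) (lose u∈ (here uv))
      w-centre = centre w≢ (lose u∈ (here (~-sym wu)))
      w′-centre = centre (~⇒≢ w′y ∷ All.map proj₁ (All.++⁻ˡ c fw′)) (here (here (~-sym w′y)))
      go : Dec (Adj w′ w) → ⊥
      go (yes w′w) = no-diamond (partsModel _ ((y ∷ c) ∷ [ w ] ∷ [ v ] ∷ [ w′ ] ∷ [])
        (path-++ˡ y c q , point , point , point , tt)
        ((w-centre , v-centre , w′-centre , tt) , (edge₁ wv , edge₁ (~-sym w′w) , tt) ,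
          (apart₁ (Far-swap (All.head (All.++⁻ʳ c fw′))) , tt) , tt , tt))
      go (no ¬w′w) = no-butterfly (partsModel _ ((y ∷ c) ∷ [ x ] ∷ [ w′ ] ∷ [ v ] ∷ [ w ] ∷ [])
        (path-++ˡ y c q , point , point , point , point , tt)
        ((centre (~⇒≢ xy ∷ All.map proj₁ (All.++⁻ˡ c fx)) (here (here (~-sym xy))) , w′-centre , v-centre ,
          w-centre , tt) ,
         (edge₁ (~-sym w′x) , apart₁ (All.head (All.++⁻ʳ c fx)) , apart₁ (Far-swap wx) , tt) ,
         (apart₁ (All.head (All.++⁻ʳ c fw′)) , apart₁ (w′≢w , ¬w′w) , tt) , (edge₁ (~-sym wv) , tt) , tt , tt))

    snoc₂-injective : ∀ (xs ys : List (Fin n)) {u v x y} → (xs ∷ʳ u) ∷ʳ v ≡ (ys ∷ʳ x) ∷ʳ y → x ≡ u × y ≡ v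
    snoc₂-injective xs ys {u} {x = x} e =
      sym (List.∷ʳ-injectiveʳ xs ys (List.∷ʳ-injectiveˡ (xs ∷ʳ u) (ys ∷ʳ x) e)) ,
        sym (List.∷ʳ-injectiveʳ (xs ∷ʳ u) (ys ∷ʳ x) e)

    length-snoc : ∀ (xs : List (Fin n)) v → length (xs ∷ʳ v) ≡ suc (length xs)
    length-snoc xs v = trans (List.length-++ xs) (ℕ.+-comm (length xs) 1)

    module Grow (done : List (Fin n)) (done-closed : Closed done) where

      Result : Set
      Result = ∃ λ C → Closed (vertices C) × Fresh done (vertices C) × ∃ λ v → v ∈ₚ vertices C

      fresh-neighbour : ∀ {w P} → Fresh done P → Any (Adj w) P → All (w ≢_) done
      fresh-neighbour {w} fr any = All.tabulate λ d∈ → λ { refl → let (x , x∈ , wx) = find any in done-closed (All.lookup fr x∈) (lose d∈ (~-sym wx)) }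

      grow : ∀ k P → Path P → Fresh done P → n < length P ℕ.+ k → Result

      extendFirst : ∀ k {w v vs} → Path (v ∷ vs) → Fresh done (v ∷ vs) → Adj w v → Far w vs → n < length
        (v ∷ vs) ℕ.+ suc k → Result
      extendFirst k {w} {v} {vs} p fr wv far lt = grow k (w ∷ v ∷ vs) (cons wv far p)
        (fresh-neighbour fr (here wv) ∷ fr) (subst (n <_) (ℕ.+-suc (suc (length vs)) k) lt)

      extendLast : ∀ k {w v} xs → Path (xs ∷ʳ v) → Fresh done (xs ∷ʳ v) → Adj w v → Far w xs → n < length
        (xs ∷ʳ v) ℕ.+ suc k → Result
      extendLast k {w} {v} xs p fr wv far lt = grow k ((xs ∷ʳ v) ∷ʳ w) (path-snoc xs p (~-sym wv) far)
        (All.++⁺ fr (fresh-neighbour fr (Any.++⁺ʳ xs (here wv)) ∷ []))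
        (subst (n <_) (trans (ℕ.+-suc (length (xs ∷ʳ v)) k) (cong (ℕ._+ k) (sym (length-snoc (xs ∷ʳ v) w)))) lt)

      module GrowKite (k : ℕ) {w : Fin n} (xs : List (Fin n)) (u v : Fin n) (p : Path ((xs ∷ʳ u) ∷ʳ v)) (fr : Fresh done ((xs ∷ʳ u) ∷ʳ v)) (wu : Adj w u) (wv : Adj w v) (far : Far w xs)
        (lt : n < length ((xs ∷ʳ u) ∷ʳ v) ℕ.+ suc k) where

        pu : Path (xs ∷ʳ u)
        pu = prefix xs p
          where
          prefix : ∀ xs → Path ((xs ∷ʳ u) ∷ʳ v) → Path (xs ∷ʳ u)
          prefix [] _ = point
          prefix (x ∷ xs) q = path-++ˡ x (xs ∷ʳ u) q
        pw : Path ((xs ∷ʳ u) ∷ʳ w)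
        pw = path-snoc xs pu (~-sym wu) far
        uv : Adj u v
        uv = path-join xs p
        w≢done : All (w ≢_) done
        w≢done = fresh-neighbour fr (Any.++⁺ʳ (xs ∷ʳ u) (here wv))

        module _ {w′ : Fin n} (w′≢ : All (w′ ≢_) ((xs ∷ʳ u) ++ v ∷ w ∷ [])) (any : Any (Adj w′) ((xs ∷ʳ u) ++ v ∷ w ∷ [])) where
          w′≢P : All (w′ ≢_) ((xs ∷ʳ u) ∷ʳ v)
          w′≢P = All.++⁺ (All.++⁻ˡ (xs ∷ʳ u) w′≢) (All.head (All.++⁻ʳ (xs ∷ʳ u) w′≢) ∷ [])
          w′≢w : w′ ≢ w
          w′≢w = All.head (All.tail (All.++⁻ʳ (xs ∷ʳ u) w′≢))
          both : Adj w′ u → Adj w′ v → Dec (Adj w′ w) → ⊥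
          both w′u w′v (yes w′w) = no-K₄ (partsModel _ ([ u ] ∷ [ v ] ∷ [ w ] ∷ [ w′ ] ∷ [])
            (point , point , point , point , tt)
            ((edge₁ uv , edge₁ (~-sym wu) , edge₁ (~-sym w′u) , tt) ,
              (edge₁ (~-sym wv) , edge₁ (~-sym w′v) , tt) , (edge₁ (~-sym w′w) , tt) , tt , tt))
          both w′u w′v (no ¬w′w) = no-diamond (partsModel _ ([ u ] ∷ [ v ] ∷ [ w ] ∷ [ w′ ] ∷ [])
            (point , point , point , point , tt)
            ((edge₁ uv , edge₁ (~-sym wu) , edge₁ (~-sym w′u) , tt) ,
              (edge₁ (~-sym wv) , edge₁ (~-sym w′v) , tt) , (apart₁ (Far-swap (w′≢w , ¬w′w)) , tt) , tt , tt))
          opposite : ∀ xs {x y ys} → Path ((xs ∷ʳ u) ∷ʳ v) → Far w xs → Adj w′ x → Adj w′ y → Far w′ ys →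
            (xs ∷ʳ u) ∷ʳ v ≡ x ∷ y ∷ ys → ⊥
          opposite [] p fw w′x w′y far′ refl = both w′x w′y (adj? w′ w)
          opposite (x ∷ []) p (fwx ∷ _) w′x w′y far′ refl = butterfly⊎diamond p (here refl) uv wu wv fwx
            (~⇒≢ wu ∷ []) w′x w′y far′ w′≢w
          opposite (x ∷ y ∷ xs) p (fwx ∷ fwy ∷ fw) w′x w′y far′ refl = butterfly⊎diamond p
            (there (∈-++⁺ʳ xs (here refl))) uv wu wv fwx
            (proj₁ fwy ∷ All.++⁺ (All.map proj₁ fw) (~⇒≢ wu ∷ [])) w′x w′y far′ w′≢w
          w′w : Far w′ ((xs ∷ʳ u) ∷ʳ v) → Any (Adj w′) (xs ∷ʳ u) ⊎ Any (Adj w′) (v ∷ w ∷ []) → Adj w′ w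
          w′w far′ (inj₁ a) = ⊥-elim (far-nonadjacent (All.++⁻ˡ (xs ∷ʳ u) far′) a)
          w′w far′ (inj₂ (here a)) = ⊥-elim (proj₂ (All.head (All.++⁻ʳ (xs ∷ʳ u) far′)) a)
          w′w far′ (inj₂ (there (here a))) = a
          attached : Attachment w′ ((xs ∷ʳ u) ∷ʳ v) → Result
          attached (none far′) = extendLast k (xs ∷ʳ u) pw (All.++⁺ (All.++⁻ˡ (xs ∷ʳ u) fr) (w≢done ∷ []))
            (w′w far′ (Any.++⁻ (xs ∷ʳ u) any)) (All.++⁻ˡ (xs ∷ʳ u) far′)
            (subst (λ l → n < l ℕ.+ suc k) (trans (length-snoc (xs ∷ʳ u) v) (sym (length-snoc (xs ∷ʳ u) w))) lt)
          attached (first x ys e w′x far′) = extendFirst k (subst Path e p) (subst (Fresh done) e fr) w′x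
            far′ (subst (λ l → n < length l ℕ.+ suc k) e lt)
          attached (last ys x e w′x far′) = extendLast k ys (subst Path e p) (subst (Fresh done) e fr) w′x
            far′ (subst (λ l → n < length l ℕ.+ suc k) e lt)
          attached (lastTwo ys x y e w′x w′y _) = let (ex , ey) = snoc₂-injective xs ys e in ⊥-elim (both (subst (Adj w′) ex w′x) (subst (Adj w′) ey w′y) (adj? w′ w))
          attached (firstTwo x y ys e w′x w′y far′) = ⊥-elim (opposite xs p far w′x w′y far′ e)

        growKite : (∃ λ w′ → All (w′ ≢_) ((xs ∷ʳ u) ++ v ∷ w ∷ []) × Any (Adj w′) ((xs ∷ʳ u) ++ v ∷ w ∷ []))
          ⊎ Closed ((xs ∷ʳ u) ++ v ∷ w ∷ []) → Result
        growKite (inj₁ (w′ , w′≢ , any)) = attached w′≢ any (attach w′ ((xs ∷ʳ u) ∷ʳ v) p (w′≢P w′≢ any))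
        growKite (inj₂ closed) = kite (xs ∷ʳ u) v w p pw (~-sym wv) , closed ,
          All.++⁺ (All.++⁻ˡ (xs ∷ʳ u) fr) (All.head (All.++⁻ʳ (xs ∷ʳ u) fr) ∷ w≢done ∷ []) , v , ∈-++⁺ʳ
            (xs ∷ʳ u) (here refl)

      growAttached : ∀ k P {w} → Path P → Fresh done P → n < length P ℕ.+ suc k → Any (Adj w) P → Attachment
        w P → Result
      growAttached k P p fr lt any (none far) = ⊥-elim (far-nonadjacent far any)
      growAttached k _ p fr lt any (first v vs refl wv far) = extendFirst k p fr wv far lt
      growAttached k _ p fr lt any (last xs v refl wv far) = extendLast k xs p fr wv far lt
      growAttached k _ p fr lt any (lastTwo xs u v refl wu wv far) = GrowKite.growKite k xs u v p fr wu wv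
        far lt (neighbour? _)
      growAttached k _ p fr lt any (firstTwo u v xs refl wu wv far) = GrowKite.growKite k (reverse xs) v u
        (subst Path rev (path-reverse p)) (subst (Fresh done) rev
          (All.tabulate λ x∈ → All.lookup fr (Any.reverse⁻ x∈))) wv wu
          (All.tabulate λ x∈ → All.lookup far (Any.reverse⁻ x∈))
        (subst (λ l → n < l ℕ.+ suc k) (trans (sym (List.length-reverse (u ∷ v ∷ xs))) (cong length rev))
          lt) (neighbour? _)
        where
        rev : reverse (u ∷ v ∷ xs) ≡ (reverse xs ∷ʳ v) ∷ʳ u
        rev = trans (List.unfold-reverse u (v ∷ xs)) (cong (_∷ʳ u) (List.unfold-reverse v xs))

      grow zero P p fr lt = ⊥-elim (ℕ.<⇒≱ lt (subst (_≤ n) (sym (ℕ.+-identityʳ (length P)))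
        (unique-length (path-unique p))))
      grow (suc k) P p fr lt = decide (neighbour? P)
        where
        member : ∀ {P} → Path P → ∃ λ v → v ∈ₚ P
        member point = _ , here refl
        member (cons _ _ _) = _ , here refl
        decide : (∃ λ w → All (w ≢_) P × Any (Adj w) P) ⊎ Closed P → Result
        decide (inj₁ (w , w≢ , any)) = growAttached k P p fr lt any (attach w P p w≢)
        decide (inj₂ closed) = path P p , closed , fr , member p

    vertices-unique : ∀ C → AllPairs _≢_ (vertices C)
    vertices-unique (path P p) = path-unique p
    vertices-unique (kite ts a b pa pb ab) = extend ts (path-unique pa) (path-unique pb)
      where
      extend : ∀ ts → AllPairs _≢_ (ts ∷ʳ a) → AllPairs _≢_ (ts ∷ʳ b) → AllPairs _≢_ (ts ++ a ∷ b ∷ [])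
      extend [] _ _ = (~⇒≢ ab ∷ []) ∷ [] ∷ []
      extend (t ∷ ts) (na ∷ ua) (nb ∷ ub) = All.++⁺ (All.++⁻ˡ ts na)
        (All.head (All.++⁻ʳ ts na) ∷ All.head (All.++⁻ʳ ts nb) ∷ []) ∷ extend ts ua ub

    allVertices : List Component → List (Fin n)
    allVertices [] = []
    allVertices (C ∷ Cs) = vertices C ++ allVertices Cs

    record Decomposition (Cs : List Component) : Set where
      field
        unique : AllPairs _≢_ (allVertices Cs)
        closed : All (λ C → Closed (vertices C)) Cs

    allVertices-closed : ∀ {Cs} → All (λ C → Closed (vertices C)) Cs → Closed (allVertices Cs)
    allVertices-closed {C ∷ Cs} (c ∷ cs) ne any with Any.++⁻ (vertices C) any
    ... | inj₁ p = c (All.++⁻ˡ (vertices C) ne) p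
    ... | inj₂ p = allVertices-closed cs (All.++⁻ʳ (vertices C) ne) p

    decompose : ∀ k Cs → Decomposition Cs → n < length (allVertices Cs) ℕ.+ k → ∃ λ Cs → Decomposition Cs ×
      ∀ v → v ∈ₚ allVertices Cs
    decompose zero Cs D lt = ⊥-elim (ℕ.<⇒≱ lt (subst (_≤ n) (sym (ℕ.+-identityʳ _))
      (unique-length (Decomposition.unique D))))
    decompose (suc k) Cs D lt = decide (Fin.any? (λ v → All.all? (λ x → ¬? (v Fin.≟ x)) (allVertices Cs)))
      where
      done = allVertices Cs
      done-closed = allVertices-closed (Decomposition.closed D)
      member : ∀ v xs → ¬ All (v ≢_) xs → v ∈ₚ xs
      member v [] ¬ne = ⊥-elim (¬ne [])
      member v (x ∷ xs) ¬ne with v Fin.≟ x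
      ... | yes e = here e
      ... | no ne = there (member v xs λ nes → ¬ne (ne ∷ nes))
      positive : ∀ {u} {xs : List (Fin n)} → u ∈ₚ xs → 1 ≤ length xs
      positive (here _) = s≤s z≤n
      positive (there _) = s≤s z≤n
      add : Grow.Result done done-closed → ∃ λ Cs → Decomposition Cs × ∀ v → v ∈ₚ allVertices Cs
      add (C , closed , fresh , u , u∈) = decompose k (C ∷ Cs)
        (record { unique = AllPairs.++⁺ (vertices-unique C) (Decomposition.unique D) fresh ; closed =
          closed ∷ Decomposition.closed D })
        (ℕ.≤-trans (subst (n <_) (ℕ.+-suc (length done) k) lt)
          (subst (λ l → suc (length done ℕ.+ k) ≤ l ℕ.+ k) (sym (List.length-++ (vertices C)))
            (ℕ.+-monoˡ-≤ k (ℕ.+-monoˡ-≤ (length done) (positive u∈)))))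
      decide : Dec (∃ λ v → All (v ≢_) done) → ∃ λ Cs → Decomposition Cs × ∀ v → v ∈ₚ allVertices Cs
      decide (no ¬v) = Cs , D , λ v → member v done λ ne → ¬v (v , ne)
      decide (yes (v , v∉)) = add (Grow.grow done done-closed n (v ∷ []) point (v∉ ∷ []) ℕ.≤-refl)

    decomposition : ∃ λ Cs → Decomposition Cs × ∀ v → v ∈ₚ allVertices Cs
    decomposition = decompose (suc n) [] (record { unique = [] ; closed = [] }) ℕ.≤-refl

standardBasis : ∀ n → Vec (Vec ℚ n) n
standardBasis ℕ.zero    = []
standardBasis (ℕ.suc n) = (1ℚ ∷ 0ᵥ) ∷ Vec.map (0ℚ ∷_) (standardBasis n)

linComb-0∷ : ∀ (cs : Vec ℚ d) (vs : Vec (Vec ℚ n) d) → linComb cs (Vec.map (0ℚ ∷_) vs) ≡ 0ℚ ∷ linComb cs vs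
linComb-0∷ [] [] = refl
linComb-0∷ (c ∷ cs) (v ∷ vs) rewrite linComb-0∷ cs vs = cong (_∷ ((c *ᵥ v) +ᵥ linComb cs vs))
  (trans (+-identityʳ (c * 0ℚ)) (*-zeroʳ c))

linComb-standardBasis : ∀ (cs : Vec ℚ n) → linComb cs (standardBasis n) ≡ cs
linComb-standardBasis [] = refl
linComb-standardBasis {ℕ.suc n} (c ∷ cs) rewrite linComb-0∷ cs (standardBasis n) | linComb-standardBasis cs =
  cong₂ _∷_ (trans (+-identityʳ (c * 1ℚ)) (*-identityʳ c))
    (vec-ext λ k → trans (lookup-+ᵥ (c *ᵥ 0ᵥ) cs k) (trans
      (cong (_+ Vec.lookup cs k) (trans (lookup-*ᵥ c 0ᵥ k) (trans (cong (c *_) (lookup-0ᵥ k)) (*-zeroʳ c))))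
      (+-identityˡ _)))

U-finite : FiniteDim {n} U
U-finite {n} = n , standardBasis n , (λ cs e → trans (sym (linComb-standardBasis cs)) e) ,
  (λ {x} _ → x , linComb-standardBasis x) , λ _ → _

-- Connected sets of a decomposed graph

infix 4 _≈ₗ_
_≈ₗ_ : Subset n → List (Fin n) → Set
I ≈ₗ p = ∀ u → u ∈ₛ I ⇔ u ∈ₚ p

sumOver-⊥ : ∀ (x : Vec ℚ n) → sumOver ⊥ₛ x ≡ 0ℚ
sumOver-⊥ [] = refl
sumOver-⊥ (a ∷ x) = sumOver-⊥ x

sumOver-⁅⁆ : ∀ (u : Fin n) x → sumOver ⁅ u ⁆ x ≡ Vec.lookup x u
sumOver-⁅⁆ zero (a ∷ x) = trans (cong (a +_) (sumOver-⊥ x)) (+-identityʳ a)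
sumOver-⁅⁆ (suc u) (a ∷ x) = sumOver-⁅⁆ u x

module _ {n : ℕ} where
  open DecMembership (Fin._≟_ {n}) using () renaming (_∈?_ to _∈ₚ?_)

  listSubset : List (Fin n) → Subset n
  listSubset p = fromDec (_∈ₚ? p)

  listSubset-≈ : ∀ p → listSubset p ≈ₗ p
  listSubset-≈ p = ∈-fromDec (_∈ₚ? p)

  sumOver-list : ∀ {p I} → AllPairs _≢_ p → I ≈ₗ p → ∀ x → sumOver I x ≡ sumForm p ⟨ x ⟩
  sumOver-list {[]} {I} [] e x = trans (cong (λ J → sumOver J x)
    (subset-ext {P = I} {⊥ₛ} (λ u u∈ → ⊥-elim (¬[] (to (e u) u∈))) λ u u∈ → ⊥-elim (∉⊥ u∈))) (sumOver-⊥ x)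
    where
    ¬[] : ∀ {u : Fin n} → ¬ u ∈ₚ []
    ¬[] ()
  sumOver-list {v ∷ p} {I} (v∉ ∷ uniq) e x =
    trans (sumOver-Sum split x) (cong₂ _+_ (sumOver-⁅⁆ v x) (sumOver-list uniq (listSubset-≈ p) x))
    where
    split : Sum ⁅ v ⁆ (listSubset p) I
    split = (λ u u∈ u∈p → All.lookup v∉ (to (listSubset-≈ p u) u∈p) (sym (x∈⁅y⁆⇒x≡y v u∈))) , λ u → mk⇔
      (λ u∈ → fwd u (to (e u) u∈)) (bwd u)
      where
      fwd : ∀ u → u ∈ₚ v ∷ p → u ∈ₛ ⁅ v ⁆ ⊎ u ∈ₛ listSubset p
      fwd u (here refl) = inj₁ (x∈⁅x⁆ u)
      fwd u (there u∈) = inj₂ (from (listSubset-≈ p u) u∈)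
      bwd : ∀ u → u ∈ₛ ⁅ v ⁆ ⊎ u ∈ₛ listSubset p → u ∈ₛ I
      bwd u (inj₁ u∈) = from (e u) (here (x∈⁅y⁆⇒x≡y v u∈))
      bwd u (inj₂ u∈) = from (e u) (there (to (listSubset-≈ p u) u∈))

  extensions-full : ∀ (E : List (List (Fin n))) p ts → p ++ ts ∈ₚ extensions E p ts
  extensions-full E p [] = here (List.++-identityʳ p)
  extensions-full E p (t ∷ ts) = there (subst (_∈ₚ extensions E (p ∷ʳ t) ts) (List.++-assoc p (t ∷ []) ts)
    (extensions-full E (p ∷ʳ t) ts))

  extensions-end : ∀ {E : List (List (Fin n))} {e} p ts → e ∈ₚ E → (p ++ ts) ++ e ∈ₚ extensions E p ts
  extensions-end {E} {e} p [] e∈ = there (subst (λ q → q ++ e ∈ₚ map (p ++_) E) (sym (List.++-identityʳ p))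
    (Any.map⁺ (Any.map (λ { refl → refl }) e∈)))
  extensions-end {E} {e} p (t ∷ ts) e∈ = there (subst (λ q → q ++ e ∈ₚ extensions E (p ∷ʳ t) ts)
    (List.++-assoc p (t ∷ []) ts) (extensions-end (p ∷ʳ t) ts e∈))

module Pieces {n} (G : SimpleGraph n) where
  open SimpleGraph G
  open Graph G
  open DecMembership (Fin._≟_ {n}) using () renaming (_∈?_ to _∈ₚ?_)

  Linked : List (Fin n) → Set
  Linked p = ∀ {u v} → u ∈ₚ p → v ∈ₚ p → Star (λ x y → x ∈ₚ p × y ∈ₚ p × Adj x y) u v

  record Piece (p : List (Fin n)) : Set where
    field
      inhabited : ∃ λ u → u ∈ₚ p
      unique    : AllPairs _≢_ p
      linked    : Linked p

  path-piece : ∀ {p} → Path p → Piece p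
  path-piece pth = record { inhabited = inh pth ; unique = path-unique pth ; linked = path-linked pth }
    where
    inh : ∀ {p} → Path p → ∃ λ u → u ∈ₚ p
    inh point = _ , here refl
    inh (cons _ _ _) = _ , here refl

  snoc-linked : ∀ {p x b} → Linked p → x ∈ₚ p → Adj x b → Linked (p ∷ʳ b)
  snoc-linked {p} {x} {b} lk x∈ xb u∈ v∈ = go (∈-++⁻ p u∈) (∈-++⁻ p v∈)
    where
    lift : ∀ {u v} → u ∈ₚ p → v ∈ₚ p → Star (λ x y → x ∈ₚ p ∷ʳ b × y ∈ₚ p ∷ʳ b × Adj x y) u v
    lift u∈ v∈ = Star.map (λ { (x , y , e) → ∈-++⁺ˡ x , ∈-++⁺ˡ y , e }) (lk u∈ v∈)
    last∈ : b ∈ₚ p ∷ʳ b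
    last∈ = ∈-++⁺ʳ p (here refl)
    go : ∀ {u v} → u ∈ₚ p ⊎ u ∈ₚ b ∷ [] → v ∈ₚ p ⊎ v ∈ₚ b ∷ [] → Star (λ x y → x ∈ₚ p ∷ʳ b × y ∈ₚ p ∷ʳ b × Adj x y) u v
    go (inj₁ u∈) (inj₁ v∈) = lift u∈ v∈
    go (inj₁ u∈) (inj₂ (here refl)) = lift u∈ x∈ ◅◅ (∈-++⁺ˡ x∈ , last∈ , xb) ◅ ε
    go (inj₂ (here refl)) (inj₁ v∈) = (last∈ , ∈-++⁺ˡ x∈ , ~-sym xb) ◅ lift x∈ v∈
    go (inj₂ (here refl)) (inj₂ (here refl)) = ε

  piece-connected : ∀ {p} → Piece p → Connected G (listSubset p)
  piece-connected {p} pc = (proj₁ inhabited , from (listSubset-≈ p _) (proj₂ inhabited)) ,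
    λ u u∈ v v∈ → Star.map (λ { (x , y , e) → from (listSubset-≈ p _) x , from (listSubset-≈ p _) y , e })
      (linked (to (listSubset-≈ p u) u∈) (to (listSubset-≈ p v) v∈))
    where open Piece pc

  extensions-pieces : ∀ {E} p ts → (∃ λ u → u ∈ₚ p) → Path (p ++ ts) → All (λ e → Piece ((p ++ ts) ++ e)) E
    → All Piece (extensions E p ts)
  extensions-pieces p [] _ pth PE = path-piece (subst Path (List.++-identityʳ p) pth) ∷ All.map⁺
    (All.map (λ {e} → subst (λ q → Piece (q ++ e)) (List.++-identityʳ p)) PE)
  extensions-pieces {E} [] (t ∷ ts) (_ , ())
  extensions-pieces {E} (x ∷ p) (t ∷ ts) (u , u∈) pth PE = path-piece (path-++ˡ x p pth) ∷
    extensions-pieces ((x ∷ p) ∷ʳ t) ts (u , ∈-++⁺ˡ u∈) (subst Path (sym assoc) pth)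
      (subst (λ q → All (λ e → Piece (q ++ e)) E) (sym assoc) PE)
    where
    assoc : ((x ∷ p) ∷ʳ t) ++ ts ≡ (x ∷ p) ++ t ∷ ts
    assoc = List.++-assoc (x ∷ p) (t ∷ []) ts

  apexPieces : Fin n → Fin n → List (Fin n) → List (List (Fin n))
  apexPieces a b [] = (a ∷ []) ∷ (b ∷ []) ∷ []
  apexPieces a b (t ∷ ts) = ((t ∷ ts) ∷ʳ a) ∷ apexPieces a b ts

  path-drop : ∀ t ts {a} → Path ((t ∷ ts) ∷ʳ a) → Path (ts ∷ʳ a)
  path-drop t [] p = point
  path-drop t (s ∷ ts) (cons _ _ p) = p

  module _ {a b : Fin n} (ab : Adj a b) where
    open KiteConfig using (ends)

    apex-pieces : ∀ ts → Path (ts ∷ʳ a) → All Piece (apexPieces a b ts)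
    apex-pieces [] _ = path-piece point ∷ path-piece point ∷ []
    apex-pieces (t ∷ ts) p = path-piece p ∷ apex-pieces ts (path-drop t ts p)

    tail-pieces : ∀ ts → Path (ts ∷ʳ a) → Path (ts ∷ʳ b) → All (All Piece)
      (tailBlocks ((b ∷ []) ∷ (a ∷ b ∷ []) ∷ []) ts)
    tail-pieces [] _ _ = []
    tail-pieces (t ∷ ts) pa pb =
      extensions-pieces (t ∷ []) ts (t , here refl) (path-++ˡ t ts pa)
        (path-piece pb ∷ subst Piece (List.++-assoc (t ∷ ts) (a ∷ []) (b ∷ [])) (record
          { inhabited = t , here refl
          ; unique = AllPairs.++⁺ (path-unique pa) ([] ∷ [])
            (All.++⁺ (All.tabulate λ x∈ → snoc-≢ (t ∷ ts) (path-unique pb) x∈ ∷ []) ((~⇒≢ ab ∷ []) ∷ []))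
          ; linked = snoc-linked (path-linked pa) (∈-++⁺ʳ (t ∷ ts) (here refl)) ab }) ∷ []) ∷
      tail-pieces ts (path-drop t ts pa) (path-drop t ts pb)
      where
      snoc-≢ : ∀ xs → AllPairs _≢_ (xs ∷ʳ b) → ∀ {x} → x ∈ₚ xs → x ≢ b
      snoc-≢ (x ∷ xs) (ne ∷ _) (here refl) = All.head (All.++⁻ʳ xs ne)
      snoc-≢ (x ∷ xs) (_ ∷ u) (there x∈) = snoc-≢ xs u x∈

  path-pieces : ∀ ts → (ts ≡ [] ⊎ Path ts) → All (All Piece) (tailBlocks [] ts)
  path-pieces [] _ = []
  path-pieces (t ∷ ts) (inj₂ p) = extensions-pieces (t ∷ []) ts (t , here refl) p [] ∷ path-pieces ts (rest p)
    where
    rest : ∀ {ts} → Path (t ∷ ts) → ts ≡ [] ⊎ Path ts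
    rest point = inj₁ refl
    rest (cons _ _ p) = inj₂ p

  module _ {I : Subset n} (conn : Connected G I) where

    boundary : ∀ xs {u v} → u ∈ₛ I → u ∈ₚ xs → v ∈ₛ I → v ∉ₚ xs → ∃₂ λ x y → x ∈ₚ xs × y ∈ₛ I × y ∉ₚ xs × Adj x y
    boundary xs {u} {v} u∈I u∈ v∈I v∉ = walk (proj₂ conn u u∈I v v∈I) u∈
      where
      walk : ∀ {u} → Star (InducedAdj G I) u v → u ∈ₚ xs → ∃₂ λ x y → x ∈ₚ xs × y ∈ₛ I × y ∉ₚ xs × Adj x y
      walk ε u∈ = ⊥-elim (v∉ u∈)
      walk (_◅_ {j = w} (_ , w∈I , uw) s) u∈ with w ∈ₚ? xs
      ... | yes w∈ = walk s w∈
      ... | no w∉ = _ , w , u∈ , w∈I , w∉ , uw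

    module _ (es L : List (Fin n)) (cross : ∀ q s r → L ≡ q ++ s ∷ r → All (λ x → Far x (r ++ es)) q) (bound : ∀ u → u ∈ₛ I → u ∈ₚ L ++ es) where

      run : ∀ {E} p ts → L ≡ p ++ ts → (∃ λ u → u ∈ₚ p) → All (_∈ₛ I) p → Any (I ≈ₗ_) (extensions E p ts) ⊎
        All (_∈ₛ I) L
      run p [] e _ p⊆ = inj₂ (subst (All (_∈ₛ I)) (sym (trans e (List.++-identityʳ p))) p⊆)
      run p (t ∷ ts) e (u , u∈) p⊆ with t ∈ₛ? I
      ... | yes t∈ = Sum.map₁ there (run (p ∷ʳ t) ts (trans e (sym (List.++-assoc p (t ∷ []) ts)))
        (u , ∈-++⁺ˡ u∈) (All.++⁺ p⊆ (t∈ ∷ [])))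
      ... | no t∉ = inj₁ (here λ v → mk⇔ (I⊆p v) (All.lookup p⊆))
        where
        I⊆p : ∀ v → v ∈ₛ I → v ∈ₚ p
        I⊆p v v∈ with v ∈ₚ? p
        ... | yes q = q
        ... | no v∉ with boundary p (All.lookup p⊆ u∈) u∈ v∈ v∉
        ...   | x , y , x∈ , y∈I , y∉ , xy with ∈-++⁻ p (subst (y ∈ₚ_)
          (trans (cong (_++ es) e) (List.++-assoc p (t ∷ ts) es)) (bound y y∈I))
        ...     | inj₁ y∈p = ⊥-elim (y∉ y∈p)
        ...     | inj₂ (here refl) = ⊥-elim (t∉ y∈I)
        ...     | inj₂ (there y∈r) = ⊥-elim (proj₂ (All.lookup (All.lookup (cross p t ts e) x∈) y∈r) xy)

    path-contains : ∀ ts → (ts ≡ [] ⊎ Path ts) → (∀ u → u ∈ₛ I → u ∈ₚ ts) → Any (Any (I ≈ₗ_)) (tailBlocks [] ts)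
    path-contains [] _ bound with bound _ (proj₂ (proj₁ conn))
    ... | ()
    path-contains (t ∷ ts) (inj₂ p) bound with t ∈ₛ? I
    ... | no t∉ = there (path-contains ts (rest p) λ u u∈ → drop u u∈ (bound u u∈))
      where
      rest : ∀ {ts} → Path (t ∷ ts) → ts ≡ [] ⊎ Path ts
      rest point = inj₁ refl
      rest (cons _ _ p) = inj₂ p
      drop : ∀ u → u ∈ₛ I → u ∈ₚ t ∷ ts → u ∈ₚ ts
      drop u u∈ (here refl) = ⊥-elim (t∉ u∈)
      drop u u∈ (there u∈′) = u∈′
    ... | yes t∈ = here (done (run [] (t ∷ ts) cross (λ u u∈ → ∈-++⁺ˡ (bound u u∈)) (t ∷ []) ts refl
      (t , here refl) (t∈ ∷ [])))
      where
      cross : ∀ q s r → t ∷ ts ≡ q ++ s ∷ r → All (λ x → Far x (r ++ [])) q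
      cross q s r e = subst (λ l → All (λ x → Far x l) q) (sym (List.++-identityʳ r)) (path-cross q (subst Path e p))
      done : Any (I ≈ₗ_) (extensions [] (t ∷ []) ts) ⊎ All (_∈ₛ I) (t ∷ ts) → Any (I ≈ₗ_) (extensions [] (t ∷ []) ts)
      done (inj₁ r) = r
      done (inj₂ all) = lose (extensions-full [] (t ∷ []) ts) λ u → mk⇔ (bound u) (All.lookup all)

    module _ {a b : Fin n} (ab : Adj a b) where
      private
        E : List (List (Fin n))
        E = (b ∷ []) ∷ (a ∷ b ∷ []) ∷ []

      kite-contains : ∀ ts → Path (ts ∷ʳ a) → Path (ts ∷ʳ b) → (∀ u → u ∈ₛ I → u ∈ₚ ts ++ a ∷ b ∷ []) →
        Any (I ≈ₗ_) (apexPieces a b ts) ⊎ Any (Any (I ≈ₗ_)) (tailBlocks E ts) ⊎ I ≈ₗ a ∷ b ∷ []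
      kite-contains [] pa pb bound with a ∈ₛ? I | b ∈ₛ? I
      ... | yes a∈ | yes b∈ = inj₂ (inj₂ λ u → mk⇔ (bound u) λ { (here refl) → a∈ ; (there (here refl)) → b∈ })
      ... | yes a∈ | no b∉ = inj₁ (here λ u → mk⇔ (λ u∈ → only u u∈ (bound u u∈)) λ { (here refl) → a∈ })
        where
        only : ∀ u → u ∈ₛ I → u ∈ₚ a ∷ b ∷ [] → u ∈ₚ a ∷ []
        only u u∈ (here e) = here e
        only u u∈ (there (here refl)) = ⊥-elim (b∉ u∈)
      ... | no a∉ | yes b∈ = inj₁ (there (here λ u → mk⇔ (λ u∈ → only u u∈ (bound u u∈)) λ { (here refl) → b∈ }))
        where
        only : ∀ u → u ∈ₛ I → u ∈ₚ a ∷ b ∷ [] → u ∈ₚ b ∷ []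
        only u u∈ (here refl) = ⊥-elim (a∉ u∈)
        only u u∈ (there u∈′) = u∈′
      ... | no a∉ | no b∉ with bound _ (proj₂ (proj₁ conn)) | proj₂ (proj₁ conn)
      ...   | here refl | u∈ = ⊥-elim (a∉ u∈)
      ...   | there (here refl) | u∈ = ⊥-elim (b∉ u∈)
      kite-contains (t ∷ ts) pa pb bound with t ∈ₛ? I
      ... | no t∉ = Sum.map there (Sum.map₁ there) (kite-contains ts (path-drop t ts pa) (path-drop t ts pb)
        λ u u∈ → drop u u∈ (bound u u∈))
        where
        drop : ∀ u → u ∈ₛ I → u ∈ₚ t ∷ ts ++ a ∷ b ∷ [] → u ∈ₚ ts ++ a ∷ b ∷ []
        drop u u∈ (here refl) = ⊥-elim (t∉ u∈)
        drop u u∈ (there u∈′) = u∈′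
      ... | yes t∈ = done (run (a ∷ b ∷ []) (t ∷ ts) cross bound (t ∷ []) ts refl (t , here refl) (t∈ ∷ []))
        where
        cross : ∀ q s r → t ∷ ts ≡ q ++ s ∷ r → All (λ x → Far x (r ++ a ∷ b ∷ [])) q
        cross q s r e = All.zipWith (λ { (fa , fb) → All.++⁺ (All.++⁻ˡ r fa)
          (All.head (All.++⁻ʳ r fa) ∷ All.head (All.++⁻ʳ r fb) ∷ []) }) (along pa , along pb)
          where
          along : ∀ {c} → Path ((t ∷ ts) ∷ʳ c) → All (λ x → Far x (r ∷ʳ c)) q
          along {c} p = path-cross q (subst Path (trans (cong (_∷ʳ c) e) (List.++-assoc q (s ∷ r) (c ∷ []))) p)
        done : Any (I ≈ₗ_) (extensions E (t ∷ []) ts) ⊎ All (_∈ₛ I) (t ∷ ts) → _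
        done (inj₁ r) = inj₂ (inj₁ (here r))
        done (inj₂ all) = full (a ∈ₛ? I) (b ∈ₛ? I)
          where
          fill : ∀ {es} → All (_∈ₛ I) es → (∀ u → u ∈ₛ I → u ∈ₚ a ∷ b ∷ [] → u ∈ₚ es) → I ≈ₗ (t ∷ ts) ++ es
          fill es⊆ sub u = mk⇔ (λ u∈ → Sum.[ ∈-++⁺ˡ , (λ r → ∈-++⁺ʳ (t ∷ ts) (sub u u∈ r)) ]′
            (∈-++⁻ (t ∷ ts) (bound u u∈))) (All.lookup (All.++⁺ all es⊆))
          full : Dec (a ∈ₛ I) → Dec (b ∈ₛ I) → Any (I ≈ₗ_) (apexPieces a b (t ∷ ts)) ⊎ Any (Any (I ≈ₗ_))
            (tailBlocks E (t ∷ ts)) ⊎ I ≈ₗ a ∷ b ∷ []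
          full (yes a∈) (yes b∈) = inj₂ (inj₁ (here (lose (extensions-end (t ∷ []) ts (there (here refl)))
            (fill (a∈ ∷ b∈ ∷ []) λ _ _ r → r))))
          full (yes a∈) (no b∉) = inj₁ (here (fill (a∈ ∷ []) λ { _ _ (here e) → here e ; _ u∈ (there (here refl)) → ⊥-elim (b∉ u∈) }))
          full (no a∉) (yes b∈) = inj₂ (inj₁ (here (lose (extensions-end (t ∷ []) ts (here refl))
            (fill (b∈ ∷ []) λ { _ u∈ (here refl) → ⊥-elim (a∉ u∈) ; _ _ (there r) → r }))))
          full (no a∉) (no b∉) = inj₂ (inj₁ (here (lose (extensions-full E (t ∷ []) ts)
            (subst (I ≈ₗ_) (List.++-identityʳ (t ∷ ts)) (fill {[]} [] λ { _ u∈ (here refl) → ⊥-elim (a∉ u∈) ; _ u∈ (there (here refl)) → ⊥-elim (b∉ u∈) })))))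

module Assemble {n} (G : SimpleGraph n) (no-claw : ¬ Model claw G) (no-square : ¬ Model square G) (no-diamond : ¬ Model diamond G)
  (no-K₄ : ¬ Model K₄ G) (no-butterfly : ¬ Model butterfly G) where
  open SimpleGraph G
  open Graph G
  open Excluded no-claw no-square no-diamond no-K₄ no-butterfly
  open Pieces G

  kiteEnds : Fin n → Fin n → List (List (Fin n))
  kiteEnds a b = (b ∷ []) ∷ (a ∷ b ∷ []) ∷ []

  blocks : List Component → List (List (List (Fin n)))
  blocks [] = []
  blocks (path P _ ∷ Cs) = tailBlocks [] P ++ blocks Cs
  blocks (kite ts a b _ _ _ ∷ Cs) = apexPieces a b ts ∷ tailBlocks (kiteEnds a b) ts ++ ((a ∷ b ∷ []) ∷ []) ∷ blocks Cs

  AllPairs-++⁻ʳ : ∀ xs {ys : List (Fin n)} → AllPairs _≢_ (xs ++ ys) → AllPairs _≢_ ys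
  AllPairs-++⁻ʳ [] u = u
  AllPairs-++⁻ʳ (x ∷ xs) (_ ∷ u) = AllPairs-++⁻ʳ xs u

  blocks-good : ∀ Cs → AllPairs _≢_ (allVertices Cs) → Good (allVertices Cs) (sumBlocks (blocks Cs))
  blocks-good [] _ = record { supported = [] ; factored = λ V-dim _ → empty (proj₂ V-dim) }
  blocks-good (path P _ ∷ Cs) u = subst (Good (P ++ allVertices Cs))
    (sym (List.map-++ (map sumForm) (tailBlocks [] P) (blocks Cs)))
    (path-good P u (blocks-good Cs (AllPairs-++⁻ʳ P u)))
  blocks-good (kite ts a b _ _ _ ∷ Cs) u = subst₂ Good (sym (List.++-assoc ts (a ∷ b ∷ []) (allVertices Cs)))
    (cong₂ _∷_ (apex-pieces-sum ts) (sym (List.map-++ (map sumForm) (tailBlocks (kiteEnds a b) ts)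
      (((a ∷ b ∷ []) ∷ []) ∷ blocks Cs))))
    (kite-good (AllPairs.head u₂) (AllPairs.head (AllPairs.tail u₂)) false ts u₁)
    where
    u₁ : AllPairs _≢_ (ts ++ a ∷ b ∷ allVertices Cs)
    u₁ = subst (AllPairs _≢_) (List.++-assoc ts (a ∷ b ∷ []) (allVertices Cs)) u
    u₂ : AllPairs _≢_ (a ∷ b ∷ allVertices Cs)
    u₂ = AllPairs-++⁻ʳ ts u₁
    open KiteConfig (blocks-good Cs (AllPairs.tail (AllPairs.tail u₂))) a b
    apex-pieces-sum : ∀ ts → apex false ts ≡ map sumForm (apexPieces a b ts)
    apex-pieces-sum [] = refl
    apex-pieces-sum (t ∷ ts) = cong (_ ∷_) (apex-pieces-sum ts)

  blocks-pieces : ∀ Cs → All (All Piece) (blocks Cs)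
  blocks-pieces [] = []
  blocks-pieces (path P p ∷ Cs) = All.++⁺ (path-pieces P (inj₂ p)) (blocks-pieces Cs)
  blocks-pieces (kite ts a b pa pb ab ∷ Cs) = apex-pieces ab ts pa ∷ All.++⁺ (tail-pieces ab ts pa pb)
    ((path-piece (cons ab [] point) ∷ []) ∷ blocks-pieces Cs)

  closed-contains : ∀ {I xs} → Connected G I → Closed xs → ∀ {v} → v ∈ₛ I → v ∈ₚ xs → ∀ u → u ∈ₛ I → u ∈ₚ xs
  closed-contains {I} {xs} (_ , conn) closed {v} v∈I v∈ u u∈I = walk (conn v v∈I u u∈I) v∈
    where
    open DecMembership (Fin._≟_ {n}) using () renaming (_∈?_ to _∈ₚ?_)
    walk : ∀ {v u} → Star (InducedAdj G I) v u → v ∈ₚ xs → u ∈ₚ xs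
    walk ε v∈ = v∈
    walk (_◅_ {j = w} (_ , _ , vw) s) v∈ with w ∈ₚ? xs
    ... | yes w∈ = walk s w∈
    ... | no w∉ = ⊥-elim (closed (All.tabulate λ x∈ → λ { refl → w∉ x∈ }) (lose v∈ (~-sym vw)))

  blocks-contain : ∀ Cs {I} → Connected G I → All (λ C → Closed (vertices C)) Cs → ∀ {v} → v ∈ₛ I → v ∈ₚ
    allVertices Cs → Any (Any (I ≈ₗ_)) (blocks Cs)
  blocks-contain (C ∷ Cs) {I} conn (c ∷ cs) {v} v∈I v∈ with ∈-++⁻ (vertices C) v∈
  blocks-contain (path P p ∷ Cs) conn (c ∷ cs) v∈I _ | inj₁ v∈ = Any.++⁺ˡ
    (path-contains conn P (inj₂ p) (closed-contains conn c v∈I v∈))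
  blocks-contain (kite ts a b pa pb ab ∷ Cs) conn (c ∷ cs) v∈I _ | inj₁ v∈ with kite-contains conn ab ts pa
    pb (closed-contains conn c v∈I v∈)
  ... | inj₁ p = here p
  ... | inj₂ (inj₁ p) = there (Any.++⁺ˡ p)
  ... | inj₂ (inj₂ p) = there (Any.++⁺ʳ (tailBlocks (kiteEnds a b) ts) (here (here p)))
  blocks-contain (path P p ∷ Cs) conn (c ∷ cs) v∈I _ | inj₂ v∈ = Any.++⁺ʳ (tailBlocks [] P)
    (blocks-contain Cs conn cs v∈I v∈)
  blocks-contain (kite ts a b _ _ _ ∷ Cs) conn (c ∷ cs) v∈I _ | inj₂ v∈ =
    there (Any.++⁺ʳ (tailBlocks (kiteEnds a b) ts) (there (blocks-contain Cs conn cs v∈I v∈)))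

  inductivelyFactored : InductivelyFactored U (connectedSubgraphArrangement G)
  inductivelyFactored = assemble decomposition
    where
    assemble : (∃ λ Cs → Decomposition Cs × ∀ v → v ∈ₚ allVertices Cs) → InductivelyFactored U
      (connectedSubgraphArrangement G)
    assemble (Cs , D , covers) = _ , IF-resp ≐-refl (into , onto) (Pointwise.refl ≋-refl)
        (factored (blocks-good Cs (Decomposition.unique D)) U-finite (λ y → y , _ , All.tabulate λ _ → refl))
      where
      open Good
      hyperplane-≐ : ∀ {p I} → AllPairs _≢_ p → I ≈ₗ p → hyperplane I ≐ (U ∩ ker (sumForm p))
      hyperplane-≐ uniq e = (λ h → _ , trans (sym (sumOver-list uniq e _)) h) ,
        (λ { (_ , h) → trans (sumOver-list uniq e _) h })
      into : concat (real U (sumBlocks (blocks Cs))) ⊆ₗ connectedSubgraphArrangement G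
      into {H} H∈ = pieces (blocks Cs) (blocks-pieces Cs) (Any.map⁻ (Any.map⁻ (to concat-∈ H∈)))
        where
        pieces : ∀ bs → All (All Piece) bs → Any (λ B → H ∈ block U (map sumForm B)) bs → H ∈
          connectedSubgraphArrangement G
        pieces (B ∷ bs) (P ∷ Ps) (there any) = pieces bs Ps any
        pieces (B ∷ bs) (P ∷ Ps) (here H∈) = one B P (Any.map⁻ (block-∈ H∈))
          where
          one : ∀ B → All Piece B → Any (λ p → H ≐ (U ∩ ker (sumForm p))) B → H ∈ connectedSubgraphArrangement G
          one (p ∷ B) (P ∷ Ps) (there any) = one B Ps any
          one (p ∷ B) (P ∷ Ps) (here e) = ∈-resp (≐-trans (hyperplane-≐ (Piece.unique P) (listSubset-≈ p))
            (≐-sym e)) (connected⇒∈ G (piece-connected P))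
      onto : connectedSubgraphArrangement G ⊆ₗ concat (real U (sumBlocks (blocks Cs)))
      onto {H} H∈ with ∈⇒connected G H∈
      ... | I , conn , H≐ = from concat-∈ (Any.map⁺ (Any.map⁺
        (find-in (blocks Cs) (blocks-pieces Cs) (blocks-contain Cs conn (Decomposition.closed D)
        (proj₂ (proj₁ conn)) (covers _)))))
        where
        find-in : ∀ bs → All (All Piece) bs → Any (Any (I ≈ₗ_)) bs → Any (λ B → H ∈ block U (map sumForm B)) bs
        find-in (B ∷ bs) (P ∷ Ps) (there any) = there (find-in bs Ps any)
        find-in (B ∷ bs) (P ∷ Ps) (here any) = here (∈-block {V = U} {C = map sumForm B} (Any.map⁺ (one B P any)))
          where
          one : ∀ B → All Piece B → Any (I ≈ₗ_) B → Any (λ p → H ≐ (U ∩ ker (sumForm p))) B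
          one (p ∷ B) (P ∷ Ps) (there any) = there (one B Ps any)
          one (p ∷ B) (P ∷ Ps) (here e) = here (≐-trans H≐ (hyperplane-≐ (Piece.unique P) e))

factored⇒inductivelyFactored : ∀ (G : SimpleGraph n) → Factored U (connectedSubgraphArrangement G) →
  InductivelyFactored U (connectedSubgraphArrangement G)
factored⇒inductivelyFactored G (arr , _ , part , nice) = Assemble.inductivelyFactored G
  (λ μ → ¬colouring-claw (Pullback.pullback μ χ)) (λ μ → ¬colouring-square (Pullback.pullback μ χ))
    (λ μ → ¬colouring-diamond (Pullback.pullback μ χ))
  (λ μ → ¬colouring-K₄ (Pullback.pullback μ χ)) (λ μ → ¬colouring-butterfly (Pullback.pullback μ χ))
  where
  χ : Colouring G
  χ = nice⇒colouring arr part nice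

mainTheorem6 : (n : ℕ) (G : SimpleGraph n) →
    Factored U (connectedSubgraphArrangement G) ⇔ InductivelyFactored U (connectedSubgraphArrangement G)
mainTheorem6 n G = mk⇔ (factored⇒inductivelyFactored G) inductivelyFactored⇒factored
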